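{- For every integer $k\geq 3$, the problem List $k$-Coloring on $n$-vertex (bull, chair)-free graphs can be solved in time $n^{\mathcal{O}(k^2)}$.
   Context: All graphs are finite, simple and undirected. For graphs $F_1,\ldots,F_m$, a graph $G$ is $(F_1,\ldots,F_m)$-free if no $F_i$ is isomorphic to an induced subgraph of $G$. The bull is the 5-vertex graph consisting of a triangle together with two pendant vertices attached to two distinct vertices of the triangle. The chair is the 5-vertex graph obtained from the star $K_{1,3}$ by subdividing one edge exactly once. Problem List $k$-Coloring. Input: a graph $G$ and, for each vertex $v$, a list $L(v)\subseteq\{1,\ldots,k\}$. Question: does $G$ admit a proper coloring (adjacent vertices get distinct colors) that assigns to each vertex $v$ a color from $L(v)$? -}

module Defs where

open import Data.Bool.Base using (Bool; true; false; if_then_else_; _∨_)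
open import Data.Bool.Properties using (∨-comm) renaming (_≟_ to _≟ᵇ_)
open import Data.Fin.Base using (Fin)
open import Data.Fin.Patterns using (0F; 1F; 2F; 3F; 4F)
open import Data.Fin.Properties using (all?) renaming (_≟_ to _≟ᶠ_)
open import Data.Fin.Subset using (Subset; _∈_)
open import Data.List.Base using (List; []; _∷_; _++_; concat; tabulate)
open import Data.List.Relation.Unary.All using (All)
open import Data.Nat.Base using (ℕ; zero; suc; _+_; _∸_; _≡ᵇ_)
open import Data.Product.Base using (∃; ∃-syntax; Σ-syntax; _×_; _,_; proj₁)
open import Data.Product.Properties using (≡-dec)
open import Data.Vec.Base using (lookup)
open import Function.Bundles using (_↔_; Inverse)
open import Relation.Binary.PropositionalEquality using (_≡_; _≢_)
open import Relation.Nullary.Decidable using (does; True; toWitness)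
open import Relation.Nullary.Negation using (¬_)
open import Relation.Nullary.Reflects using (Reflects)
import Data.List.Membership.DecPropositional as DecMembership

------------------------------------------------------------------------
-- Graphs

record Graph (V : Set) : Set where
  field
    adj    : V → V → Bool
    sym    : ∀ u v → adj u v ≡ adj v u
    irrefl : ∀ v → adj v v ≡ false

open Graph public

FiniteGraph : Set
FiniteGraph = ∃[ m ] Graph (Fin m)

_≅_ : ∀ {V W} → Graph V → Graph W → Set
_≅_ {V} {W} G H =
  Σ[ φ ∈ V ↔ W ] (∀ u v → adj G u v ≡ adj H (Inverse.to φ u) (Inverse.to φ v))

_[_] : ∀ {n} → Graph (Fin n) → (S : Subset n) → Graph (∃ (_∈ S))
G [ S ] = record
  { adj    = λ u v → adj G (proj₁ u) (proj₁ v)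
  ; sym    = λ u v → sym G (proj₁ u) (proj₁ v)
  ; irrefl = λ v → irrefl G (proj₁ v)
  }

Free : ∀ {n} → List FiniteGraph → Graph (Fin n) → Set
Free {n} Fs G = All (λ (_ , F) → ¬ (∃[ S ] F ≅ (G [ S ]))) Fs

isEdge : ∀ {m} → List (Fin m × Fin m) → Fin m → Fin m → Bool
isEdge E u v = does ((u , v) ∈? E) ∨ does ((v , u) ∈? E)
  where open DecMembership (≡-dec _≟ᶠ_ _≟ᶠ_) using (_∈?_)

fromEdges : ∀ {m} (E : List (Fin m × Fin m))
            {_ : True (all? λ v → isEdge E v v ≟ᵇ false)} → Graph (Fin m)
fromEdges E {loopless} = record
  { adj    = isEdge E
  ; sym    = λ u v → ∨-comm (does ((u , v) ∈? E)) (does ((v , u) ∈? E))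
  ; irrefl = toWitness loopless
  }
  where open DecMembership (≡-dec _≟ᶠ_ _≟ᶠ_) using (_∈?_)

bull : FiniteGraph
bull = 5 , fromEdges
  ((0F , 1F) ∷ (1F , 2F) ∷ (0F , 2F) ∷ (0F , 3F) ∷ (1F , 4F) ∷ [])

-- The star with centre 0 and leaves 1, 2, 4, its edge 0–4 subdivided by 3.
chair : FiniteGraph
chair = 5 , fromEdges
  ((0F , 1F) ∷ (0F , 2F) ∷ (0F , 3F) ∷ (3F , 4F) ∷ [])

------------------------------------------------------------------------
-- List colouring; the colours 1, …, k are the elements of Fin k.

ListColourable : ∀ {V k} → Graph V → (V → Subset k) → Set
ListColourable {V} {k} G L =
  Σ[ f ∈ (V → Fin k) ]
    (∀ v → f v ∈ L v) × (∀ u v → adj G u v ≡ true → f u ≢ f v)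

------------------------------------------------------------------------
-- Algorithms: a unit-cost random access machine with indirect addressing,
-- addition and truncated subtraction, in structured form.  A program is
-- finite and fixed, so using while/if instead of jumps changes running times
-- by a constant factor only.  There is deliberately no unit-cost
-- multiplication or shift: t steps lengthen the binary representation of the
-- numbers stored by at most O(t) bits, so time on this machine and on a
-- Turing machine are polynomially related.

Memory : Set
Memory = ℕ → ℕ

_[_↦_] : Memory → ℕ → ℕ → Memory
(σ [ a ↦ x ]) b = if a ≡ᵇ b then x else σ b

infixl 6 _⊕_ _⊖_

data Expr : Set where
  lit     : ℕ → Expr
  mem     : Expr → Expr
  _⊕_ _⊖_ : Expr → Expr → Expr

⟦_⟧ : Expr → Memory → ℕ
⟦ lit x ⟧   σ = x
⟦ mem e ⟧   σ = σ (⟦ e ⟧ σ)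
⟦ e₁ ⊕ e₂ ⟧ σ = ⟦ e₁ ⟧ σ + ⟦ e₂ ⟧ σ
⟦ e₁ ⊖ e₂ ⟧ σ = ⟦ e₁ ⟧ σ ∸ ⟦ e₂ ⟧ σ

-- One step for every literal, memory access and arithmetic operation.
cost : Expr → ℕ
cost (lit _)   = 1
cost (mem e)   = suc (cost e)
cost (e₁ ⊕ e₂) = suc (cost e₁ + cost e₂)
cost (e₁ ⊖ e₂) = suc (cost e₁ + cost e₂)

infix  5 mem[_]≔_
infixr 4 _⨾_

data Program : Set where
  skip     : Program
  mem[_]≔_ : Expr → Expr → Program
  _⨾_      : Program → Program → Program
  if       : Expr → Program → Program → Program
  while    : Expr → Program → Program

-- ⟨ p , σ ⟩⇓[ t ] τ : started in memory σ, the program p halts after exactly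
-- t steps in memory τ.  A test succeeds when its value is nonzero.  Execution
-- is deterministic, and a non-terminating program has no derivation.
infix 3 ⟨_,_⟩⇓[_]_

data ⟨_,_⟩⇓[_]_ : Program → Memory → ℕ → Memory → Set where
  skip⇓ : ∀ {σ} → ⟨ skip , σ ⟩⇓[ 1 ] σ
  assign⇓ : ∀ {a e σ} →
    ⟨ mem[ a ]≔ e , σ ⟩⇓[ suc (cost a + cost e) ] (σ [ ⟦ a ⟧ σ ↦ ⟦ e ⟧ σ ])
  seq⇓ : ∀ {p q σ τ υ s t} →
    ⟨ p , σ ⟩⇓[ s ] τ → ⟨ q , τ ⟩⇓[ t ] υ → ⟨ p ⨾ q , σ ⟩⇓[ s + t ] υ
  if-true⇓ : ∀ {e p q σ τ t} → ⟦ e ⟧ σ ≢ 0 →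
    ⟨ p , σ ⟩⇓[ t ] τ → ⟨ if e p q , σ ⟩⇓[ suc (cost e + t) ] τ
  if-false⇓ : ∀ {e p q σ τ t} → ⟦ e ⟧ σ ≡ 0 →
    ⟨ q , σ ⟩⇓[ t ] τ → ⟨ if e p q , σ ⟩⇓[ suc (cost e + t) ] τ
  while-true⇓ : ∀ {e p σ τ υ s t} → ⟦ e ⟧ σ ≢ 0 →
    ⟨ p , σ ⟩⇓[ s ] τ → ⟨ while e p , τ ⟩⇓[ t ] υ →
    ⟨ while e p , σ ⟩⇓[ suc (cost e + s + t) ] υ
  while-false⇓ : ∀ {e p σ} → ⟦ e ⟧ σ ≡ 0 →
    ⟨ while e p , σ ⟩⇓[ suc (cost e) ] σ

------------------------------------------------------------------------
-- Input and output

bit : Bool → ℕ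
bit true  = 1
bit false = 0

load : List ℕ → Memory
load []       _       = 0
load (x ∷ _)  zero    = x
load (_ ∷ xs) (suc a) = load xs a

-- The number of vertices, then the adjacency matrix row by row, then the
-- vertex/colour incidence matrix of the lists row by row; all other cells
-- hold 0.
input : ∀ {n k} → Graph (Fin n) → (Fin n → Subset k) → Memory
input {n} G L = load
  (n ∷ concat (tabulate λ u → tabulate λ v → bit (adj G u v))
    ++ concat (tabulate λ v → tabulate λ c → bit (lookup (L v) c)))

-- On input (G , L), the program p halts after t steps, leaving in cell 0 the
-- answer to whether G has a proper colouring from the lists L.
DecidesListColouring : ∀ {n k} → Program → Graph (Fin n) → (Fin n → Subset k) → ℕ → Set
DecidesListColouring p G L t =
  ∃[ σ ] (⟨ p , input G L ⟩⇓[ t ] σ)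
       × (∃[ b ] Reflects (ListColourable G L) b × σ 0 ≡ bit b)

{-# OPTIONS --safe #-}
module Submission where

-- A state places at most q = 16 k + 5 vertices in the slots of every colour.  The algorithm deletes a state when it is
-- improper or when, for some vertex v, no colour c is such that v can be put into any slot of colour c without leaving
-- the remaining states.  A colouring protects all states that agree with it.  Conversely, call a colour live at v when
-- some remaining state contains the current partial colouring and gives v that colour; if a state remains, then a
-- connected set S can be coloured from the live colours, by induction on the number of colours live on S:
-- if S is claw-free, no breadth-first layer contains three independent vertices, so S can be coloured layer by layer.
-- Otherwise call an edge strong if no proper module of S contains both ends (if S is a join, if it crosses the join).
-- Vertices of one colour with private strong neighbours number at most 16: more would give nine strong edges forming
-- an induced matching; since the components left undominated by a claw are modules, some vertex is then complete to all
-- nine, and one of them lies in a module formed by vertices that see at most two.  So a few vertices can be coloured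
-- such that no strong edge retains a common live colour.  What remains connected lies in a proper module, and a
-- neighbour of that module has a live colour that is dead on the module.

open import Defs
open import Data.Bool.Base using (Bool; true; false; T; _∨_; not)
open import Data.Bool.Properties using () renaming (_≟_ to _≟ᵇ_)
open import Data.Empty using (⊥; ⊥-elim)
open import Data.Fin.Base using (Fin; zero; suc; toℕ; fromℕ<)
open import Data.Fin.Patterns using (0F; 1F; 2F; 3F; 4F; 5F; 6F; 7F; 8F; 9F)
open import Data.Fin.Properties using (any?; all?; toℕ<n; toℕ-injective; toℕ-fromℕ<; toℕ-combine; combine-injective; pigeonhole) renaming (_≟_ to _≟ᶠ_)
open import Data.Fin.Subset using (Subset; _∈_; _∉_; _⊆_; _∪_)
open import Data.Fin.Subset.Properties using (_∈?_; _⊆?_; anySubset?; x∈p∪q⁺; x∈p∪q⁻)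
open import Data.List.Base using (List; []; _∷_; _++_; length; filter; allFin; cartesianProduct; concat; map; tabulate; lookup; removeAt)
open import Data.List.Membership.DecPropositional using () renaming (_∈?_ to memberˡ?)
open import Data.List.Membership.Propositional using (lose; find) renaming (_∈_ to _∈ˡ_; _∉_ to _∉ˡ_)
open import Data.List.Membership.Propositional.Properties using (∈-filter⁻; ∈-filter⁺; ∈-allFin; ∈-cartesianProduct⁺; ∈-++⁺ˡ; ∈-++⁺ʳ; ∈-++⁻; ∈-map⁻; ∈-map⁺; ∈-lookup)
open import Data.List.Properties using (length-filter; filter-notAll; filter-++; length-++; length-map; length-tabulate; tabulate-lookup; map-tabulate)
open import Data.List.Relation.Unary.All as All using (All; []; _∷_)
import Data.List.Relation.Unary.All.Properties as Allₚ
open import Data.List.Relation.Unary.AllPairs using (AllPairs; []; _∷_)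
import Data.List.Relation.Unary.AllPairs.Properties as AllPairsₚ
open import Data.List.Relation.Unary.Any as Any using (Any; here; there)
open import Data.List.Relation.Unary.Any.Properties using (lookup-index)
open import Data.List.Relation.Unary.Unique.Propositional using (Unique)
open import Data.List.Relation.Unary.Unique.Propositional.Properties using (allFin⁺; filter⁺)
open import Data.Nat.Base using (ℕ; zero; suc; _≤_; _+_; _*_; _∸_; _^_; _⊔_; z≤n; s≤s; _<_; _≡ᵇ_; NonZero; >-nonZero)
open import Data.Nat.DivMod
open import Data.Nat.Properties
open import Data.Nat.Solver using (module +-*-Solver)
open import Data.Product.Base using (∃; ∃-syntax; Σ-syntax; _×_; _,_; proj₁; proj₂)
open import Data.Sum.Base using (_⊎_; inj₁; inj₂; [_,_]′)
open import Data.Unit.Base using (⊤; tt)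
open import Data.Vec.Base using (Vec; []; _∷_) renaming (lookup to lookᵛ; tabulate to tabulateᵛ)
open import Data.Vec.Properties using (lookup∘tabulate; lookup⇒[]=; []=⇒lookup)
open import Data.Vec.Properties.WithK using ([]=-irrelevant)
open import Function.Bundles using (mk↔ₛ′)
open import Relation.Binary.Construct.Closure.ReflexiveTransitive using (Star; ε; _◅_; _◅◅_) renaming (map to star-map)
open import Relation.Binary.PropositionalEquality hiding ([_]) renaming (sym to ≡-sym)
open import Relation.Nullary using (¬_; Dec; yes; no; does)
open import Relation.Nullary.Decidable using (toWitness; _×-dec_; _⊎-dec_; _→-dec_; ¬?; decidable-stable; dec-true; dec-false)
open import Relation.Nullary.Negation using (contradiction)
open import Relation.Nullary.Reflects using (Reflects; ofʸ; ofⁿ)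
open import Relation.Unary using (Decidable)
open +-*-Solver using (solve; _:=_; _:+_; _:*_) renaming (con to κ)

-- Forbidden induced subgraphs

-- The remaining states only speak about boundedly many vertices at once: a further vertex always
-- gets some colour, but not one of our choice. So the final colouring is not read off a single
-- state. It gives every vertex a colour that is live by itself, and two adjacent vertices need
-- coordination only if some colour is live at both. This is why edges without a common live colour
-- can be cut, and why the induction counts colours: a larger partial colouring has fewer live ones.
-- Origin of q = 16 k + 5: each of at most k levels of the induction adds at most 16 vertices of
-- each colour, and the sweep through a claw-free set holds two layers with at most two vertices of
-- each colour while it asks for one free slot. The k q slots give (n + 1)^(k q) states, hence the
-- exponent of order k^2. Origin of 16: nine matched edges are needed because four claw vertices,
-- each seeing at most two edges, reach eight; and at least half of the private pairs survive the
-- passage to an induced matching. The machine has no multiplication, so size computations and the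
-- digits of a state are obtained by loops over addition and subtraction.

true≢false : ∀ {b} → b ≡ true → b ≡ false → ⊥
true≢false refl ()

true⊎false : ∀ b → b ≡ true ⊎ b ≡ false
true⊎false true  = inj₁ refl
true⊎false false = inj₂ refl

dec-does : ∀ {p} {P : Set p} (P? : Dec P) → does P? ≡ true → P
dec-does (yes p) _ = p

⟪_⟫ : ∀ {n} {P : Fin n → Set} → Decidable P → Subset n
⟪ P? ⟫ = tabulateᵛ (λ v → does (P? v))

∈⟪⟫⁺ : ∀ {n} {P : Fin n → Set} (P? : Decidable P) {v} → P v → v ∈ ⟪ P? ⟫
∈⟪⟫⁺ P? {v} pv = lookup⇒[]= v _ (trans (lookup∘tabulate _ v) (dec-true (P? v) pv))

∈⟪⟫⁻ : ∀ {n} {P : Fin n → Set} (P? : Decidable P) {v} → v ∈ ⟪ P? ⟫ → P v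
∈⟪⟫⁻ P? {v} v∈ = dec-does (P? v) (trans (≡-sym (lookup∘tabulate _ v)) ([]=⇒lookup v∈))


embedding⇒≅ : ∀ {m n} (F : Graph (Fin m)) (G : Graph (Fin n)) (g : Fin m → Fin n) →
  (∀ {i j} → g i ≡ g j → i ≡ j) → (∀ i j → adj F i j ≡ adj G (g i) (g j)) →
  ∃[ S ] F ≅ (G [ S ])
embedding⇒≅ {m} {n} F G g inj pres = ⟪ image? ⟫ , mk↔ₛ′ to from to∘from from∘to , pres
  where
  image? : Decidable (λ v → ∃[ i ] g i ≡ v)
  image? v = any? λ i → g i ≟ᶠ v
  to : Fin m → ∃ (_∈ ⟪ image? ⟫)
  to i = g i , ∈⟪⟫⁺ image? (i , refl)
  from : ∃ (_∈ ⟪ image? ⟫) → Fin m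
  from (v , v∈) = proj₁ (∈⟪⟫⁻ image? v∈)
  Σ-≡ : ∀ {S : Subset n} {v w} {p : v ∈ S} {q : w ∈ S} → v ≡ w → (v , p) ≡ (w , q)
  Σ-≡ {v = v} refl = cong (v ,_) ([]=-irrelevant _ _)
  to∘from : ∀ v → to (from v) ≡ v
  to∘from (v , v∈) = Σ-≡ (proj₂ (∈⟪⟫⁻ image? v∈))
  from∘to : ∀ i → from (to i) ≡ i
  from∘to i = inj (proj₂ (∈⟪⟫⁻ image? (∈⟪⟫⁺ image? (i , refl))))

-- A map that preserves adjacency and non-adjacency can only identify vertices with equal rows. The
-- bull has no such pair, so injectivity comes for free; in the chair the two leaves at the centre
-- are the only one, which is why `no-chair` asks for `t ≢ t′`.
SameRow : ∀ {m} → Graph (Fin m) → Fin m → Fin m → Set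
SameRow F i j = ∀ w → adj F i w ≡ adj F j w

sameRow? : ∀ {m} (F : Graph (Fin m)) i j → Dec (SameRow F i j)
sameRow? F i j = all? λ w → adj F i w ≟ᵇ adj F j w

bull-rows : ∀ i j → SameRow (proj₂ bull) i j → i ≡ j
bull-rows = toWitness {a? = all? λ i → all? λ j → sameRow? (proj₂ bull) i j →-dec (i ≟ᶠ j)} _

chair-rows : ∀ i j → SameRow (proj₂ chair) i j → i ≡ j ⊎ (i ≡ 1F × j ≡ 2F) ⊎ (i ≡ 2F × j ≡ 1F)
chair-rows = toWitness {a? = all? λ i → all? λ j → sameRow? (proj₂ chair) i j →-dec
  ((i ≟ᶠ j) ⊎-dec ((i ≟ᶠ 1F) ×-dec (j ≟ᶠ 2F)) ⊎-dec ((i ≟ᶠ 2F) ×-dec (j ≟ᶠ 1F)))} _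

module Adjacency {n} (G : Graph (Fin n)) where

  data Upper : Fin 5 → Fin 5 → Set where
    u01 : Upper 0F 1F
    u02 : Upper 0F 2F
    u03 : Upper 0F 3F
    u04 : Upper 0F 4F
    u12 : Upper 1F 2F
    u13 : Upper 1F 3F
    u14 : Upper 1F 4F
    u23 : Upper 2F 3F
    u24 : Upper 2F 4F
    u34 : Upper 3F 4F

  full : (F : Graph (Fin 5)) (g : Fin 5 → Fin n) →
    (∀ {i j} → Upper i j → adj F i j ≡ adj G (g i) (g j)) →
    ∀ i j → adj F i j ≡ adj G (g i) (g j)
  full F g up = go
    where
    diag : ∀ i → adj F i i ≡ adj G (g i) (g i)
    diag i = trans (irrefl F i) (≡-sym (irrefl G (g i)))
    low : ∀ {i j} → Upper j i → adj F i j ≡ adj G (g i) (g j)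
    low {i} {j} u = trans (sym F i j) (trans (up u) (sym G (g j) (g i)))
    go : ∀ i j → adj F i j ≡ adj G (g i) (g j)
    go 0F 0F = diag 0F
    go 0F 1F = up u01
    go 0F 2F = up u02
    go 0F 3F = up u03
    go 0F 4F = up u04
    go 1F 0F = low u01
    go 1F 1F = diag 1F
    go 1F 2F = up u12
    go 1F 3F = up u13
    go 1F 4F = up u14
    go 2F 0F = low u02
    go 2F 1F = low u12
    go 2F 2F = diag 2F
    go 2F 3F = up u23
    go 2F 4F = up u24
    go 3F 0F = low u03
    go 3F 1F = low u13
    go 3F 2F = low u23
    go 3F 3F = diag 3F
    go 3F 4F = up u34
    go 4F 0F = low u04
    go 4F 1F = low u14
    go 4F 2F = low u24
    go 4F 3F = low u34
    go 4F 4F = diag 4F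

  sameRow : (F : Graph (Fin 5)) (g : Fin 5 → Fin n) →
    (∀ i j → adj F i j ≡ adj G (g i) (g j)) → ∀ {i j} → g i ≡ g j → SameRow F i j
  sameRow F g pres {i} {j} eq w =
    trans (pres i w) (trans (cong (λ v → adj G v (g w)) eq) (≡-sym (pres j w)))

  infix 4 _~_ _≁_

  _~_ _≁_ : Fin n → Fin n → Set
  u ~ v = adj G u v ≡ true
  u ≁ v = adj G u v ≡ false

  _~?_ : ∀ u v → Dec (u ~ v)
  u ~? v = adj G u v ≟ᵇ true

  ~-or-≁ : ∀ u v → u ~ v ⊎ u ≁ v
  ~-or-≁ u v = true⊎false (adj G u v)

  ~-sym : ∀ {u v} → u ~ v → v ~ u
  ~-sym {u} {v} = trans (sym G v u)

  ≁-sym : ∀ {u v} → u ≁ v → v ≁ u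
  ≁-sym {u} {v} = trans (sym G v u)

  ¬~⇒≁ : ∀ {u v} → ¬ (u ~ v) → u ≁ v
  ¬~⇒≁ {u} {v} p with ~-or-≁ u v
  ... | inj₁ q = contradiction q p
  ... | inj₂ q = q

  ~⇒≢ : ∀ {u v} → u ~ v → u ≢ v
  ~⇒≢ {u} p refl = true≢false p (irrefl G u)

  module Forbidden (free : Free (bull ∷ chair ∷ []) G) where

    no-bull : ∀ {a b c a′ b′} → a ~ b → b ~ c → a ~ c → a ~ a′ → b ~ b′ →
      a ≁ b′ → b ≁ a′ → c ≁ a′ → c ≁ b′ → a′ ≁ b′ → ⊥
    no-bull {a} {b} {c} {a′} {b′} ab bc ac aa bb ab′ ba′ ca′ cb′ a′b′ = All.head free (embedding⇒≅ F G g (λ eq → bull-rows _ _ (sameRow F g pres eq)) pres)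
      where
      F = proj₂ bull
      g : Fin 5 → Fin n
      g 0F = a
      g 1F = b
      g 2F = c
      g 3F = a′
      g 4F = b′
      up : ∀ {i j} → Upper i j → adj F i j ≡ adj G (g i) (g j)
      up u01 = ≡-sym ab
      up u02 = ≡-sym ac
      up u03 = ≡-sym aa
      up u04 = ≡-sym ab′
      up u12 = ≡-sym bc
      up u13 = ≡-sym ba′
      up u14 = ≡-sym bb
      up u23 = ≡-sym ca′
      up u24 = ≡-sym cb′
      up u34 = ≡-sym a′b′
      pres = full F g up

    no-chair : ∀ {y t t′ p z} → t ≢ t′ → y ~ t → y ~ t′ → y ~ p → p ~ z →
      t ≁ t′ → t ≁ p → t′ ≁ p → y ≁ z → t ≁ z → t′ ≁ z → ⊥
    no-chair {y} {t} {t′} {p} {z} t≢t′ yt yt′ yp pz tt′ tp t′p yz tz t′z = All.head (All.tail free) (embedding⇒≅ F G g inj pres)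
      where
      F = proj₂ chair
      g : Fin 5 → Fin n
      g 0F = y
      g 1F = t
      g 2F = t′
      g 3F = p
      g 4F = z
      up : ∀ {i j} → Upper i j → adj F i j ≡ adj G (g i) (g j)
      up u01 = ≡-sym yt
      up u02 = ≡-sym yt′
      up u03 = ≡-sym yp
      up u04 = ≡-sym yz
      up u12 = ≡-sym tt′
      up u13 = ≡-sym tp
      up u14 = ≡-sym tz
      up u23 = ≡-sym t′p
      up u24 = ≡-sym t′z
      up u34 = ≡-sym pz
      pres = full F g up
      inj : ∀ {i j} → g i ≡ g j → i ≡ j
      inj {i} {j} eq with chair-rows i j (sameRow F g pres eq)
      ... | inj₁ i≡j = i≡j
      ... | inj₂ (inj₁ (refl , refl)) = contradiction eq t≢t′
      ... | inj₂ (inj₂ (refl , refl)) = contradiction (≡-sym eq) t≢t′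

-- Counting and connected components

sel : ∀ {A : Set} → (A → Bool) → List A → List A
sel p = filter (λ e → p e ≟ᵇ true)

count : ∀ {A : Set} → (A → Bool) → List A → ℕ
count p xs = length (sel p xs)

count-cover : ∀ {A : Set} (p q r : A → Bool) (xs : List A) →
  (∀ {e} → e ∈ˡ xs → r e ≡ true → p e ≡ true ⊎ q e ≡ true) → count r xs ≤ count p xs + count q xs
count-cover p q r [] h = z≤n
count-cover p q r (x ∷ xs) h with count-cover p q r xs (λ e∈ → h (there e∈)) | h (here refl)
... | ih | hx with r x | p x | q x
...   | false | false | false = ih
...   | false | false | true  = ≤-trans ih (+-monoʳ-≤ (count p xs) (n≤1+n _))
...   | false | true  | false = m≤n⇒m≤1+n ih
...   | false | true  | true  = m≤n⇒m≤1+n (≤-trans ih (+-monoʳ-≤ (count p xs) (n≤1+n _)))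
...   | true  | false | true  = subst (suc (count r xs) ≤_) (≡-sym (+-suc _ _)) (s≤s ih)
...   | true  | true  | false = s≤s ih
...   | true  | true  | true  = s≤s (≤-trans ih (+-monoʳ-≤ (count p xs) (n≤1+n _)))
...   | true  | false | false with hx refl
...     | inj₁ ()
...     | inj₂ ()

count-all : ∀ {A : Set} (p : A → Bool) (xs : List A) →
  (∀ {e} → e ∈ˡ xs → p e ≡ true) → count p xs ≡ length xs
count-all p [] h = refl
count-all p (x ∷ xs) h rewrite h (here refl) = cong suc (count-all p xs (λ e∈ → h (there e∈)))

count-split : ∀ {A : Set} (p : A → Bool) (xs : List A) →
  length xs ≤ count p xs + count (λ e → not (p e)) xs
count-split p xs = subst (_≤ count p xs + count (λ e → not (p e)) xs) (count-all (λ _ → true) xs λ _ → refl)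
  (count-cover p (λ e → not (p e)) (λ _ → true) xs λ {e} _ _ → cases e)
  where
  cases : ∀ e → p e ≡ true ⊎ not (p e) ≡ true
  cases e with p e
  ... | true  = inj₁ refl
  ... | false = inj₂ refl

not-true : ∀ {b} → not b ≡ true → b ≡ false
not-true {false} _ = refl

∨-split : ∀ b c → b ∨ c ≡ true → b ≡ true ⊎ c ≡ true
∨-split true  c _ = inj₁ refl
∨-split false c p = inj₂ p

module _ {A : Set} {R : A → A → Set} where

  two : ∀ p xs → 2 ≤ count p xs → AllPairs R xs →
    ∃[ a ] ∃[ b ] (a ∈ˡ xs × p a ≡ true) × (b ∈ˡ xs × p b ≡ true) × R a b
  two p xs le ps with sel p xs in eq | AllPairsₚ.filter⁺ (λ e → p e ≟ᵇ true) ps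
  ... | a ∷ b ∷ _ | (r ∷ _) ∷ _ = a , b ,
    ∈-filter⁻ _ (subst (a ∈ˡ_) (≡-sym eq) (here refl)) ,
    ∈-filter⁻ _ (subst (b ∈ˡ_) (≡-sym eq) (there (here refl))) , r
  two p xs () ps | [] | _
  two p xs (s≤s ()) ps | _ ∷ [] | _

  three : ∀ p xs → 3 ≤ count p xs → AllPairs R xs →
    ∃[ a ] ∃[ b ] ∃[ c ] (a ∈ˡ xs × p a ≡ true) × (b ∈ˡ xs × p b ≡ true) × (c ∈ˡ xs × p c ≡ true)
      × R a b × R a c × R b c
  three p xs le ps with sel p xs in eq | AllPairsₚ.filter⁺ (λ e → p e ≟ᵇ true) ps
  ... | a ∷ b ∷ c ∷ _ | (r ∷ r′ ∷ _) ∷ (r″ ∷ _) ∷ _ = a , b , c ,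
    ∈-filter⁻ _ (subst (a ∈ˡ_) (≡-sym eq) (here refl)) ,
    ∈-filter⁻ _ (subst (b ∈ˡ_) (≡-sym eq) (there (here refl))) ,
    ∈-filter⁻ _ (subst (c ∈ˡ_) (≡-sym eq) (there (there (here refl)))) , r , r′ , r″
  three p xs () ps | [] | _
  three p xs (s≤s ()) ps | _ ∷ [] | _
  three p xs (s≤s (s≤s ())) ps | _ ∷ _ ∷ [] | _

  related : (∀ {a b} → R a b → R b a) → ∀ {xs} → AllPairs R xs → ∀ {a b} → a ∈ˡ xs → b ∈ˡ xs →
    a ≡ b ⊎ R a b
  related s (_ ∷ _) (here refl) (here refl) = inj₁ refl
  related s (r ∷ _) (here refl) (there b∈) = inj₂ (All.lookup r b∈)
  related s (r ∷ _) (there a∈) (here refl) = inj₂ (s (All.lookup r a∈))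
  related s (_ ∷ ps) (there a∈) (there b∈) = related s ps a∈ b∈

module _ {n} {E : Fin n → Fin n → Set} (E? : ∀ u v → Dec (E u v)) (E-sym : ∀ {u v} → E u v → E v u) where

  private
    redirect : Fin n → Fin n → Fin n → Fin n
    redirect i j l with l ≟ᶠ i
    ... | yes _ = j
    ... | no  _ = l

    redirect-joins : ∀ i j → redirect i j i ≡ redirect i j j
    redirect-joins i j with i ≟ᶠ i | j ≟ᶠ i
    ... | yes _ | yes _ = refl
    ... | yes _ | no  _ = refl
    ... | no  p | _     = contradiction refl p

    -- Union-find by relabelling: joining two classes redirects one label to the other. Once all
    -- pairs have been processed, equality of labels decides connectivity.
    build : List (Fin n × Fin n) → Fin n → Fin n
    build [] = λ x → x
    build ((u , v) ∷ ps) with E? u v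
    ... | yes _ = λ x → redirect (build ps u) (build ps v) (build ps x)
    ... | no  _ = build ps

    star-sym : ∀ {u v} → Star E u v → Star E v u
    star-sym ε = ε
    star-sym (e ◅ s) = star-sym s ◅◅ (E-sym e ◅ ε)

    build-sound : ∀ ps {x y} → build ps x ≡ build ps y → Star E x y
    build-sound [] refl = ε
    build-sound ((u , v) ∷ ps) {x} {y} eq with E? u v
    ... | no  _ = build-sound ps eq
    ... | yes e with build ps x ≟ᶠ build ps u | build ps y ≟ᶠ build ps u
    ...   | yes p | yes q = build-sound ps (trans p (≡-sym q))
    ...   | yes p | no  _ = build-sound ps p ◅◅ (e ◅ build-sound ps eq)
    ...   | no  _ | yes q = build-sound ps eq ◅◅ (E-sym e ◅ star-sym (build-sound ps q))
    ...   | no  _ | no  _ = build-sound ps eq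

    build-complete : ∀ ps {u v} → (u , v) ∈ˡ ps → E u v → build ps u ≡ build ps v
    build-complete ((u , v) ∷ ps) (here refl) e with E? u v
    ... | yes _ = redirect-joins (build ps u) (build ps v)
    ... | no ¬e = contradiction e ¬e
    build-complete ((u′ , v′) ∷ ps) (there i) e with E? u′ v′
    ... | yes _ = cong (redirect (build ps u′) (build ps v′)) (build-complete ps i e)
    ... | no  _ = build-complete ps i e

    pairs = cartesianProduct (allFin n) (allFin n)

  abstract
    component : Fin n → Fin n
    component = build pairs

    component-edge : ∀ {u v} → E u v → component u ≡ component v
    component-edge {u} {v} = build-complete pairs (∈-cartesianProduct⁺ (∈-allFin u) (∈-allFin v))

    component-path : ∀ {u v} → component u ≡ component v → Star E u v
    component-path = build-sound pairs

star-transport : ∀ {A : Set} {E : A → A → Set} (P : A → Set) →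
  (∀ {a b} → E a b → P a → P b) → ∀ {u v} → Star E u v → P u → P v
star-transport P step ε pu = pu
star-transport P step (e ◅ s) pu = star-transport P step s (step e pu)

-- Modules, weak edges and claws

module Modules {n} (G : Graph (Fin n)) where
  open Adjacency G

  Edge : Subset n → Fin n → Fin n → Set
  Edge S u v = u ∈ S × v ∈ S × u ~ v

  edge? : ∀ S u v → Dec (Edge S u v)
  edge? S u v = (u ∈? S) ×-dec (v ∈? S) ×-dec (u ~? v)

  edge-sym : ∀ {S u v} → Edge S u v → Edge S v u
  edge-sym (u∈ , v∈ , e) = v∈ , u∈ , ~-sym e

  ProperModule : Subset n → Subset n → Set
  ProperModule S M =
    M ⊆ S ×
    (∀ z u v → z ∈ S → z ∉ M → u ∈ M → v ∈ M → z ~ u → z ~ v) ×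
    (∃[ z ] z ∈ S × z ∉ M)

  properModule? : ∀ S M → Dec (ProperModule S M)
  properModule? S M =
    (M ⊆? S) ×-dec
    (all? λ z → all? λ u → all? λ v →
      (z ∈? S) →-dec ¬? (z ∈? M) →-dec (u ∈? M) →-dec (v ∈? M) →-dec (z ~? u) →-dec (z ~? v)) ×-dec
    (any? λ z → (z ∈? S) ×-dec ¬? (z ∈? M))

  Weak : Subset n → Fin n → Fin n → Set
  Weak S u v = ∃[ M ] ProperModule S M × u ∈ M × v ∈ M

  -- Exhaustive search over subsets. It serves the case distinctions of the proof; the algorithm
  -- never looks for modules.
  weak? : ∀ S u v → Dec (Weak S u v)
  weak? S u v = anySubset? λ M → properModule? S M ×-dec (u ∈? M) ×-dec (v ∈? M)

  -- The component of `x` in the graph induced on `A` is the module: the rest of `A` sends no edge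
  -- to it, and adjacency to a vertex outside `A` is carried along its edges because none of them is
  -- split.
  unsplit-component : ∀ {S A} → A ⊆ S → (∃[ z ] z ∈ S × z ∉ A) →
    (∀ {z a b} → z ∈ S → z ∉ A → a ∈ A → b ∈ A → a ~ b → z ~ a → z ~ b) →
    ∀ {x w} → x ∈ A → w ∈ A → x ~ w → Weak S x w
  unsplit-component {S} {A} A⊆S (z₀ , z₀∈S , z₀∉A) nosplit {x} {w} x∈A w∈A x~w =
    M , ((λ v∈ → A⊆S (proj₁ (out v∈))) , uniform , z₀ , z₀∈S , λ z₀∈ → z₀∉A (proj₁ (out z₀∈))) ,
    into x∈A refl , into w∈A (≡-sym (component-edge (edge? A) edge-sym (x∈A , w∈A , x~w)))
    where
    comp = component (edge? A) edge-sym
    M? : ∀ v → Dec (v ∈ A × comp v ≡ comp x)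
    M? v = (v ∈? A) ×-dec (comp v ≟ᶠ comp x)
    M = ⟪ M? ⟫
    into : ∀ {v} → v ∈ A → comp v ≡ comp x → v ∈ M
    into v∈ eq = ∈⟪⟫⁺ M? (v∈ , eq)
    out : ∀ {v} → v ∈ M → v ∈ A × comp v ≡ comp x
    out = ∈⟪⟫⁻ M?
    uniform : ∀ z u v → z ∈ S → z ∉ M → u ∈ M → v ∈ M → z ~ u → z ~ v
    uniform z u v z∈S z∉M u∈M v∈M z~u with out u∈M | out v∈M | z ∈? A
    ... | u∈A , cu | v∈A , cv | yes z∈A =
      contradiction (into z∈A (trans (component-edge (edge? A) edge-sym (z∈A , u∈A , z~u)) cu)) z∉M
    ... | u∈A , cu | v∈A , cv | no z∉A =
      star-transport (z ~_) (λ (a∈ , b∈ , a~b) → nosplit z∈S z∉A a∈ b∈ a~b)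
        (component-path (edge? A) edge-sym (trans cu (≡-sym cv))) z~u

  record Claw (S : Subset n) : Set where
    constructor claw
    field
      {y t₁ t₂ t₃} : Fin n
      y∈ : y ∈ S
      t₁∈ : t₁ ∈ S
      t₂∈ : t₂ ∈ S
      t₃∈ : t₃ ∈ S
      yt₁ : y ~ t₁
      yt₂ : y ~ t₂
      yt₃ : y ~ t₃
      ≢₁₂ : t₁ ≢ t₂
      ≢₁₃ : t₁ ≢ t₃
      ≢₂₃ : t₂ ≢ t₃
      ≁₁₂ : t₁ ≁ t₂
      ≁₁₃ : t₁ ≁ t₃
      ≁₂₃ : t₂ ≁ t₃

  claw? : ∀ S → Dec (Claw S)
  claw? S with any? (λ y → any? λ t₁ → any? λ t₂ → any? λ t₃ →
    ((y ∈? S) ×-dec (t₁ ∈? S) ×-dec (t₂ ∈? S) ×-dec (t₃ ∈? S)) ×-dec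
    ((y ~? t₁) ×-dec (y ~? t₂) ×-dec (y ~? t₃)) ×-dec
    (¬? (t₁ ≟ᶠ t₂) ×-dec ¬? (t₁ ≟ᶠ t₃) ×-dec ¬? (t₂ ≟ᶠ t₃)) ×-dec
    (≁? t₁ t₂ ×-dec ≁? t₁ t₃ ×-dec ≁? t₂ t₃))
    where
    ≁? : ∀ u v → Dec (u ≁ v)
    ≁? u v = adj G u v ≟ᵇ false
  ... | yes (_ , _ , _ , _ , (y∈ , t₁∈ , t₂∈ , t₃∈) , (a , b , c) , (d , e , f) , (g , h , i)) =
    yes (claw y∈ t₁∈ t₂∈ t₃∈ a b c d e f g h i)
  ... | no ¬p = no λ (claw y∈ t₁∈ t₂∈ t₃∈ a b c d e f g h i) →
    ¬p (_ , _ , _ , _ , (y∈ , t₁∈ , t₂∈ , t₃∈) , (a , b , c) , (d , e , f) , (g , h , i))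

-- Induced matchings of strong edges

module Matchings {n} (G : Graph (Fin n)) (free : Free (bull ∷ chair ∷ []) G) where
  open Adjacency G
  open Forbidden free
  open Modules G

  -- No vertex `z` splits an edge `a b` that is anticomplete to the claw. If `z` sees two leaves,
  -- they form a chair with centre `z` and path `a`, `b`. Otherwise `z` misses two leaves; if it
  -- sees `y`, these are the leaves of a chair with centre `y` and path `z`, `a`. If it sees a
  -- single leaf and not `y`, the chair has centre `y` and its path leads through that leaf to `z`.
  -- If it sees nothing of the claw, it lies in the set itself.
  undominated-weak : ∀ {S} (Q : Claw S) → let open Claw Q in ∀ {x w} → x ∈ S → w ∈ S → x ~ w →
    y ≁ x → t₁ ≁ x → t₂ ≁ x → t₃ ≁ x → y ≁ w → t₁ ≁ w → t₂ ≁ w → t₃ ≁ w → Weak S x w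
  undominated-weak {S} Q {x} {w} x∈ w∈ xw yx t₁x t₂x t₃x yw t₁w t₂w t₃w =
    unsplit-component {S} {⟪ A? ⟫} (λ v∈ → proj₁ (∈⟪⟫⁻ A? v∈))
      (y , y∈ , λ y∈A → true≢false yt₁ (≁-sym (proj₁ (proj₂ (proj₂ (∈⟪⟫⁻ A? y∈A))))))
      nosplit (∈⟪⟫⁺ A? (x∈ , yx , t₁x , t₂x , t₃x)) (∈⟪⟫⁺ A? (w∈ , yw , t₁w , t₂w , t₃w)) xw
    where
    open Claw Q
    ≁? : ∀ u v → Dec (u ≁ v)
    ≁? u v = adj G u v ≟ᵇ false
    A? : ∀ v → Dec (v ∈ S × y ≁ v × t₁ ≁ v × t₂ ≁ v × t₃ ≁ v)
    A? v = (v ∈? S) ×-dec ≁? y v ×-dec ≁? t₁ v ×-dec ≁? t₂ v ×-dec ≁? t₃ v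
    nosplit : ∀ {z a b} → z ∈ S → z ∉ ⟪ A? ⟫ → a ∈ ⟪ A? ⟫ → b ∈ ⟪ A? ⟫ → a ~ b → z ~ a → z ~ b
    nosplit {z} {a} {b} z∈ z∉A a∈A b∈A ab za with ∈⟪⟫⁻ A? a∈A | ∈⟪⟫⁻ A? b∈A | ~-or-≁ z b
    ... | _ | _ | inj₁ zb = zb
    ... | _ , ya , t₁a , t₂a , t₃a | _ , yb , t₁b , t₂b , t₃b | inj₂ zb
      with ~-or-≁ z y | ~-or-≁ z t₁ | ~-or-≁ z t₂ | ~-or-≁ z t₃
    ... | _ | inj₁ z₁ | inj₁ z₂ | _       = ⊥-elim (no-chair ≢₁₂ z₁ z₂ za ab ≁₁₂ t₁a t₂a zb t₁b t₂b)
    ... | _ | inj₁ z₁ | _       | inj₁ z₃ = ⊥-elim (no-chair ≢₁₃ z₁ z₃ za ab ≁₁₃ t₁a t₃a zb t₁b t₃b)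
    ... | _ | _       | inj₁ z₂ | inj₁ z₃ = ⊥-elim (no-chair ≢₂₃ z₂ z₃ za ab ≁₂₃ t₂a t₃a zb t₂b t₃b)
    ... | inj₁ zy | inj₂ z₁ | inj₂ z₂ | _ =
      ⊥-elim (no-chair ≢₁₂ yt₁ yt₂ (~-sym zy) za ≁₁₂ (≁-sym z₁) (≁-sym z₂) ya t₁a t₂a)
    ... | inj₁ zy | inj₂ z₁ | _ | inj₂ z₃ =
      ⊥-elim (no-chair ≢₁₃ yt₁ yt₃ (~-sym zy) za ≁₁₃ (≁-sym z₁) (≁-sym z₃) ya t₁a t₃a)
    ... | inj₁ zy | _ | inj₂ z₂ | inj₂ z₃ =
      ⊥-elim (no-chair ≢₂₃ yt₂ yt₃ (~-sym zy) za ≁₂₃ (≁-sym z₂) (≁-sym z₃) ya t₂a t₃a)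
    ... | inj₂ zy | inj₁ z₁ | inj₂ z₂ | inj₂ z₃ =
      ⊥-elim (no-chair ≢₂₃ yt₂ yt₃ yt₁ (~-sym z₁) ≁₂₃ (≁-sym ≁₁₂) (≁-sym ≁₁₃) (≁-sym zy) (≁-sym z₂) (≁-sym z₃))
    ... | inj₂ zy | inj₂ z₁ | inj₁ z₂ | inj₂ z₃ =
      ⊥-elim (no-chair ≢₁₃ yt₁ yt₃ yt₂ (~-sym z₂) ≁₁₃ ≁₁₂ (≁-sym ≁₂₃) (≁-sym zy) (≁-sym z₁) (≁-sym z₃))
    ... | inj₂ zy | inj₂ z₁ | inj₂ z₂ | inj₁ z₃ =
      ⊥-elim (no-chair ≢₁₂ yt₁ yt₂ yt₃ (~-sym z₃) ≁₁₂ ≁₁₃ ≁₂₃ (≁-sym zy) (≁-sym z₁) (≁-sym z₂))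
    ... | inj₂ zy | inj₂ z₁ | inj₂ z₂ | inj₂ z₃ =
      contradiction (∈⟪⟫⁺ A? (z∈ , ≁-sym zy , ≁-sym z₁ , ≁-sym z₂ , ≁-sym z₃)) z∉A

  Pair : Set
  Pair = Fin n × Fin n

  att : Fin n → Pair → Bool
  att z (x , w) = adj G z x ∨ adj G z w

  Anti : Pair → Pair → Set
  Anti (x , w) (x′ , w′) = x ≁ x′ × x ≁ w′ × w ≁ x′ × w ≁ w′

  anti-sym : ∀ {e f} → Anti e f → Anti f e
  anti-sym (a , b , c , d) = ≁-sym a , ≁-sym c , ≁-sym b , ≁-sym d

  StrongEdge : Subset n → Pair → Set
  StrongEdge S (x , w) = x ∈ S × w ∈ S × x ~ w × ¬ Weak S x w

  data EndOf : Pair → Fin n → Set where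
    fst : ∀ {x w} → EndOf (x , w) x
    snd : ∀ {x w} → EndOf (x , w) w

  att-false : ∀ {z e} → att z e ≡ false → z ≁ proj₁ e × z ≁ proj₂ e
  att-false {z} {x , w} eq with adj G z x | adj G z w
  att-false refl | false | false = refl , refl
  att-false ()   | true  | _
  att-false ()   | false | true

  att-intro : ∀ {z e t} → EndOf e t → z ~ t → att z e ≡ true
  att-intro {z} {x , w} fst zx rewrite zx = refl
  att-intro {z} {x , w} snd zw rewrite zw with adj G z x
  ... | true  = refl
  ... | false = refl

  att-end : ∀ {z e} → att z e ≡ true → ∃[ t ] EndOf e t × z ~ t
  att-end {z} {x , w} eq with ~-or-≁ z x | ~-or-≁ z w
  ... | inj₁ zx | _       = x , fst , zx
  ... | inj₂ _  | inj₁ zw = w , snd , zw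
  ... | inj₂ zx | inj₂ zw rewrite zx | zw = contradiction eq λ ()

  anti-end : ∀ {e f t u} → Anti e f → EndOf e t → EndOf f u → t ≁ u
  anti-end (a , b , c , d) fst fst = a
  anti-end (a , b , c , d) fst snd = b
  anti-end (a , b , c , d) snd fst = c
  anti-end (a , b , c , d) snd snd = d

  module _ {S : Subset n} where

    end-∈ : ∀ {e t} → StrongEdge S e → EndOf e t → t ∈ S
    end-∈ s fst = proj₁ s
    end-∈ s snd = proj₁ (proj₂ s)

    mate : ∀ {e t} → StrongEdge S e → EndOf e t → ∃[ p ] EndOf e p × t ~ p
    mate (_ , _ , xw , _) fst = _ , snd , xw
    mate (_ , _ , xw , _) snd = _ , fst , ~-sym xw

    ends-≢ : ∀ {e f t u} → StrongEdge S e → Anti e f → EndOf e t → EndOf f u → t ≢ u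
    ends-≢ s anti te uf refl with mate s te
    ... | p , pe , tp = true≢false tp (≁-sym (anti-end anti pe uf))

    end-anti-unattached : ∀ {e f t} → EndOf e t → Anti e f → att t f ≡ false
    end-anti-unattached {e} {f} {t} te anti with true⊎false (att t f)
    ... | inj₂ q = q
    ... | inj₁ q with att-end q
    ...   | u , uf , tu = ⊥-elim (true≢false tu (anti-end anti te uf))

    claw-attached : (Q : Claw S) → let open Claw Q in ∀ {e} → StrongEdge S e →
      att y e ≡ false → att t₁ e ≡ false → att t₂ e ≡ false → att t₃ e ≡ false → ⊥
    claw-attached Q (x∈ , w∈ , xw , strong) a b c d with att-false a | att-false b | att-false c | att-false d
    ... | yx , yw | t₁x , t₁w | t₂x , t₂w | t₃x , t₃w =
      strong (undominated-weak Q x∈ w∈ xw yx t₁x t₂x t₃x yw t₁w t₂w t₃w)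

    module _ {F : List Pair} (strong : ∀ {e} → e ∈ˡ F → StrongEdge S e) (anti : AllPairs Anti F)
             (long : 9 ≤ length F) (Q : Claw S) where

      Hub : Fin n → Set
      Hub z = 3 ≤ count (att z) F

      -- A hub has neighbours in three edges of the matching and is the centre of a claw on them. An
      -- edge missed by the hub would be missed by this whole claw, since the leaves belong to other
      -- edges of an induced matching.
      hub-attached : ∀ {h} → h ∈ S → Hub h → ∀ {e} → e ∈ˡ F → att h e ≡ true
      hub-attached {h} h∈ hub {e} e∈ with true⊎false (att h e) | three (att h) F hub anti
      ... | inj₁ p | _ = p
      ... | inj₂ he | e₁ , e₂ , e₃ , (e₁∈ , h₁) , (e₂∈ , h₂) , (e₃∈ , h₃) , a₁₂ , a₁₃ , a₂₃
        with att-end h₁ | att-end h₂ | att-end h₃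
      ... | t₁ , t₁e , ht₁ | t₂ , t₂e , ht₂ | t₃ , t₃e , ht₃ =
        ⊥-elim (claw-attached Q′ (strong e∈) he
          (far e₁∈ h₁ t₁e) (far e₂∈ h₂ t₂e) (far e₃∈ h₃ t₃e))
        where
        Q′ : Claw S
        Q′ = claw h∈ (end-∈ (strong e₁∈) t₁e) (end-∈ (strong e₂∈) t₂e) (end-∈ (strong e₃∈) t₃e) ht₁ ht₂ ht₃
          (ends-≢ (strong e₁∈) a₁₂ t₁e t₂e) (ends-≢ (strong e₁∈) a₁₃ t₁e t₃e) (ends-≢ (strong e₂∈) a₂₃ t₂e t₃e)
          (anti-end a₁₂ t₁e t₂e) (anti-end a₁₃ t₁e t₃e) (anti-end a₂₃ t₂e t₃e)
        far : ∀ {f t} → f ∈ˡ F → att h f ≡ true → EndOf f t → att t e ≡ false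
        far f∈ hf tf with related anti-sym anti f∈ e∈
        ... | inj₁ refl = ⊥-elim (true≢false hf he)
        ... | inj₂ a = end-anti-unattached tf a

      spare : ∀ p → count p F ≤ 4 →
        ∃[ f ] ∃[ g ] (f ∈ˡ F × p f ≡ false) × (g ∈ˡ F × p g ≡ false) × Anti f g
      spare p le with two (λ f → not (p f)) F enough anti
        where
        enough : 2 ≤ count (λ f → not (p f)) F
        enough = ≤-trans (s≤s (s≤s z≤n)) (+-cancelˡ-≤ 4 5 _ (≤-trans long (≤-trans (count-split p F) (+-monoˡ-≤ _ le))))
      ... | f , g , (f∈ , pf) , (g∈ , pg) , fg = f , g , (f∈ , not-true pf) , (g∈ , not-true pg) , fg

      end-not-hub : ∀ {e t} → e ∈ˡ F → EndOf e t → ¬ Hub t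
      end-not-hub {e} {t} e∈ te hub with three (att t) F hub anti
      ... | f , g , _ , (f∈ , af) , (g∈ , ag) , _ , fg , _
        with related anti-sym anti e∈ f∈ | related anti-sym anti e∈ g∈
      ...   | inj₂ a | _ = true≢false af (end-anti-unattached te a)
      ...   | _ | inj₂ a = true≢false ag (end-anti-unattached te a)
      ...   | inj₁ refl | inj₁ refl =
        true≢false (proj₁ (proj₂ (proj₂ (strong e∈)))) (proj₁ (proj₂ fg))

      not-hub⇒few : ∀ {z} → ¬ Hub z → count (att z) F ≤ 2
      not-hub⇒few ¬hub = ≤-pred (≰⇒> ¬hub)

      -- The end `t` is attached to few edges, so two others remain. If `h` missed `p`, its
      -- neighbours in those two would be the leaves of a chair with centre `h` and path `t`, `p`.
      hub-complete : ∀ {h} → h ∈ S → Hub h → ∀ {e t p} → e ∈ˡ F → EndOf e t → EndOf e p → t ~ p → h ~ t → h ~ p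
      hub-complete {h} h∈ hub {e} {t} {p} e∈ te pe tp ht
        with ~-or-≁ h p | spare (att t) (≤-trans (not-hub⇒few (end-not-hub e∈ te)) (s≤s (s≤s z≤n)))
      ... | inj₁ hp | _ = hp
      ... | inj₂ hp | f , g , (f∈ , af) , (g∈ , ag) , fg
        with att-end (hub-attached h∈ hub f∈) | att-end (hub-attached h∈ hub g∈)
      ... | a , fa , ha | b , gb , hb =
        ⊥-elim (no-chair (ends-≢ (strong f∈) fg fa gb) ha hb ht tp (anti-end fg fa gb)
          (anti-end (apart f∈ af) fa te) (anti-end (apart g∈ ag) gb te) hp
          (anti-end (apart f∈ af) fa pe) (anti-end (apart g∈ ag) gb pe))
        where
        apart : ∀ {f} → f ∈ˡ F → att t f ≡ false → Anti f e
        apart f∈ af with related anti-sym anti f∈ e∈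
        ... | inj₂ a    = a
        ... | inj₁ refl = ⊥-elim (true≢false (att-intro pe tp) af)

      hub-complete₁ : ∀ {h} → h ∈ S → Hub h → ∀ {e} → e ∈ˡ F → h ~ proj₁ e
      hub-complete₁ h∈ hub e∈ with att-end (hub-attached h∈ hub e∈)
      ... | _ , fst , hx = hx
      ... | _ , snd , hw = hub-complete h∈ hub e∈ snd fst (~-sym (proj₁ (proj₂ (proj₂ (strong e∈))))) hw

      -- Each edge is attached to one of the four claw vertices. If none were a hub, they would
      -- account for at most 4 * 2 = 8 edges, whence the 9.
      some-hub : ∃[ h ] h ∈ S × Hub h
      some-hub with 3 ≤? count (att y) F | 3 ≤? count (att t₁) F | 3 ≤? count (att t₂) F | 3 ≤? count (att t₃) F
        where open Claw Q
      ... | yes p | _ | _ | _ = _ , Claw.y∈ Q , p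
      ... | _ | yes p | _ | _ = _ , Claw.t₁∈ Q , p
      ... | _ | _ | yes p | _ = _ , Claw.t₂∈ Q , p
      ... | _ | _ | _ | yes p = _ , Claw.t₃∈ Q , p
      ... | no a | no b | no c | no d = contradiction (≤-trans long bound) λ { (s≤s (s≤s (s≤s (s≤s (s≤s (s≤s (s≤s (s≤s ())))))))) }
        where
        open Claw Q
        bound : length F ≤ 8
        bound = ≤-trans (≤-reflexive (≡-sym (count-all any F λ {e} e∈ → attached e∈)))
          (≤-trans (count-cover (λ e → att y e ∨ att t₁ e) (λ e → att t₂ e ∨ att t₃ e) any F λ {e} _ → ∨-split (att y e ∨ att t₁ e) _)
          (+-mono-≤ (half y t₁ a b) (half t₂ t₃ c d)))
          where
          any : Pair → Bool
          any e = (att y e ∨ att t₁ e) ∨ (att t₂ e ∨ att t₃ e)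
          half : ∀ u v → ¬ Hub u → ¬ Hub v → count (λ e → att u e ∨ att v e) F ≤ 4
          half u v p q = ≤-trans (count-cover (att u) (att v) _ F λ {e} _ → ∨-split (att u e) _)
            (+-mono-≤ (not-hub⇒few p) (not-hub⇒few q))
          attached : ∀ {e} → e ∈ˡ F → any e ≡ true
          attached {e} e∈ with att y e in p | att t₁ e in q | att t₂ e in r | att t₃ e in s
          ... | true | _ | _ | _ = refl
          ... | false | true | _ | _ = refl
          ... | false | false | true | _ = refl
          ... | false | false | false | true = refl
          ... | false | false | false | false = ⊥-elim (claw-attached Q (strong e∈) p q r s)

      -- The vertices that are not hubs include both ends of `e` but miss `h`, so it remains to see
      -- that no hub `z` splits an edge `a b` among them. Together `a` and `b` touch at most four
      -- matching edges; the first ends of two untouched ones are adjacent to `z` and would form a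
      -- chair with centre `z` and path `a`, `b`.
      no-strong-matching : ∀ {e} → e ∈ˡ F → ⊥
      no-strong-matching {x , w} e∈ with some-hub | strong e∈
      ... | h , h∈ , hub | x∈ , w∈ , xw , ¬weak =
        ¬weak (unsplit-component {A = ⟪ small? ⟫} (λ v∈ → proj₁ (∈⟪⟫⁻ small? v∈))
          (h , h∈ , λ h∈A → proj₂ (∈⟪⟫⁻ small? h∈A) hub) nosplit
          (∈⟪⟫⁺ small? (x∈ , end-not-hub e∈ fst)) (∈⟪⟫⁺ small? (w∈ , end-not-hub e∈ snd)) xw)
        where
        small? : ∀ v → Dec (v ∈ S × ¬ Hub v)
        small? v = (v ∈? S) ×-dec ¬? (3 ≤? count (att v) F)
        nosplit : ∀ {z a b} → z ∈ S → z ∉ ⟪ small? ⟫ → a ∈ ⟪ small? ⟫ → b ∈ ⟪ small? ⟫ → a ~ b → z ~ a → z ~ b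
        nosplit {z} {a} {b} z∈ z∉ a∈ b∈ ab za
          with ~-or-≁ z b | decidable-stable (3 ≤? count (att z) F) (λ ¬hub → z∉ (∈⟪⟫⁺ small? (z∈ , ¬hub)))
        ... | inj₁ zb | _ = zb
        ... | inj₂ zb | hubz with spare (λ e → att a e ∨ att b e) few
          where
          few : count (λ e → att a e ∨ att b e) F ≤ 4
          few = ≤-trans (count-cover (att a) (att b) _ F λ {e} _ → ∨-split (att a e) _)
            (+-mono-≤ (not-hub⇒few (proj₂ (∈⟪⟫⁻ small? a∈))) (not-hub⇒few (proj₂ (∈⟪⟫⁻ small? b∈))))
        ... | f , g , (f∈ , af) , (g∈ , ag) , fg =
          ⊥-elim (no-chair (ends-≢ (strong f∈) fg fst fst) (hub-complete₁ z∈ hubz f∈) (hub-complete₁ z∈ hubz g∈) za ab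
            (proj₁ fg) (≁-sym (proj₁ (att-false (∨-false₁ (att a _) af)))) (≁-sym (proj₁ (att-false (∨-false₁ (att a _) ag)))) zb
            (≁-sym (proj₁ (att-false (∨-false₂ (att a _) af)))) (≁-sym (proj₁ (att-false (∨-false₂ (att a _) ag)))))
          where
          ∨-false₁ : ∀ b {c} → b ∨ c ≡ false → b ≡ false
          ∨-false₁ false _ = refl
          ∨-false₂ : ∀ b {c} → b ∨ c ≡ false → c ≡ false
          ∨-false₂ false p = p

    -- The second components are the private neighbours. Adjacency between two of these is left
    -- open: it is the one thing that separates such pairs from an induced matching.
    Private : Pair → Pair → Set
    Private (x , w) (x′ , w′) = x ≁ x′ × x ≁ w′ × w ≁ x′

    -- The private neighbours induce a matching: two of them adjacent to a third give a bull
    -- (if adjacent to each other) or a chair.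
    private-degree : ∀ {x w ps} → x ~ w → All (λ e → proj₁ e ~ proj₂ e) ps → All (Private (x , w)) ps →
      AllPairs Private ps → count (λ e → adj G w (proj₂ e)) ps ≤ 1
    private-degree {x} {w} {ps} xw edges privs pairs with count (λ e → adj G w (proj₂ e)) ps ≤? 1
    ... | yes p = p
    ... | no ¬p with two (λ e → adj G w (proj₂ e)) ps (≰⇒> ¬p) pairs
    ...   | (a , b) , (c , d) , (f∈ , wb) , (g∈ , wd) , ac , ad , bc
      with All.lookup edges f∈ | All.lookup edges g∈ | All.lookup privs f∈ | All.lookup privs g∈ | ~-or-≁ b d
    ... | ab | cd | xa , xb , wa | xc , xd , wc | inj₁ bd =
      ⊥-elim (no-bull wb bd wd (~-sym xw) (~-sym ab) wa (≁-sym xb) (≁-sym xd) (≁-sym ad) xa)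
    ... | ab | cd | xa , xb , wa | xc , xd , wc | inj₂ bd =
      ⊥-elim (no-chair (λ { refl → true≢false cd (≁-sym xc) }) (~-sym xw) wd wb (~-sym ab)
        xd xb (≁-sym bd) wa xa (≁-sym ad))

    -- Greedy choice: by `private-degree` a chosen pair excludes at most one later pair, so at least
    -- half of the pairs are kept. The bound `m` makes the recursion through the filtered list
    -- structural.
    induced-matching : ∀ m ps → length ps ≤ m → All (λ e → proj₁ e ~ proj₂ e) ps → AllPairs Private ps →
      ∃[ F ] length ps ≤ length F + length F × AllPairs Anti F × (∀ {e} → e ∈ˡ F → e ∈ˡ ps)
    induced-matching m [] _ _ _ = [] , z≤n , [] , λ ()
    induced-matching (suc m) ((x , w) ∷ ps) (s≤s le) (xw ∷ edges) (privs ∷ pairs)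
      with induced-matching m (sel (λ e → not (adj G w (proj₂ e))) ps) (≤-trans (length-filter _ ps) le)
             (Allₚ.filter⁺ _ edges) (AllPairsₚ.filter⁺ _ pairs)
    ... | F , le′ , anti , F⊆ = (x , w) ∷ F , bound , All.tabulate new ∷ anti , sub
      where
      far : Pair → Bool
      far e = not (adj G w (proj₂ e))
      bound : suc (length ps) ≤ suc (length F) + suc (length F)
      bound = s≤s (subst (length ps ≤_) (≡-sym (+-suc _ _))
        (≤-trans (count-split (λ e → adj G w (proj₂ e)) ps)
          (+-mono-≤ (private-degree xw edges privs pairs) le′)))
      new : ∀ {e} → e ∈ˡ F → Anti (x , w) e
      new e∈ with ∈-filter⁻ (λ e → far e ≟ᵇ true) {xs = ps} (F⊆ e∈)
      ... | e∈ps , wf with All.lookup privs e∈ps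
      ...   | xx , xw′ , wx = xx , xw′ , wx , not-true wf
      sub : ∀ {e} → e ∈ˡ (x , w) ∷ F → e ∈ˡ (x , w) ∷ ps
      sub (here p) = here p
      sub (there e∈) = there (proj₁ (∈-filter⁻ (λ e → far e ≟ᵇ true) {xs = ps} (F⊆ e∈)))

    -- Seventeen pairs would leave a matching of at least nine strong edges; 16 is twice 8.
    private-bound : Claw S → ∀ {ps} → All (StrongEdge S) ps → AllPairs Private ps → length ps ≤ 16
    private-bound Q {ps} strong pairs with length ps ≤? 16
    ... | yes p = p
    ... | no ¬p with induced-matching (length ps) ps ≤-refl (All.map (λ s → proj₁ (proj₂ (proj₂ s))) strong) pairs
    ...   | F , le , anti , F⊆ with 9 ≤? length F
    ...     | no q = contradiction (≤-trans (≰⇒> ¬p) (≤-trans le (+-mono-≤ (≤-pred (≰⇒> q)) (≤-pred (≰⇒> q))))) (<-irrefl refl)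
    private-bound Q {ps} strong pairs | no ¬p | [] , le , anti , F⊆ | yes ()
    private-bound Q {ps} strong pairs | no ¬p | F@(_ ∷ _) , le , anti , F⊆ | yes long =
      ⊥-elim (no-strong-matching (λ e∈ → All.lookup strong (F⊆ e∈)) anti long Q (here refl))

-- Separations

module Separations {n} (G : Graph (Fin n)) (free : Free (bull ∷ chair ∷ []) G) where
  open Adjacency G
  open Forbidden free
  open Modules G
  open Matchings G free

  Connected : Subset n → Set
  Connected S = ∀ {u v} → u ∈ S → v ∈ S → Star (Edge S) u v

  On : (Fin n → Fin n → Set) → Pair → Set
  On Str (x , w) = Str x w

  Uncrossed : (Fin n → Fin n → Set) → Pair → Pair → Set
  Uncrossed Str (x , w) (x′ , w′) = x ≁ x′ × ¬ Str x w′ × ¬ Str x′ w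

  -- What the colouring argument requires of the edges to be cut, so that joins and strong edges are
  -- treated alike. `dominated` supplies the vertex whose colour is lost on a part that is connected
  -- without cut edges; `bound` limits how many pebbles of one colour can each have a private
  -- neighbour across cut edges.
  record Separation (S : Subset n) : Set₁ where
    field
      Str  : Fin n → Fin n → Set
      str? : ∀ u w → Dec (Str u w)
      str-edge : ∀ {u w} → Str u w → Edge S u w
      dominated : ∀ {K x} → K ⊆ S → x ∈ K →
        (∀ {u} → u ∈ K → Star (λ a b → Edge S a b × ¬ Str a b) x u) →
        ∃[ h ] h ∈ S × (∀ {u} → u ∈ K → h ~ u)
      bound : ∀ {ps : List Pair} → All (On Str) ps → AllPairs (Uncrossed Str) ps → length ps ≤ 16

  Join : Subset n → Subset n → Set
  Join S A = (∃[ a ] a ∈ S × a ∈ A) × (∃[ b ] b ∈ S × b ∉ A) ×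
    (∀ a b → a ∈ S → b ∈ S → a ∈ A → b ∉ A → a ~ b)

  join? : ∀ S A → Dec (Join S A)
  join? S A =
    (any? λ a → (a ∈? S) ×-dec (a ∈? A)) ×-dec
    (any? λ b → (b ∈? S) ×-dec ¬? (b ∈? A)) ×-dec
    (all? λ a → all? λ b → (a ∈? S) →-dec (b ∈? S) →-dec (a ∈? A) →-dec ¬? (b ∈? A) →-dec (a ~? b))

  module _ {S : Subset n} where

    -- The cut edges are those across the join. A path avoiding them stays on one side, and every
    -- vertex of the other side dominates it. Two non-adjacent vertices lie on the same side and see
    -- the same vertices across, so two pairs are never uncrossed.
    join-separation : ∀ {A} → Join S A → Separation S
    join-separation {A} ((a₀ , a₀∈ , a₀A) , (b₀ , b₀∈ , b₀A) , complete) = record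
      { Str = Str
      ; str? = λ u w → (u ∈? S) ×-dec (w ∈? S) ×-dec
          (((u ∈? A) ×-dec ¬? (w ∈? A)) ⊎-dec (¬? (u ∈? A) ×-dec (w ∈? A)))
      ; str-edge = edge
      ; dominated = dominated
      ; bound = bound
      }
      where
      Str : Fin n → Fin n → Set
      Str u w = u ∈ S × w ∈ S × ((u ∈ A × w ∉ A) ⊎ (u ∉ A × w ∈ A))
      edge : ∀ {u w} → Str u w → Edge S u w
      edge (u∈ , w∈ , inj₁ (uA , wA)) = u∈ , w∈ , complete _ _ u∈ w∈ uA wA
      edge (u∈ , w∈ , inj₂ (uA , wA)) = u∈ , w∈ , ~-sym (complete _ _ w∈ u∈ wA uA)
      stay : ∀ {a b} → Edge S a b × ¬ Str a b → a ∈ A → b ∈ A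
      stay {b = b} ((a∈ , b∈ , _) , ¬s) aA with b ∈? A
      ... | yes p = p
      ... | no  p = contradiction (a∈ , b∈ , inj₁ (aA , p)) ¬s
      stay′ : ∀ {a b} → Edge S a b × ¬ Str a b → a ∉ A → b ∉ A
      stay′ ((a∈ , b∈ , _) , ¬s) aA bA = ¬s (a∈ , b∈ , inj₂ (aA , bA))
      dominated : ∀ {K x} → K ⊆ S → x ∈ K →
        (∀ {u} → u ∈ K → Star (λ a b → Edge S a b × ¬ Str a b) x u) →
        ∃[ h ] h ∈ S × (∀ {u} → u ∈ K → h ~ u)
      dominated {K} {x} K⊆S x∈ path with x ∈? A
      ... | yes xA = b₀ , b₀∈ , λ u∈ → ~-sym (complete _ _ (K⊆S u∈) b₀∈ (star-transport (_∈ A) stay (path u∈) xA) b₀A)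
      ... | no  xA = a₀ , a₀∈ , λ u∈ → complete _ _ a₀∈ (K⊆S u∈) a₀A (star-transport (_∉ A) stay′ (path u∈) xA)
      bound : ∀ {ps : List Pair} → All (On Str) ps → AllPairs (Uncrossed Str) ps → length ps ≤ 16
      bound [] _ = z≤n
      bound (_ ∷ []) _ = s≤s z≤n
      bound {(x , w) ∷ (x′ , w′) ∷ _} ((x∈ , w∈ , s) ∷ (x′∈ , _ , _) ∷ _) (((xx′ , _ , ¬s) ∷ _) ∷ _)
        with x ∈? A | x′ ∈? A | s
      ... | yes xA | no  x′A | _ = ⊥-elim (true≢false (complete _ _ x∈ x′∈ xA x′A) xx′)
      ... | no  xA | yes x′A | _ = ⊥-elim (true≢false (complete _ _ x′∈ x∈ x′A xA) (≁-sym xx′))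
      ... | yes _  | yes x′A | inj₁ (_ , wA) = contradiction (x′∈ , w∈ , inj₁ (x′A , wA)) ¬s
      ... | yes xA | yes _   | inj₂ (¬xA , _) = contradiction xA ¬xA
      ... | no  _  | no  x′A | inj₂ (_ , wA) = contradiction (x′∈ , w∈ , inj₂ (x′A , wA)) ¬s
      ... | no ¬xA | no  _   | inj₁ (xA , _) = contradiction xA ¬xA

    crossing : ∀ {M x z} → Star (Edge S) x z → x ∈ M → z ∉ M →
      ∃[ a ] ∃[ b ] Edge S a b × a ∈ M × b ∉ M
    crossing ε x∈ z∉ = contradiction x∈ z∉
    crossing {M} {x} (_◅_ {j = b} e s) x∈ z∉ with b ∈? M
    ... | yes b∈ = crossing s b∈ z∉
    ... | no  b∉ = x , b , e , x∈ , b∉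

    module _ (connected : Connected S) (no-join : ∀ A → ¬ Join S A) (Q : Claw S) where

      -- Only properness is delicate. If the union were all of `S`, connectedness gives an edge from
      -- `M` to some `b` outside, so `b` is adjacent to all of `M`, in particular to `z′`, which
      -- lies outside `M′`. Then `z′` is adjacent to all of `M′`, hence every vertex outside `M` is
      -- adjacent to `z′` and so to all of `M`: a join.
      union-module : ∀ {M M′ v} → ProperModule S M → ProperModule S M′ → v ∈ M → v ∈ M′ → ProperModule S (M ∪ M′)
      union-module {M} {M′} {v} (M⊆ , unif , z , z∈ , z∉) (M′⊆ , unif′ , z′ , z′∈ , z′∉) v∈ v∈′ =
        (λ u∈ → ∪-elim (_∈ S) M⊆ M′⊆ u∈) , uniform , rest
        where
        ∪-elim : ∀ (P : Fin n → Set) → (∀ {u} → u ∈ M → P u) → (∀ {u} → u ∈ M′ → P u) → ∀ {u} → u ∈ M ∪ M′ → P u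
        ∪-elim P p p′ u∈ with x∈p∪q⁻ M M′ u∈
        ... | inj₁ q = p q
        ... | inj₂ q = p′ q
        uniform : ∀ z u w → z ∈ S → z ∉ M ∪ M′ → u ∈ M ∪ M′ → w ∈ M ∪ M′ → z ~ u → z ~ w
        uniform z u w z∈ z∉ u∈ w∈ zu = ∪-elim (z ~_)
          (λ {w} w∈ → unif z v w z∈ zM v∈ w∈ zv) (λ {w} w∈ → unif′ z v w z∈ zM′ v∈′ w∈ zv) w∈
          where
          zM : z ∉ M
          zM p = z∉ (x∈p∪q⁺ (inj₁ p))
          zM′ : z ∉ M′
          zM′ p = z∉ (x∈p∪q⁺ (inj₂ p))
          zv : z ~ v
          zv = ∪-elim (λ u → z ~ u → z ~ v) (λ {u} u∈ → unif z u v z∈ zM u∈ v∈)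
            (λ {u} u∈ → unif′ z u v z∈ zM′ u∈ v∈′) u∈ zu
        rest : ∃[ z ] z ∈ S × z ∉ M ∪ M′
        rest with any? (λ z → (z ∈? S) ×-dec ¬? (z ∈? M ∪ M′))
        ... | yes p = p
        ... | no ¬p with crossing (connected (M⊆ v∈) z∈) v∈ z∉
        ...   | a , b , (a∈ , b∈ , ab) , aM , bM =
          contradiction ((v , M⊆ v∈ , v∈) , (z , z∈ , z∉) , λ c d c∈ d∈ cM dM →
            ~-sym (unif d z′ c d∈ dM z′M cM (~-sym
              (unif′ z′ b d z′∈ z′∉ (in-M′ b∈ bM) (in-M′ d∈ dM) (~-sym (unif b a z′ b∈ bM aM z′M (~-sym ab)))))))
            (no-join M)
          where
          covered : ∀ {u} → u ∈ S → u ∈ M ⊎ u ∈ M′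
          covered {u} u∈ with u ∈? M ∪ M′
          ... | yes q = x∈p∪q⁻ M M′ q
          ... | no  q = contradiction (u , u∈ , q) ¬p
          in-M′ : ∀ {u} → u ∈ S → u ∉ M → u ∈ M′
          in-M′ u∈ u∉ with covered u∈
          ... | inj₁ q = contradiction q u∉
          ... | inj₂ q = q
          z′M : z′ ∈ M
          z′M with covered z′∈
          ... | inj₁ q = q
          ... | inj₂ q = contradiction q z′∉

      weak-trans : ∀ {u v w} → Weak S u v → Weak S v w → Weak S u w
      weak-trans (M , m , u∈ , v∈) (M′ , m′ , v∈′ , w∈) =
        M ∪ M′ , union-module m m′ v∈ v∈′ , x∈p∪q⁺ (inj₁ u∈) , x∈p∪q⁺ (inj₂ w∈)

      -- A singleton is a module, and the claw provides a second vertex that makes it proper.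
      weak-refl : ∀ {x} → x ∈ S → Weak S x x
      weak-refl {x} x∈ = ⟪ _≟ᶠ x ⟫ ,
        ((λ u∈ → subst (_∈ S) (≡-sym (∈⟪⟫⁻ (_≟ᶠ x) u∈)) x∈) ,
         (λ z u v _ _ u∈ v∈ zu → subst (z ~_) (trans (∈⟪⟫⁻ (_≟ᶠ x) u∈) (≡-sym (∈⟪⟫⁻ (_≟ᶠ x) v∈))) zu) , other) ,
        ∈⟪⟫⁺ (_≟ᶠ x) refl , ∈⟪⟫⁺ (_≟ᶠ x) refl
        where
        open Claw Q
        other : ∃[ z ] z ∈ S × z ∉ ⟪ _≟ᶠ x ⟫
        other with y ≟ᶠ x
        ... | no  p = y , y∈ , λ q → p (∈⟪⟫⁻ (_≟ᶠ x) q)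
        ... | yes refl = t₁ , t₁∈ , λ q → ~⇒≢ yt₁ (≡-sym (∈⟪⟫⁻ (_≟ᶠ x) q))

      -- Being weakly related to `x` is witnessed by a different module for each vertex; all of them
      -- contain `x`, so their union is again a proper module.
      weak-hull : ∀ {x} → x ∈ S → ∀ us → All (Weak S x) us →
        ∃[ M ] ProperModule S M × x ∈ M × All (_∈ M) us
      weak-hull x∈ [] [] with weak-refl x∈
      ... | M , m , xM , _ = M , m , xM , []
      weak-hull x∈ (u ∷ us) ((M , m , xM , uM) ∷ ws) with weak-hull x∈ us ws
      ... | M′ , m′ , xM′ , usM′ = M ∪ M′ , union-module m m′ xM xM′ , x∈p∪q⁺ (inj₁ xM) ,
        x∈p∪q⁺ (inj₁ uM) ∷ All.map (λ p → x∈p∪q⁺ (inj₂ p)) usM′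

      strong-separation : Separation S
      strong-separation = record
        { Str = Strong
        ; str? = λ u w → (u ∈? S) ×-dec (w ∈? S) ×-dec (u ~? w) ×-dec ¬? (weak? S u w)
        ; str-edge = λ (u∈ , w∈ , uw , _) → u∈ , w∈ , uw
        ; dominated = dominated
        ; bound = λ strong pairs → private-bound Q strong (privates strong pairs)
        }
        where
        Strong : Fin n → Fin n → Set
        Strong u w = StrongEdge S (u , w)
        weak-edge : ∀ {a b} → Edge S a b × ¬ StrongEdge S (a , b) → Weak S a b
        weak-edge {a} {b} ((a∈ , b∈ , ab) , ¬s) =
          decidable-stable (weak? S a b) λ ¬w → ¬s (a∈ , b∈ , ab , ¬w)
        dominated : ∀ {K x} → K ⊆ S → x ∈ K →
          (∀ {u} → u ∈ K → Star (λ a b → Edge S a b × ¬ StrongEdge S (a , b)) x u) →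
          ∃[ h ] h ∈ S × (∀ {u} → u ∈ K → h ~ u)
        dominated {K} {x} K⊆S x∈ path
          with weak-hull (K⊆S x∈) (filter (_∈? K) (allFin n))
            (All.tabulate λ u∈ → star-transport (Weak S x) (λ e w → weak-trans w (weak-edge e))
              (path (proj₂ (∈-filter⁻ (_∈? K) {xs = allFin n} u∈))) (weak-refl (K⊆S x∈)))
        -- By connectedness an edge leaves the hull; its outer end sees one vertex of the module and
        -- therefore all of it.
        ... | M , (M⊆ , unif , z , z∈ , z∉) , xM , KM with crossing (connected (K⊆S x∈) z∈) xM z∉
        ...   | a , h , (a∈ , h∈ , ah) , aM , hM =
          h , h∈ , λ {u} u∈ → unif h a u h∈ hM aM (All.lookup KM (∈-filter⁺ (_∈? K) (∈-allFin u) u∈)) (~-sym ah)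
        -- This upgrades "not strongly adjacent" to "not adjacent". If `x w′` were a weak edge, its
        -- module could not contain `x′`, as `x′ w′` is strong; but then `x′` sees `w′` and hence
        -- also `x`.
        apart : ∀ {x w x′ w′} → StrongEdge S (x , w) → StrongEdge S (x′ , w′) →
          x ≁ x′ → ¬ StrongEdge S (x , w′) → x ≁ w′
        apart {x} {w} {x′} {w′} (x∈ , _ , _ , _) (x′∈ , w′∈ , x′w′ , ¬weak) xx′ ¬s = ¬~⇒≁ absurd
          where
          absurd : ¬ (x ~ w′)
          absurd xw′ with weak-edge ((x∈ , w′∈ , xw′) , ¬s)
          ... | M , m@(_ , unif , _) , xM , w′M with x′ ∈? M
          ...   | yes x′M = ¬weak (M , m , x′M , w′M)
          ...   | no  x′M = true≢false (unif x′ w′ x x′∈ x′M w′M xM x′w′) (≁-sym xx′)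
        privates : ∀ {ps : List Pair} → All (On Strong) ps → AllPairs (Uncrossed Strong) ps → AllPairs (Private {S}) ps
        privates [] [] = []
        privates (s ∷ ss) (ps ∷ pss) = All.zipWith
          (λ { (s′ , xx′ , p , q) → xx′ , apart s s′ xx′ p , ≁-sym (apart s′ s (≁-sym xx′) q) }) (ss , ps)
          ∷ privates ss pss

-- Consistent families of partial colourings

Entry : ℕ → ℕ → Set
Entry n k = Fin n × Fin k

hasColour : ∀ {n k} → Fin k → Entry n k → Bool
hasColour c e = does (proj₂ e ≟ᶠ c)

tally : ∀ {n k} → Fin k → List (Entry n k) → ℕ
tally c = count (hasColour c)

tally-++ : ∀ {n k} (c : Fin k) (ρ π : List (Entry n k)) → tally c (ρ ++ π) ≡ tally c ρ + tally c π
tally-++ c ρ π = trans (cong length (filter-++ _ ρ π)) (length-++ (sel (hasColour c) ρ))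

-- The interface between the surviving states and the graph theory. In `extend` the vertex is ours
-- to choose and the colour is not. Only the number of entries of each colour limits an extension.
record Family {n k} (q : ℕ) (G : Graph (Fin n)) (L : Fin n → Subset k) : Set₁ where
  field
    Live   : List (Entry n k) → Set
    live?  : ∀ π → Dec (Live π)
    sub    : ∀ {ρ π} → (∀ {e} → e ∈ˡ ρ → e ∈ˡ π) → Live π → Live ρ
    extend : ∀ {π} → Live π → (∀ c → tally c π < q) → ∀ v → ∃[ c ] Live ((v , c) ∷ π)
    proper : ∀ {π u v c} → Live π → (u , c) ∈ˡ π → (v , c) ∈ˡ π → adj G u v ≡ false
    listed : ∀ {π v c} → Live π → (v , c) ∈ˡ π → c ∈ L v

count-strict : ∀ {A : Set} (p q : A → Bool) (xs : List A) → (∀ x → p x ≡ true → q x ≡ true) →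
  ∀ {a} → a ∈ˡ xs → q a ≡ true → p a ≡ false → count p xs < count q xs
count-strict p q (x ∷ xs) imp (here refl) qa pa rewrite qa | pa =
  s≤s (≤-trans (count-cover q (λ _ → false) p xs λ {e} _ pe → inj₁ (imp e pe))
    (≤-reflexive (trans (cong (count q xs +_) (none xs)) (+-comm _ 0))))
  where
  none : ∀ {A : Set} (xs : List A) → count (λ _ → false) xs ≡ 0
  none [] = refl
  none (_ ∷ xs) = none xs
count-strict p q (x ∷ xs) imp (there a∈) qa pa with p x in px | q x in qx | count-strict p q xs imp a∈ qa pa
... | true  | true  | ih = s≤s ih
... | true  | false | ih = contradiction (trans (≡-sym (imp x px)) qx) λ ()
... | false | true  | ih = m≤n⇒m≤1+n ih
... | false | false | ih = ih

lookup-removeAt : ∀ {A : Set} (xs : List A) {i j} → i ≢ j → lookup xs j ∈ˡ removeAt xs i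
lookup-removeAt (x ∷ xs) {zero}  {zero}  p = contradiction refl p
lookup-removeAt (x ∷ xs) {zero}  {suc j} p = ∈-lookup j
lookup-removeAt (x ∷ xs) {suc i} {zero}  p = here refl
lookup-removeAt (x ∷ xs) {suc i} {suc j} p = there (lookup-removeAt xs λ q → p (cong suc q))

removeAt-⊆ : ∀ {A : Set} (xs : List A) i {e} → e ∈ˡ removeAt xs i → e ∈ˡ xs
removeAt-⊆ (x ∷ xs) zero e∈ = there e∈
removeAt-⊆ (x ∷ xs) (suc i) (here p) = here p
removeAt-⊆ (x ∷ xs) (suc i) (there e∈) = there (removeAt-⊆ xs i e∈)

removeAt-length : ∀ {A : Set} (xs : List A) i → suc (length (removeAt xs i)) ≡ length xs
removeAt-length (x ∷ xs) zero = refl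
removeAt-length (x ∷ y ∷ xs) (suc i) = cong suc (removeAt-length (y ∷ xs) i)

Any-removeAt : ∀ {A : Set} {P : A → Set} (xs : List A) i → Any P xs → P (lookup xs i) ⊎ Any P (removeAt xs i)
Any-removeAt (x ∷ xs) zero (here p) = inj₁ p
Any-removeAt (x ∷ xs) zero (there a) = inj₂ a
Any-removeAt (x ∷ xs) (suc i) (here p) = inj₂ (here p)
Any-removeAt (x ∷ xs) (suc i) (there a) with Any-removeAt xs i a
... | inj₁ p = inj₁ p
... | inj₂ a′ = inj₂ (there a′)

count-map : ∀ {A B : Set} (f : A → B) (p : B → Bool) (xs : List A) →
  count p (map f xs) ≡ count (λ a → p (f a)) xs
count-map f p [] = refl
count-map f p (x ∷ xs) with p (f x)
... | true  = cong suc (count-map f p xs)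
... | false = count-map f p xs

AllPairs-apply : ∀ {A : Set} {P : A → Set} {R : A → A → Set} {xs : List A} →
  AllPairs (λ a b → P a → P b → R a b) xs → All P xs → AllPairs R xs
AllPairs-apply [] [] = []
AllPairs-apply {P = P} {R} (_∷_ {x = a} rs ps) (pa ∷ pas) = go rs pas ∷ AllPairs-apply ps pas
  where
  go : ∀ {ys} → All (λ b → P a → P b → R a b) ys → All P ys → All (R a) ys
  go [] [] = []
  go (r ∷ rs) (pb ∷ pbs) = r pa pb ∷ go rs pbs

-- Colouring from the live colours

module Consistency {n k q} (G : Graph (Fin n)) (free : Free (bull ∷ chair ∷ []) G)
                   (L : Fin n → Subset k) (family : Family q G L) (c₀ : Fin k) where
  open Adjacency G
  open Forbidden free
  open Modules G
  open Matchings G free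
  open Separations G free
  open Family family

  private
    E : Set
    E = Entry n k

  -- Liveness is required of each vertex separately, over the same `π`: no state is large enough to
  -- hold the colouring as a whole.
  Colouring : List E → Subset n → Set
  Colouring π S = Σ[ f ∈ (Fin n → Fin k) ] (∀ {u} → u ∈ S → Live ((u , f u) ∷ π)) × (∀ {u v} → u ∈ S → v ∈ S → u ~ v → f u ≢ f v)

  module _ {S : Subset n} (sep : Separation S) (π : List E) where
    open Separation sep

    Covers : List E → E → Set
    Covers R (w , c) = Any (λ e → proj₂ e ≡ c × Str (proj₁ e) w) R

    covers? : ∀ R e → Dec (Covers R e)
    covers? R (w , c) = Any.any? (λ e → (proj₂ e ≟ᶠ c) ×-dec str? (proj₁ e) w) R

    -- The vertex `w` is a private strong neighbour of its pebble with respect to the other pebbles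
    -- of the same colour.
    Irredundant : List E → Set
    Irredundant R = ∀ i → ∃[ w ] Str (proj₁ (lookup R i)) w × ¬ Covers (removeAt R i) (w , proj₂ (lookup R i))

    prune : ∀ m R → length R ≤ m →
      ∃[ R′ ] (∀ {e} → e ∈ˡ R′ → e ∈ˡ R) × (∀ e → Covers R e → Covers R′ e) × Irredundant R′
    prune zero [] _ = [] , (λ e∈ → e∈) , (λ _ c → c) , λ ()
    prune (suc m) R le with any? (λ i → all? λ w →
      str? (proj₁ (lookup R i)) w →-dec covers? (removeAt R i) (w , proj₂ (lookup R i)))
    ... | yes (i , redundant) with prune m (removeAt R i) (≤-pred (≤-trans (≤-reflexive (removeAt-length R i)) le))
    ...   | R′ , R′⊆ , cov , irr = R′ , (λ e∈ → removeAt-⊆ R i (R′⊆ e∈)) , (λ e c → cov e (keep e c)) , irr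
      where
      keep : ∀ e → Covers R e → Covers (removeAt R i) e
      keep (w , c) cov with Any-removeAt R i cov
      ... | inj₂ a = a
      ... | inj₁ (refl , s) = redundant w s
    prune (suc m) R le | no ¬p = R , (λ e∈ → e∈) , (λ _ c → c) , irr
      where
      irr : Irredundant R
      irr i with any? (λ w → str? (proj₁ (lookup R i)) w ×-dec ¬? (covers? (removeAt R i) (w , proj₂ (lookup R i))))
      ... | yes p = p
      ... | no ¬q = contradiction (i , λ w s → decidable-stable (covers? _ _) λ ¬c → ¬q (w , s , ¬c)) ¬p

    -- Pebbles of one colour are pairwise non-adjacent because a live partial colouring is proper,
    -- and irredundancy excludes strong edges to the private neighbours of others. Thus the pairs
    -- are uncrossed and `bound` applies.
    irredundant-bound : ∀ {R} → Live (R ++ π) → Irredundant R → ∀ c → tally c R ≤ 16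
    irredundant-bound {R} live irr c = ≤-trans (≤-reflexive length-eq)
      (bound {map pair chosen} (Allₚ.map⁺ (Allₚ.filter⁺ _ (Allₚ.tabulate⁺ λ i → proj₁ (proj₂ (irr i)))))
        (AllPairsₚ.map⁺ (AllPairs-apply (AllPairsₚ.filter⁺ _ (AllPairsₚ.tabulate⁺ uncrossed)) (Allₚ.all-filter _ triples))))
      where
      Triple : Set
      Triple = E × Fin n
      pair : Triple → Pair
      pair ((x , _) , w) = x , w
      coloured : Triple → Bool
      coloured t = hasColour c (proj₁ t)
      entry : Fin (length R) → Triple
      entry i = lookup R i , proj₁ (irr i)
      triples chosen : List Triple
      triples = tabulate entry
      chosen = sel coloured triples
      length-eq : tally c R ≡ length (map pair chosen)
      length-eq = trans (cong (tally c) (≡-sym (trans (map-tabulate entry proj₁) (tabulate-lookup R))))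
        (trans (count-map proj₁ (hasColour c) triples) (≡-sym (length-map pair chosen)))
      uncrossed : ∀ {i j} → i ≢ j → coloured (entry i) ≡ true → coloured (entry j) ≡ true →
        Uncrossed Str (pair (entry i)) (pair (entry j))
      uncrossed {i} {j} i≢j ci cj with dec-does (_ ≟ᶠ c) ci | dec-does (_ ≟ᶠ c) cj
      ... | pi | pj =
        proper live (∈-++⁺ˡ (subst (λ d → (proj₁ (lookup R i) , d) ∈ˡ R) pi (∈-lookup i)))
          (∈-++⁺ˡ (subst (λ d → (proj₁ (lookup R j) , d) ∈ˡ R) pj (∈-lookup j))) ,
        (λ s → proj₂ (proj₂ (irr j)) (lose (lookup-removeAt R (λ q → i≢j (≡-sym q))) (trans pi (≡-sym pj) , s))) ,
        (λ s → proj₂ (proj₂ (irr i)) (lose (lookup-removeAt R i≢j) (trans pj (≡-sym pi) , s)))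

    Separated : List E → Set
    Separated R = ∀ {u w c} → Str u w → Live ((u , c) ∷ R ++ π) → Live ((w , c) ∷ R ++ π) → ⊥

    private
      entries : List E
      entries = cartesianProduct (allFin n) (allFin k)

      uncovered : List E → E → Bool
      uncovered R e = not (does (covers? R e))

    -- A live pebble at a strong live edge covers a new pair, so the number of uncovered pairs decreases.
    pebble : ∀ m R → count (uncovered R) entries < m → Live (R ++ π) → Irredundant R →
      ∃[ R′ ] Live (R′ ++ π) × (∀ c → tally c R′ ≤ 16) × Separated R′
    pebble (suc m) R (s≤s le) live irr with any? (λ u → any? λ w → any? λ c →
      str? u w ×-dec live? ((u , c) ∷ R ++ π) ×-dec live? ((w , c) ∷ R ++ π))
    ... | no ¬p = R , live , irredundant-bound live irr , λ s lu lw → ¬p (_ , _ , _ , s , lu , lw)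
    ... | yes (u , w , c , s , lu , lw) with prune _ ((u , c) ∷ R) ≤-refl
    ...   | R′ , R′⊆ , cov , irr′ = pebble m R′ (≤-trans fewer le) live′ irr′
      where
      live′ : Live (R′ ++ π)
      live′ = sub (λ e∈ → [ (λ p → ∈-++⁺ˡ (R′⊆ p)) , ∈-++⁺ʳ _ ]′ (∈-++⁻ R′ e∈)) lu
      new : ¬ Covers R (w , c)
      new cov with find cov
      ... | (x , c) , x∈ , refl , xw = true≢false (proj₂ (proj₂ (str-edge xw)))
        (proper lw (there (∈-++⁺ˡ x∈)) (here refl))
      not-does : ∀ {P Q : Set} (P? : Dec P) (Q? : Dec Q) → (Q → P) → not (does P?) ≡ true → not (does Q?) ≡ true
      not-does (no ¬p) (yes q) f _ = contradiction (f q) ¬p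
      not-does (no ¬p) (no ¬q) f _ = refl
      fewer : count (uncovered R′) entries < count (uncovered R) entries
      fewer = count-strict (uncovered R′) (uncovered R) entries
        (λ e → not-does (covers? R′ e) (covers? R e) (λ a → cov e (there a)))
        (∈-cartesianProduct⁺ (∈-allFin w) (∈-allFin c))
        (cong not (dec-false (covers? R (w , c)) new))
        (cong not (dec-true (covers? R′ (w , c)) (cov (w , c) (here (refl , s)))))

  -- Claw-free sets and their breadth-first layers

  module Sweep {S : Subset n} (connected : Connected S) (claw-free : ¬ Claw S) {s₀ : Fin n} (s₀∈ : s₀ ∈ S) where

    Reach : ℕ → Fin n → Set
    Reach zero v = v ≡ s₀
    Reach (suc i) v = Reach i v ⊎ (v ∈ S × ∃[ u ] Reach i u × u ~ v)

    reach? : ∀ i v → Dec (Reach i v)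
    reach? zero v = v ≟ᶠ s₀
    reach? (suc i) v = reach? i v ⊎-dec ((v ∈? S) ×-dec any? λ u → reach? i u ×-dec (u ~? v))

    Layer : ℕ → Fin n → Set
    Layer zero v = v ≡ s₀
    Layer (suc i) v = Reach (suc i) v × ¬ Reach i v

    layer? : ∀ i v → Dec (Layer i v)
    layer? zero v = v ≟ᶠ s₀
    layer? (suc i) v = reach? (suc i) v ×-dec ¬? (reach? i v)

    layer⇒reach : ∀ i {v} → Layer i v → Reach i v
    layer⇒reach zero l = l
    layer⇒reach (suc i) l = proj₁ l

    reach-mono : ∀ {i j v} → i ≤ j → Reach i v → Reach j v
    reach-mono {j = zero} z≤n r = r
    reach-mono {j = suc j} z≤n r = inj₁ (reach-mono {j = j} z≤n r)
    reach-mono (s≤s le) (inj₁ r) = inj₁ (reach-mono le r)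
    reach-mono (s≤s le) (inj₂ (v∈ , u , r , uv)) = inj₂ (v∈ , u , reach-mono le r , uv)

    layer-bound : ∀ {i j v} → Layer j v → Reach i v → j ≤ i
    layer-bound {i} {zero} l r = z≤n
    layer-bound {i} {suc j} l r with suc j ≤? i
    ... | yes p = p
    ... | no ¬p = contradiction (reach-mono (≤-pred (≰⇒> ¬p)) r) (proj₂ l)

    layer-edge : ∀ {i j u v} → v ∈ S → Layer i u → Layer j v → u ~ v → j ≤ suc i
    layer-edge {i} v∈ lu lv uv = layer-bound lv (inj₂ (v∈ , _ , layer⇒reach i lu , uv))

    far : ∀ {i u v} → v ∈ S → Layer i u → Layer (suc (suc i)) v → u ≁ v
    far v∈ lu lv = ¬~⇒≁ λ uv → <-irrefl refl (layer-edge v∈ lu lv uv)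

    layer-∈ : ∀ i {v} → Layer i v → v ∈ S
    layer-∈ zero refl = s₀∈
    layer-∈ (suc i) (inj₁ r , ¬r) = contradiction r ¬r
    layer-∈ (suc i) (inj₂ (v∈ , _) , _) = v∈

    parent : ∀ i {v} → Layer (suc i) v → ∃[ u ] Layer i u × u ~ v
    parent i (inj₁ r , ¬r) = contradiction r ¬r
    parent zero (inj₂ (v∈ , u , r , uv) , ¬r) = u , r , uv
    parent (suc i) (inj₂ (v∈ , u , r , uv) , ¬r) = u , (r , λ r′ → ¬r (inj₂ (v∈ , u , r′ , uv))) , uv

    reach⇒layer : ∀ i {v} → Reach i v → ∃[ j ] Layer j v
    reach⇒layer zero r = 0 , r
    reach⇒layer (suc i) {v} r with reach? i v
    ... | yes r′ = reach⇒layer i r′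
    ... | no ¬r′ = suc i , r , ¬r′

    layered : ∀ {v} → v ∈ S → ∃[ i ] Layer i v
    layered v∈ = reach⇒layer _ (proj₂ (star-transport (λ u → ∃[ i ] Reach i u)
      (λ { (_ , b∈ , ab) (i , r) → suc i , inj₂ (b∈ , _ , r , ab) }) (connected s₀∈ v∈) (0 , refl)))

    LayerIndependent : ℕ → Set
    LayerIndependent i = ∀ {a b c} → Layer i a → Layer i b → Layer i c →
      a ≢ b → a ≢ c → b ≢ c → a ≁ b → a ≁ c → b ≁ c → ⊥

    layers-apart : ∀ {i u} → Layer i u → Layer (suc (suc i)) u → ⊥
    layers-apart {i} l l′ = <-irrefl refl (≤-trans (n≤1+n _) (layer-bound l′ (layer⇒reach i l)))

    -- Parents of three independent vertices are again three independent vertices, one layer lower.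
    -- A vertex with two non-adjacent children would form a claw with them and its own parent. If
    -- the parents `p` and `r` were adjacent, let `s` be a parent of `p`: should `s` see `r`, the
    -- triangle with the two children is a bull; otherwise `p` is the centre of a claw on `s`, `r`
    -- and `u`. In the layer next to `s₀` such a triple is a claw at `s₀`.
    next-layer-independence : ∀ i → LayerIndependent (suc i) → LayerIndependent (suc (suc i))
    next-layer-independence i independent {a} {b} {c} la lb lc a≢b a≢c b≢c ab ac bc
      with parent (suc i) la | parent (suc i) lb | parent (suc i) lc
    ... | x , lx , xa | y , ly , yb | z , lz , zc =
      independent lx ly lz
        (λ { refl → true≢false yb xb }) (λ { refl → true≢false zc xc }) (λ { refl → true≢false zc yc })
        (siblings la lb lx ly xa yb xb (one-child lb la ly (λ q → a≢b (≡-sym q)) (≁-sym ab) yb) ab)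
        (siblings la lc lx lz xa zc xc (one-child lc la lz (λ q → a≢c (≡-sym q)) (≁-sym ac) zc) ac)
        (siblings lb lc ly lz yb zc yc (one-child lc lb lz (λ q → b≢c (≡-sym q)) (≁-sym bc) zc) bc)
      where
      one-child : ∀ {u v p} → Layer (suc (suc i)) u → Layer (suc (suc i)) v → Layer (suc i) p →
        u ≢ v → u ≁ v → p ~ u → p ≁ v
      one-child {u} {v} {p} lu lv lp u≢v uv pu with parent i lp
      ... | r , lr , rp = ¬~⇒≁ λ pv →
        claw-free (claw (layer-∈ (suc i) lp) (layer-∈ i lr) (layer-∈ (suc (suc i)) lu) (layer-∈ (suc (suc i)) lv) (~-sym rp) pu pv
          (λ { refl → layers-apart lr lu }) (λ { refl → layers-apart lr lv }) u≢v (far (layer-∈ (suc (suc i)) lu) lr lu)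
          (far (layer-∈ (suc (suc i)) lv) lr lv) uv)
      xb = one-child la lb lx a≢b ab xa
      xc = one-child la lc lx a≢c ac xa
      yc = one-child lb lc ly b≢c bc yb
      siblings : ∀ {u v p r} → Layer (suc (suc i)) u → Layer (suc (suc i)) v → Layer (suc i) p → Layer (suc i) r →
        p ~ u → r ~ v → p ≁ v → r ≁ u → u ≁ v → p ≁ r
      siblings {u} {v} {p} {r} lu lv lp lr pu rv pv ru uv with parent i lp
      ... | s , ls , sp = ¬~⇒≁ λ pr → absurd pr (~-or-≁ s r)
        where
        su : s ≁ u
        su = far (layer-∈ (suc (suc i)) lu) ls lu
        sv : s ≁ v
        sv = far (layer-∈ (suc (suc i)) lv) ls lv
        absurd : p ~ r → s ~ r ⊎ s ≁ r → ⊥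
        absurd pr (inj₁ sr) = no-bull pr (~-sym sr) (~-sym sp) pu rv pv ru su sv uv
        absurd pr (inj₂ sr) = claw-free (claw (layer-∈ (suc i) lp) (layer-∈ i ls) (layer-∈ (suc i) lr) (layer-∈ (suc (suc i)) lu) (~-sym sp) pr pu
          (λ { refl → true≢false rv sv }) (λ { refl → layers-apart ls lu }) (λ { refl → true≢false rv uv }) sr su ru)

    layer-independence : ∀ i → LayerIndependent i
    layer-independence zero la lb lc a≢b _ _ _ _ _ = a≢b (trans la (≡-sym lb))
    layer-independence (suc zero) la lb lc a≢b a≢c b≢c ab ac bc
      with parent 0 la | parent 0 lb | parent 0 lc
    ... | _ , refl , sa | _ , refl , sb | _ , refl , sc =
      claw-free (claw s₀∈ (layer-∈ 1 la) (layer-∈ 1 lb) (layer-∈ 1 lc) sa sb sc a≢b a≢c b≢c ab ac bc)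
    layer-independence (suc (suc i)) = next-layer-independence i (layer-independence (suc i))

    module _ {π : List E} (live : Live π) (room : ∀ c → tally c π + 5 ≤ q) where

      InLayer : ℕ → List E → Set
      InLayer i ρ = map proj₁ ρ ≡ filter (layer? i) (allFin n)

      thin : ∀ i {ρ π′} → All (Layer i) (map proj₁ ρ) → Unique (map proj₁ ρ) → Live π′ → (∀ {e} → e ∈ˡ ρ → e ∈ˡ π′) →
        ∀ c → tally c ρ ≤ 2
      thin i {ρ} in-layer unique live′ ρ⊆ c with tally c ρ ≤? 2
      ... | yes p = p
      ... | no ¬p with three (hasColour c) ρ (≰⇒> ¬p) (AllPairsₚ.map⁻ unique)
      ...   | (x , cx) , (y , cy) , (z , cz) , (x∈ , px) , (y∈ , py) , (z∈ , pz) , xy , xz , yz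
        with dec-does (cx ≟ᶠ c) px | dec-does (cy ≟ᶠ c) py | dec-does (cz ≟ᶠ c) pz
      ... | refl | refl | refl = ⊥-elim (layer-independence i
        (All.lookup in-layer (∈-map⁺ proj₁ x∈)) (All.lookup in-layer (∈-map⁺ proj₁ y∈)) (All.lookup in-layer (∈-map⁺ proj₁ z∈))
        xy xz yz (proper live′ (ρ⊆ x∈) (ρ⊆ y∈)) (proper live′ (ρ⊆ x∈) (ρ⊆ z∈)) (proper live′ (ρ⊆ y∈) (ρ⊆ z∈)))

      colour-layer : ∀ i {prev} → (∀ c → tally c prev ≤ 2) → Live (prev ++ π) →
        ∀ us → All (Layer i) us → Unique us → ∃[ ρ ] map proj₁ ρ ≡ us × Live (ρ ++ prev ++ π)
      colour-layer i few live′ [] [] [] = [] , refl , live′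
      colour-layer i {prev} few live′ (u ∷ us) (lu ∷ lus) (≢u ∷ uniq) with colour-layer i few live′ us lus uniq
      ... | ρ , refl , live″ with extend live″ room′ u
        where
        room′ : ∀ c → tally c (ρ ++ prev ++ π) < q
        room′ c rewrite tally-++ c ρ (prev ++ π) | tally-++ c prev π =
          -- At most two entries of a colour in the layer in progress, two in the previous one, and
          -- one free slot: the summand 5 of q.
          ≤-trans (s≤s (+-mono-≤ (thin i lus uniq live″ ∈-++⁺ˡ c) (+-monoˡ-≤ (tally c π) (few c))))
            (≤-trans (≤-reflexive (+-comm 5 (tally c π))) (room c))
      ...   | c , live‴ = (u , c) ∷ ρ , refl , live‴

      ColouredLayer : ℕ → Set
      ColouredLayer i = ∃[ ρ ] InLayer i ρ × Live (ρ ++ π)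

      layer-all : ∀ i → All (Layer i) (filter (layer? i) (allFin n))
      layer-all i = Allₚ.all-filter (layer? i) (allFin n)

      layer-unique : ∀ i → Unique (filter (layer? i) (allFin n))
      layer-unique i = filter⁺ (layer? i) (allFin⁺ n)

      next : ∀ {i} → ((ρ , _) : ColouredLayer i) → ∃[ ρ′ ] InLayer (suc i) ρ′ × Live (ρ′ ++ ρ ++ π)
      next {i} (ρ , eq , live′) = colour-layer (suc i)
        (thin i (subst (All (Layer i)) (≡-sym eq) (layer-all i)) (subst Unique (≡-sym eq) (layer-unique i)) live′ ∈-++⁺ˡ)
        live′ _ (layer-all (suc i)) (layer-unique (suc i))

      drop-previous : ∀ ρ′ {ρ} → Live (ρ′ ++ ρ ++ π) → Live (ρ′ ++ π)
      drop-previous ρ′ {ρ} = sub λ e∈ → [ ∈-++⁺ˡ , (λ p → ∈-++⁺ʳ ρ′ (∈-++⁺ʳ ρ p)) ]′ (∈-++⁻ ρ′ e∈)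

      -- The previous layer is kept while a layer is being coloured and forgotten afterwards. This
      -- suffices because edges join only vertices of the same or of consecutive layers.
      coloured : ∀ i → ColouredLayer i
      coloured zero = colour-layer 0 {[]} (λ _ → z≤n) live _ (layer-all 0) (layer-unique 0)
      coloured (suc i) with next (coloured i)
      ... | ρ′ , eq , live′ = ρ′ , eq , drop-previous ρ′ live′

      layer-live : ∀ i → Live (proj₁ (coloured (suc i)) ++ proj₁ (coloured i) ++ π)
      layer-live i with next (coloured i)
      ... | _ , _ , live′ = live′

      entry-of : ∀ {i u} → Layer i u → ∃[ c ] (u , c) ∈ˡ proj₁ (coloured i)
      entry-of {i} {u} l with coloured i
      ... | ρ , eq , _ with ∈-map⁻ proj₁ (subst (u ∈ˡ_) (≡-sym eq) (∈-filter⁺ (layer? i) (∈-allFin u) l))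
      ...   | (.u , c) , e∈ , refl = c , e∈

      sweep : Colouring π S
      sweep = f , (λ u∈ → live-entry (spec u∈)) , λ u∈ v∈ uv → distinct u∈ v∈ uv (spec u∈) (spec v∈)
        where
        f : Fin n → Fin k
        f u with u ∈? S
        ... | yes u∈ = proj₁ (entry-of (proj₂ (layered u∈)))
        ... | no  _  = c₀
        Spec : Fin n → Set
        Spec u = ∃[ i ] Layer i u × (u , f u) ∈ˡ proj₁ (coloured i)
        spec : ∀ {u} → u ∈ S → Spec u
        spec {u} u∈ with u ∈? S
        ... | yes u∈′ = proj₁ (layered u∈′) , proj₂ (layered u∈′) , proj₂ (entry-of (proj₂ (layered u∈′)))
        ... | no ¬u∈ = contradiction u∈ ¬u∈
        live-entry : ∀ {u} → Spec u → Live ((u , f u) ∷ π)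
        live-entry (i , _ , e∈) = sub (λ { (here refl) → ∈-++⁺ˡ e∈ ; (there p) → ∈-++⁺ʳ (proj₁ (coloured i)) p }) (proj₂ (proj₂ (coloured i)))
        same : ∀ {i u v} → u ~ v → (u , f u) ∈ˡ proj₁ (coloured i) → (v , f v) ∈ˡ proj₁ (coloured i) → f u ≢ f v
        same {i} {u} {v} uv u∈ v∈ eq = true≢false uv (proper (proj₂ (proj₂ (coloured i))) (∈-++⁺ˡ u∈)
          (∈-++⁺ˡ (subst (λ c → (v , c) ∈ˡ proj₁ (coloured i)) (≡-sym eq) v∈)))
        consecutive : ∀ {u v i} → u ~ v → (u , f u) ∈ˡ proj₁ (coloured (suc i)) → (v , f v) ∈ˡ proj₁ (coloured i) → f u ≢ f v
        consecutive {u} {v} {i} uv u∈ v∈ eq = true≢false uv (proper (layer-live i) (∈-++⁺ˡ u∈)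
          (∈-++⁺ʳ (proj₁ (coloured (suc i))) (∈-++⁺ˡ (subst (λ c → (v , c) ∈ˡ proj₁ (coloured i)) (≡-sym eq) v∈))))
        close : ∀ {i j} → i ≤ suc j → j ≤ suc i → i ≡ j ⊎ i ≡ suc j ⊎ j ≡ suc i
        close {zero} {zero} _ _ = inj₁ refl
        close {zero} {suc zero} _ _ = inj₂ (inj₂ refl)
        close {suc zero} {zero} _ _ = inj₂ (inj₁ refl)
        close {zero} {suc (suc j)} _ (s≤s ())
        close {suc (suc i)} {zero} (s≤s ()) _
        close {suc i} {suc j} (s≤s p) (s≤s q) with close p q
        ... | inj₁ refl = inj₁ refl
        ... | inj₂ (inj₁ refl) = inj₂ (inj₁ refl)
        ... | inj₂ (inj₂ refl) = inj₂ (inj₂ refl)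
        distinct : ∀ {u v} → u ∈ S → v ∈ S → u ~ v → Spec u → Spec v → f u ≢ f v
        distinct u∈ v∈ uv (i , lu , eu) (j , lv , ev)
          with close (layer-edge u∈ lv lu (~-sym uv)) (layer-edge v∈ lu lv uv)
        ... | inj₁ refl = same {i} uv eu ev
        ... | inj₂ (inj₁ refl) = consecutive uv eu ev
        ... | inj₂ (inj₂ refl) = λ eq → consecutive (~-sym uv) ev eu (≡-sym eq)

  -- Independent parts and the induction on the palette

  module _ {Rel : Fin n → Fin n → Set} (rel? : ∀ u v → Dec (Rel u v)) (rel-sym : ∀ {u v} → Rel u v → Rel v u) where

    part? : ∀ S r u → Dec (u ∈ S × component rel? rel-sym u ≡ r)
    part? S r u = (u ∈? S) ×-dec (component rel? rel-sym u ≟ᶠ r)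

    -- An edge between different components of `Rel` has no colour live at both ends, so colourings
    -- of the parts never conflict there.
    combine-parts : ∀ {π S} →
      (∀ {u v c} → u ∈ S → v ∈ S → u ~ v → Live ((u , c) ∷ π) → Live ((v , c) ∷ π) → Rel u v) →
      (∀ r → Colouring π ⟪ part? S r ⟫) → Colouring π S
    combine-parts {π} {S} related parts = f , (λ u∈ → live u∈) , distinct
      where
      comp : Fin n → Fin n
      comp = component rel? rel-sym
      f : Fin n → Fin k
      f u = proj₁ (parts (comp u)) u
      member : ∀ {u} → u ∈ S → u ∈ ⟪ part? S (comp u) ⟫
      member {u} u∈ = ∈⟪⟫⁺ (part? S (comp u)) (u∈ , refl)
      live : ∀ {u} → u ∈ S → Live ((u , f u) ∷ π)
      live {u} u∈ = proj₁ (proj₂ (parts (comp u))) (member u∈)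
      distinct : ∀ {u v} → u ∈ S → v ∈ S → u ~ v → f u ≢ f v
      distinct {u} {v} u∈ v∈ uv eq = proj₂ (proj₂ (parts (comp v)))
        (∈⟪⟫⁺ (part? S (comp v)) (u∈ , same)) (member v∈) uv (trans (cong (λ r → proj₁ (parts r) u) (≡-sym same)) eq)
        where
        same : comp u ≡ comp v
        same = component-edge rel? rel-sym (related u∈ v∈ uv (live u∈)
          (subst (λ c → Live ((v , c) ∷ π)) (≡-sym eq) (live v∈)))

    part-out : ∀ {S r u} → u ∈ ⟪ part? S r ⟫ → u ∈ S × component rel? rel-sym u ≡ r
    part-out {S} {r} = ∈⟪⟫⁻ (part? S r)

    part-star : ∀ {S r u v} → u ∈ ⟪ part? S r ⟫ → v ∈ ⟪ part? S r ⟫ → Star Rel u v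
    part-star u∈ v∈ = component-path rel? rel-sym (trans (proj₂ (part-out u∈)) (≡-sym (proj₂ (part-out v∈))))

    part-closed : ∀ {S r u v} → (∀ {u v} → Rel u v → u ∈ S) → Rel u v → v ∈ ⟪ part? S r ⟫ → u ∈ ⟪ part? S r ⟫
    part-closed {S} {r} inS e v∈ = ∈⟪⟫⁺ (part? S r) (inS e , trans (component-edge rel? rel-sym e) (proj₂ (part-out v∈)))

    part-path : ∀ {S r x} → (∀ {u v} → Rel u v → u ∈ S × v ∈ S) → x ∈ ⟪ part? S r ⟫ → ∀ {u} → Star Rel x u →
      Star (λ a b → Rel a b × a ∈ ⟪ part? S r ⟫ × b ∈ ⟪ part? S r ⟫) x u
    part-path inS x∈ ε = ε
    part-path {S} {r} inS x∈ (_◅_ {j = y} e s) = (e , x∈ , y∈) ◅ part-path inS y∈ s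
      where
      y∈ : y ∈ ⟪ part? S r ⟫
      y∈ = ∈⟪⟫⁺ (part? S r) (proj₂ (inS e) ,
        trans (≡-sym (component-edge rel? rel-sym e)) (proj₂ (∈⟪⟫⁻ (part? S r) x∈)))

  empty-colouring : ∀ {π S} → (∀ u → u ∉ S) → Colouring π S
  empty-colouring none = (λ _ → c₀) , (λ u∈ → contradiction u∈ (none _)) , λ u∈ → contradiction u∈ (none _)

  Palette : List E → Subset n → List (Fin k) → Set
  Palette π S P = ∀ {u c} → u ∈ S → Live ((u , c) ∷ π) → c ∈ˡ P

  separation : ∀ {S} → Connected S → Claw S → Separation S
  separation {S} connected Q with anySubset? (join? S)
  ... | yes (A , join) = join-separation join
  ... | no ¬join = strong-separation connected (λ A join → ¬join (A , join)) Q

  shift-room : ∀ {r a s e m} → r ≤ s → a + (s + e) ≤ m → r + a + e ≤ m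
  shift-room {r} {a} {s} {e} r≤s le = ≤-trans (+-monoˡ-≤ e (≤-trans (+-monoˡ-≤ a r≤s) (≤-reflexive (+-comm s a))))
    (≤-trans (≤-reflexive (+-assoc a s e)) le)

  spare-room : ∀ {a e} → a + (e + 5) ≤ q → a < q
  spare-room {a} {e} le = ≤-trans (≤-trans (≤-reflexive (+-comm 1 a)) (+-monoʳ-≤ a (≤-trans (s≤s z≤n) (m≤n+m 5 e)))) le

  -- The parameter `d` bounds the palette and hence the number of further levels: 16 slots of every
  -- colour are reserved for each of them and 5 for a final sweep.
  ColourConnected : ℕ → Set
  ColourConnected d = ∀ {π} → Live π → (∀ c → tally c π + (d * 16 + 5) ≤ q) →
    ∀ {S P} → length P ≤ d → Palette π S P → Connected S → Colouring π S

  colour-separated : ∀ {d} → ColourConnected d → ∀ {π} → (∀ c → tally c π + (suc d * 16 + 5) ≤ q) →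
    ∀ {S P} → length P ≤ suc d → Palette π S P → (sep : Separation S) →
    ∀ {R} → Live (R ++ π) → (∀ c → tally c R ≤ 16) → Separated sep π R → Colouring π S
  colour-separated {d} recurse {π} room {S} {P} le palette sep {R} liveR few separated =
    f , (λ u∈ → sub weaken (f-live u∈)) , f-proper
    where
    open Separation sep
    weaken : ∀ {e x} → x ∈ˡ e ∷ π → x ∈ˡ e ∷ R ++ π
    weaken (here p) = here p
    weaken (there p) = there (∈-++⁺ʳ R p)
    Rel : Fin n → Fin n → Set
    Rel u v = Edge S u v × ∃[ c ] Live ((u , c) ∷ R ++ π) × Live ((v , c) ∷ R ++ π)
    rel? : ∀ u v → Dec (Rel u v)
    rel? u v = edge? S u v ×-dec any? λ c → live? ((u , c) ∷ R ++ π) ×-dec live? ((v , c) ∷ R ++ π)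
    rel-sym : ∀ {u v} → Rel u v → Rel v u
    rel-sym (e , c , l , l′) = edge-sym e , c , l′ , l
    room′ : ∀ c → tally c (R ++ π) + (d * 16 + 5) ≤ q
    room′ c = subst (λ t → t + (d * 16 + 5) ≤ q) (≡-sym (tally-++ c R π))
      (shift-room {tally c R} {tally c π} {16} {d * 16 + 5} (few c) (room c))
    -- A common neighbour of the part has a live colour, and that colour is not live in the part.
    colour-part : ∀ {K} → K ⊆ S → (∀ {u v} → u ∈ K → v ∈ K → Star Rel u v) → (∀ {u v} → Rel u v → v ∈ K → u ∈ K) →
      Connected K → Colouring (R ++ π) K
    colour-part {K} K⊆S path closed connectedᴷ with any? (_∈? K)
    ... | no none = empty-colouring (λ u u∈ → none (u , u∈))
    -- An edge of `Rel` has a common live colour and so is not cut, as the paths for `dominated`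
    -- require.
    ... | yes (x , x∈) with dominated {K} {x} K⊆S x∈
                              (λ u∈ → star-map (λ (e , c , l , l′) → e , λ s → separated s l l′) (path x∈ u∈))
    ...   | h , h∈ , hK = finish (extend liveR (λ c → spare-room (room′ c)) h)
      where
      finish : ∃[ c ] Live ((h , c) ∷ R ++ π) → Colouring (R ++ π) K
      finish (c , live-h) = recurse liveR room′ {P = filter (λ c′ → ¬? (c′ ≟ᶠ c)) P} shorter palette′ connectedᴷ
        where
        -- Since `h` lies in `S`, its live colour `c` does occur in `P`, and removing it shortens
        -- the palette.
        shorter : length (filter (λ c′ → ¬? (c′ ≟ᶠ c)) P) ≤ d
        shorter = ≤-pred (≤-trans (filter-notAll (λ c′ → ¬? (c′ ≟ᶠ c)) P
          (lose (palette h∈ (sub weaken live-h)) λ ¬p → ¬p refl)) le)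
        dead : ∀ {u} → u ∈ K → ¬ Live ((u , c) ∷ R ++ π)
        -- If `c` were live at `u` as well, the edge `h u` would put `h` into the part; but `h` is
        -- adjacent to every vertex of the part and cannot be adjacent to itself.
        dead {u} u∈ live-u = ~⇒≢ (hK (closed ((h∈ , K⊆S u∈ , hK u∈) , c , live-h , live-u) u∈)) refl
        palette′ : Palette (R ++ π) K (filter (λ c′ → ¬? (c′ ≟ᶠ c)) P)
        palette′ u∈ live-u = ∈-filter⁺ (λ c′ → ¬? (c′ ≟ᶠ c)) (palette (K⊆S u∈) (sub weaken live-u))
          λ { refl → dead u∈ live-u }
    whole : Colouring (R ++ π) S
    whole = combine-parts rel? rel-sym (λ u∈ v∈ uv l l′ → (u∈ , v∈ , uv) , _ , l , l′) λ r →
      colour-part (λ u∈ → proj₁ (part-out rel? rel-sym u∈)) (part-star rel? rel-sym)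
        (λ e v∈ → part-closed rel? rel-sym (λ ((u∈ , _) , _) → u∈) e v∈)
        λ u∈ v∈ → star-map (λ (((_ , _ , ab) , _) , a∈ , b∈) → a∈ , b∈ , ab)
          (part-path rel? rel-sym (λ ((a∈ , b∈ , _) , _) → a∈ , b∈) u∈ (part-star rel? rel-sym u∈ v∈))
    f = proj₁ whole
    f-live = proj₁ (proj₂ whole)
    f-proper = proj₂ (proj₂ whole)

  colour-connected : ∀ d → ColourConnected d
  colour-connected d {π} live room {S} le palette connected with any? (_∈? S)
  ... | no none = empty-colouring (λ u u∈ → none (u , u∈))
  ... | yes (s₀ , s₀∈) with claw? S
  ...   | no claw-free = Sweep.sweep connected claw-free s₀∈ live
    (λ c → ≤-trans (+-monoʳ-≤ (tally c π) (m≤n+m 5 (d * 16))) (room c))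
  colour-connected zero {π} live room {S} {[]} le palette connected | yes (s₀ , s₀∈) | yes Q
    with extend live (λ c → spare-room {e = 0} (room c)) s₀
  ... | c , live′ with palette s₀∈ live′
  ...   | ()
  colour-connected (suc d) {π} live room {S} {P} le palette connected | yes (s₀ , s₀∈) | yes Q =
    colour-pebbled (separation connected Q)
    where
    colour-pebbled : Separation S → Colouring π S
    colour-pebbled sep with pebble sep π _ [] ≤-refl live (λ ())
    ... | R , liveR , few , separated =
      colour-separated (colour-connected d) room le palette sep liveR few separated

  colourable : k * 16 + 5 ≤ q → Live [] → ListColourable G L
  colourable le live = proj₁ whole , (λ v → listed (proj₁ (proj₂ whole) (∈⟪⟫⁺ all-of tt)) (here refl)) ,
    λ u v uv → proj₂ (proj₂ whole) (∈⟪⟫⁺ all-of tt) (∈⟪⟫⁺ all-of tt) uv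
    where
    all-of : ∀ (v : Fin n) → Dec ⊤
    all-of _ = yes tt
    S : Subset n
    S = ⟪ all-of ⟫
    whole : Colouring [] S
    whole = combine-parts (edge? S) edge-sym (λ u∈ v∈ uv _ _ → u∈ , v∈ , uv) λ r →
      colour-connected k live (λ _ → le) {P = allFin k} (≤-reflexive (length-tabulate _)) (λ _ _ → ∈-allFin _)
        λ u∈ v∈ → star-map (λ ((_ , _ , ab) , a∈ , b∈) → a∈ , b∈ , ab)
          (part-path (edge? S) edge-sym (λ (a∈ , b∈ , _) → a∈ , b∈) u∈
            (part-star (edge? S) edge-sym u∈ v∈))

-- A primitive recursive language and its compilation

update-same : ∀ σ a x → (σ [ a ↦ x ]) a ≡ x
update-same σ a x with a ≡ᵇ a in eq
... | true  = refl
... | false = contradiction (≡⇒≡ᵇ a a refl) λ t → subst T eq t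

update-other : ∀ σ {a b} x → a ≢ b → (σ [ a ↦ x ]) b ≡ σ b
update-other σ {a} {b} x a≢b with a ≡ᵇ b in eq
... | false = refl
... | true  = contradiction (≡ᵇ⇒≡ a b (subst T (≡-sym eq) _)) a≢b

Run : Program → Memory → ℕ → Memory → Set
Run p σ t τ = ∃[ s ] s ≤ t × ⟨ p , σ ⟩⇓[ s ] τ

run-seq : ∀ {p q σ τ υ s t} → Run p σ s τ → Run q τ t υ → Run (p ⨾ q) σ (s + t) υ
run-seq (s , s≤ , r) (t , t≤ , r′) = s + t , +-mono-≤ s≤ t≤ , seq⇓ r r′

run-weaken : ∀ {p σ τ s t} → s ≤ t → Run p σ s τ → Run p σ t τ
run-weaken le (s , s≤ , r) = s , ≤-trans s≤ le , r

run-if-true : ∀ {e p q σ τ t} → ⟦ e ⟧ σ ≢ 0 → Run p σ t τ → Run (if e p q) σ (suc (cost e + t)) τ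
run-if-true {e} nz (t , t≤ , r) = _ , s≤s (+-monoʳ-≤ (cost e) t≤) , if-true⇓ nz r

run-if-false : ∀ {e p q σ τ t} → ⟦ e ⟧ σ ≡ 0 → Run q σ t τ → Run (if e p q) σ (suc (cost e + t)) τ
run-if-false {e} z (t , t≤ , r) = _ , s≤s (+-monoʳ-≤ (cost e) t≤) , if-false⇓ z r

run-while-true : ∀ {e p σ τ υ s t} → ⟦ e ⟧ σ ≢ 0 → Run p σ s τ → Run (while e p) τ t υ →
  Run (while e p) σ (suc (cost e + s + t)) υ
run-while-true {e} nz (s , s≤ , r) (t , t≤ , r′) =
  _ , s≤s (+-mono-≤ (+-monoʳ-≤ (cost e) s≤) t≤) , while-true⇓ nz r r′

run-while-false : ∀ {e p σ} → ⟦ e ⟧ σ ≡ 0 → Run (while e p) σ (suc (cost e)) σ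
run-while-false z = _ , ≤-refl , while-false⇓ z

primrec : ℕ → ℕ → (ℕ → ℕ → ℕ) → ℕ
primrec zero    z s = z
primrec (suc x) z s = s x (primrec x z s)

infixl 6 _⊞_ _⊟_

-- The body of rec has the counter as variable 0 and the accumulator as variable 1; the number of rounds is the same
-- global bound for every loop.
data Tm (v : ℕ) : Set where
  var     : Fin v → Tm v
  con     : ℕ → Tm v
  _⊞_ _⊟_ : Tm v → Tm v → Tm v
  inp tab : Tm v → Tm v
  cond    : Tm v → Tm v → Tm v → Tm v
  bind    : Tm v → Tm (suc v) → Tm v
  rec     : Tm v → Tm (suc (suc v)) → Tm v

choose : ℕ → ℕ → ℕ → ℕ
choose zero    x y = y
choose (suc _) x y = x

module Semantics (X : ℕ) (I T : ℕ → ℕ) where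
  eval : ∀ {v} → Tm v → Vec ℕ v → ℕ
  eval (var i)      ρ = lookᵛ ρ i
  eval (con x)      ρ = x
  eval (a ⊞ b)      ρ = eval a ρ + eval b ρ
  eval (a ⊟ b)      ρ = eval a ρ ∸ eval b ρ
  eval (inp a)      ρ = I (eval a ρ)
  eval (tab a)      ρ = T (eval a ρ)
  eval (cond a b c) ρ = choose (eval a ρ) (eval b ρ) (eval c ρ)
  eval (bind a b)   ρ = eval b (eval a ρ ∷ ρ)
  eval (rec a b)    ρ = primrec X (eval a ρ) (λ x y → eval b (x ∷ y ∷ ρ))

-- Besides being the coefficient in `time-bound`, this bounds the number of registers used by the
-- compiled code; a loop occupies two for itself, accumulator and counter.
size : ∀ {v} → Tm v → ℕ
size (var i)      = 1
size (con x)      = 1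
size (a ⊞ b)      = suc (size a + size b)
size (a ⊟ b)      = suc (size a + size b)
size (inp a)      = suc (size a)
size (tab a)      = suc (size a)
size (cond a b c) = suc (size a + (size b + size c))
size (bind a b)   = suc (size a + size b)
size (rec a b)    = suc (suc (size a + size b))

depth : ∀ {v} → Tm v → ℕ
depth (var i)      = 0
depth (con x)      = 0
depth (a ⊞ b)      = depth a ⊔ depth b
depth (a ⊟ b)      = depth a ⊔ depth b
depth (inp a)      = depth a
depth (tab a)      = depth a
depth (cond a b c) = depth a ⊔ (depth b ⊔ depth c)
depth (bind a b)   = depth a ⊔ depth b
depth (rec a b)    = depth a ⊔ suc (depth b)

reg : ℕ → Expr
reg i = mem (mem (lit 0) ⊕ lit i)

setReg : ℕ → Expr → Program
setReg i e = mem[ mem (lit 0) ⊕ lit i ]≔ e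

-- Cell 0 holds the address of register 0, and register 0 holds the number of rounds of every loop.  The registers
-- number M, the table lies above them and the input below them (from cell 1 on).
module Compiler (M : ℕ) where

  code : ∀ {v} → Tm v → Vec ℕ v → ℕ → Program
  code (var i) p d = setReg d (reg (lookᵛ p i))
  code (con x) p d = setReg d (lit x)
  code (a ⊞ b) p d = code a p d ⨾ code b p (suc d) ⨾ setReg d (reg d ⊕ reg (suc d))
  code (a ⊟ b) p d = code a p d ⨾ code b p (suc d) ⨾ setReg d (reg d ⊖ reg (suc d))
  -- Entry `a` of the input is in cell `a + 1`. From the base of the registers on, the zeros behind
  -- the input have been overwritten, so reads beyond the base must be answered by 0 explicitly.
  code (inp a) p d = code a p d ⨾
    if (mem (lit 0) ⊖ (lit 1 ⊕ reg d)) (setReg d (mem (lit 1 ⊕ reg d))) (setReg d (lit 0))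
  code (tab a) p d = code a p d ⨾ setReg d (mem (mem (lit 0) ⊕ (lit M ⊕ reg d)))
  code (cond a b c) p d = code a p d ⨾ if (reg d) (code b p d) (code c p d)
  code (bind a b) p d = code a p d ⨾ code b (d ∷ p) (suc d) ⨾ setReg d (reg (suc d))
  code (rec a b) p d = code a p d ⨾ setReg (suc d) (lit 0) ⨾
    while (reg 0 ⊖ reg (suc d))
      (code b (suc d ∷ d ∷ p) (suc (suc d)) ⨾ setReg d (reg (suc (suc d))) ⨾
       setReg (suc d) (reg (suc d) ⊕ lit 1))

  time : ∀ {v} → ℕ → Tm v → ℕ
  time X (var i)      = 20
  time X (con x)      = 20
  time X (a ⊞ b)      = time X a + (time X b + 20)
  time X (a ⊟ b)      = time X a + (time X b + 20)
  time X (inp a)      = time X a + 40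
  time X (tab a)      = time X a + 20
  time X (cond a b c) = time X a + (10 + (time X b + time X c))
  time X (bind a b)   = time X a + (time X b + 20)
  time X (rec a b)    = time X a + (20 + (X * (time X b + 60) + 20))

  module Correctness (base X : ℕ) (I : ℕ → ℕ) (I-outside : ∀ a → base ≤ suc a → I a ≡ 0) where

    record Holds (T : ℕ → ℕ) (σ : Memory) : Set where
      field
        holds-base  : σ 0 ≡ base
        holds-bound : σ (base + 0) ≡ X
        holds-input : ∀ a → suc a < base → σ (suc a) ≡ I a
        holds-table : ∀ j → σ (base + (M + j)) ≡ T j

    open Holds

    record Frame (d : ℕ) (σ τ : Memory) : Set where
      constructor frame
      field unchanged : ∀ a → a < base + d ⊎ base + M ≤ a → τ a ≡ σ a


    frame-trans : ∀ {d d′ σ τ υ} → d ≤ d′ → Frame d σ τ → Frame d′ τ υ → Frame d σ υ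
    frame-trans le (frame f) (frame g) = frame λ where
      a (inj₁ p) → trans (g a (inj₁ (≤-trans p (+-monoʳ-≤ base le)))) (f a (inj₁ p))
      a (inj₂ p) → trans (g a (inj₂ p)) (f a (inj₂ p))

    frame-weaken : ∀ {d d′ σ τ} → d ≤ d′ → Frame d′ σ τ → Frame d σ τ
    frame-weaken le (frame f) = frame λ where
      a (inj₁ p) → f a (inj₁ (≤-trans p (+-monoʳ-≤ base le)))
      a (inj₂ p) → f a (inj₂ p)

    frame-reg : ∀ {d σ τ i} → Frame d σ τ → i < d → τ (base + i) ≡ σ (base + i)
    frame-reg (frame f) i<d = f _ (inj₁ (+-monoʳ-< base i<d))

    frame-holds : ∀ {d σ τ T} → 1 ≤ d → 1 ≤ base → Frame d σ τ → Holds T σ → Holds T τ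
    frame-holds {d} {σ} {τ} 1≤d 1≤b fr@(frame f) h = record
      { holds-base  = trans (f 0 (inj₁ (≤-trans 1≤b (m≤m+n base d)))) (holds-base h)
      ; holds-bound = trans (frame-reg fr 1≤d) (holds-bound h)
      ; holds-input = λ a lt → trans (f (suc a) (inj₁ (≤-trans lt (m≤m+n base d)))) (holds-input h a lt)
      ; holds-table = λ j → trans (f _ (inj₂ (+-monoʳ-≤ base (m≤m+n M j)))) (holds-table h j)
      }

    record Env {v} (p : Vec ℕ v) (σ : Memory) (ρ : Vec ℕ v) : Set where
      constructor env
      field at : ∀ i → σ (base + lookᵛ p i) ≡ lookᵛ ρ i

    record Below {v} (p : Vec ℕ v) (d : ℕ) : Set where
      constructor below
      field under : ∀ i → lookᵛ p i < d

    open Env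

    frame-env : ∀ {v d σ τ} {p ρ : Vec ℕ v} → Below p d → Frame d σ τ → Env p σ ρ → Env p τ ρ
    frame-env (below b) f (env e) = env λ i → trans (frame-reg f (b i)) (e i)

    env-cons : ∀ {v σ x i} {p ρ : Vec ℕ v} → σ (base + i) ≡ x → Env p σ ρ → Env (i ∷ p) σ (x ∷ ρ)
    env-cons eq (env e) = env λ where
      zero    → eq
      (suc i) → e i

    below-cons : ∀ {v d i} {p : Vec ℕ v} → i < d → Below p d → Below (i ∷ p) d
    below-cons lt (below b) = below λ where
      zero    → lt
      (suc i) → b i

    below-suc : ∀ {v d} {p : Vec ℕ v} → Below p d → Below p (suc d)
    below-suc (below b) = below λ i → m≤n⇒m≤1+n (b i)

    reg-value : ∀ {T σ} → Holds T σ → ∀ i → ⟦ reg i ⟧ σ ≡ σ (base + i)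
    reg-value {σ = σ} h i = cong (λ b → σ (b + i)) (holds-base h)

    module _ {T : ℕ → ℕ} (1≤base : 1 ≤ base) where
      open Semantics X I T

      record Outcome (p : Program) (d : ℕ) (σ : Memory) (t x : ℕ) : Set where
        constructor outcome
        field
          {final} : Memory
          run   : Run p σ t final
          framed : Frame d σ final
          value : final (base + d) ≡ x

      set-frame : ∀ {d i σ} x → Holds T σ → d ≤ i → i < M → Frame d σ (σ [ σ 0 + i ↦ x ])
      set-frame {d} {i} {σ} x h d≤i i<M = frame λ where
        a (inj₁ a<) → update-other σ {a = σ 0 + i} x λ { refl →
          <-irrefl refl (≤-trans a< (≤-trans (+-monoʳ-≤ base d≤i) (≤-reflexive (cong (_+ i) (≡-sym (holds-base h)))))) }
        a (inj₂ a≥) → update-other σ {a = σ 0 + i} x λ { refl →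
          <-irrefl refl (≤-trans (+-monoʳ-< base i<M) (≤-trans a≥ (≤-reflexive (cong (_+ i) (holds-base h))))) }

      set-other : ∀ {i j σ} x → Holds T σ → i ≢ j → (σ [ σ 0 + i ↦ x ]) (base + j) ≡ σ (base + j)
      set-other {i} {j} {σ} x h i≢j = update-other σ x λ p →
        i≢j (+-cancelˡ-≡ base i j (trans (cong (_+ i) (≡-sym (holds-base h))) p))

      set-value : ∀ {i σ} x → Holds T σ → (σ [ σ 0 + i ↦ x ]) (base + i) ≡ x
      set-value {i} {σ} x h = trans (cong (λ b → (σ [ σ 0 + i ↦ x ]) (b + i)) (≡-sym (holds-base h))) (update-same σ (σ 0 + i) x)

      set-outcome : ∀ {d σ e x t} → Holds T σ → d < M → ⟦ e ⟧ σ ≡ x → 5 + cost e ≤ t → Outcome (setReg d e) d σ t x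
      set-outcome {d} {σ} h d<M refl le = outcome (_ , le , assign⇓) (set-frame _ h ≤-refl d<M) (set-value _ h)

      binary : ∀ {v} (a b : Tm v) {p : Vec ℕ v} {d x y z σ} (_∙_ : Expr → Expr → Expr) → (∀ {τ} → Holds T τ →
          τ (base + d) ≡ x → τ (base + suc d) ≡ y → ⟦ reg d ∙ reg (suc d) ⟧ τ ≡ z) →
        cost (reg d ∙ reg (suc d)) ≤ 11 → 1 ≤ d → d < M → Holds T σ →
        ((o : Outcome (code a p d) d σ (time X a) x) → Outcome (code b p (suc d)) (suc d) (Outcome.final o) (time X b) y) →
        Outcome (code a p d) d σ (time X a) x →
        Outcome (code a p d ⨾ code b p (suc d) ⨾ setReg d (reg d ∙ reg (suc d))) d σ (time X a + (time X b + 20)) z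
      binary a b {d = d} _∙_ spec le 1≤d d<M h next oa with oa | next oa
      ... | outcome ra fa va | outcome rb fb vb
        with frame-holds (s≤s z≤n) 1≤base fb (frame-holds 1≤d 1≤base fa h)
      ... | h₂ with set-outcome {e = reg d ∙ reg (suc d)} {t = 20} h₂ d<M
                      (spec h₂ (trans (frame-reg fb ≤-refl) va) vb) (≤-trans (+-monoʳ-≤ 5 le) (m≤m+n 16 4))
      ... | outcome rc fc vc = outcome (run-seq ra (run-seq rb rc))
        (frame-trans ≤-refl (frame-trans ≤-refl fa (frame-weaken (n≤1+n d) fb)) fc) vc

      code-correct : ∀ {v} (e : Tm v) {p ρ : Vec ℕ v} {d} → 1 ≤ d → Below p d → d + size e ≤ M →
        ∀ {σ} → Holds T σ → Env p σ ρ → Outcome (code e p d) d σ (time X e) (eval e ρ)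

      loop-correct : ∀ {v} (b : Tm (suc (suc v))) {p ρ : Vec ℕ v} {d z} → 1 ≤ d → Below p d → suc (suc d) + size b ≤ M →
        ∀ r x {σ} → x + r ≡ X → Holds T σ → Env p σ ρ → σ (base + suc d) ≡ x →
        σ (base + d) ≡ primrec x z (λ x y → eval b (x ∷ y ∷ ρ)) →
        Outcome (while (reg 0 ⊖ reg (suc d))
          (code b (suc d ∷ d ∷ p) (suc (suc d)) ⨾ setReg d (reg (suc (suc d))) ⨾ setReg (suc d) (reg (suc d) ⊕ lit 1)))
          d σ (r * (time X b + 60) + 20) (primrec X z (λ x y → eval b (x ∷ y ∷ ρ)))

      private
        room : ∀ {d s} → d + suc s ≤ M → d < M
        room {d} {s} le = ≤-trans (s≤s (m≤m+n d s)) (≤-trans (≤-reflexive (≡-sym (+-suc d s))) le)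

        roomˡ : ∀ {d s t} → d + suc (s + t) ≤ M → d + s ≤ M
        roomˡ {d} {s} {t} le = ≤-trans (+-monoʳ-≤ d (≤-trans (m≤m+n s t) (n≤1+n _))) le

        roomʳ : ∀ {d s t} → d + suc (s + t) ≤ M → suc d + t ≤ M
        roomʳ {d} {s} {t} le = ≤-trans (≤-reflexive (≡-sym (+-suc d t))) (≤-trans (+-monoʳ-≤ d (s≤s (m≤n+m t s))) le)

      code-correct (var i) {p} {ρ} {d} 1≤d bel le h en =
        set-outcome {e = reg (lookᵛ p i)} h (room {s = 0} le)
          (trans (reg-value h (lookᵛ p i)) (at en i)) (m≤m+n 10 10)
      code-correct (con x) 1≤d bel le h en =
        set-outcome {e = lit x} h (room {s = 0} le) refl (m≤m+n 6 14)
      code-correct (a ⊞ b) {d = d} 1≤d bel le h en =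
        binary a b _⊕_ (λ h₂ va vb → cong₂ _+_ (trans (reg-value h₂ d) va) (trans (reg-value h₂ (suc d)) vb))
          ≤-refl 1≤d (room le) h
          (λ o → code-correct b (s≤s z≤n) (below-suc bel) (roomʳ le)
            (frame-holds 1≤d 1≤base (Outcome.framed o) h) (frame-env bel (Outcome.framed o) en))
          (code-correct a 1≤d bel (roomˡ le) h en)
      code-correct (a ⊟ b) {d = d} 1≤d bel le h en =
        binary a b _⊖_ (λ h₂ va vb → cong₂ _∸_ (trans (reg-value h₂ d) va) (trans (reg-value h₂ (suc d)) vb))
          ≤-refl 1≤d (room le) h
          (λ o → code-correct b (s≤s z≤n) (below-suc bel) (roomʳ le)
            (frame-holds 1≤d 1≤base (Outcome.framed o) h) (frame-env bel (Outcome.framed o) en))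
          (code-correct a 1≤d bel (roomˡ le) h en)
      code-correct (inp a) {ρ = ρ} {d} 1≤d bel le h en
        with code-correct a 1≤d bel (≤-trans (+-monoʳ-≤ d (n≤1+n _)) le) h en
      ... | outcome {τ} ra fa va with frame-holds 1≤d 1≤base fa h
      ...   | h₁ = finish (≤-<-connex base (suc (eval a ρ)))
        where
        guard-value : ⟦ mem (lit 0) ⊖ (lit 1 ⊕ reg d) ⟧ τ ≡ base ∸ suc (eval a ρ)
        guard-value = cong₂ _∸_ (holds-base h₁) (cong suc (trans (reg-value h₁ d) va))
        finish : base ≤ suc (eval a ρ) ⊎ suc (eval a ρ) < base → Outcome (code (inp a) _ d) d _ (time X (inp a)) (I (eval a ρ))
        finish (inj₁ out) with set-outcome {e = lit 0} {t = 20} h₁ (room le)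
                                 (≡-sym (I-outside (eval a ρ) out)) (m≤m+n 6 14)
        ... | outcome rc fc vc = outcome (run-seq ra (run-weaken (m≤m+n 31 9)
                (run-if-false (trans guard-value (m≤n⇒m∸n≡0 out)) rc))) (frame-trans ≤-refl fa fc) vc
        finish (inj₂ lt) with set-outcome {e = mem (lit 1 ⊕ reg d)} {t = 20} h₁ (room le)
                                (trans (cong (λ x → τ (suc x)) (trans (reg-value h₁ d) va))
                                  (holds-input h₁ (eval a ρ) lt)) (m≤m+n 13 7)
        ... | outcome rc fc vc = outcome (run-seq ra (run-weaken (m≤m+n 31 9)
                (run-if-true (λ z → m>n⇒m∸n≢0 lt (trans (≡-sym guard-value) z)) rc))) (frame-trans ≤-refl fa fc) vc
      code-correct (tab a) {ρ = ρ} {d} 1≤d bel le h en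
        with code-correct a 1≤d bel (≤-trans (+-monoʳ-≤ d (n≤1+n _)) le) h en
      ... | outcome {τ} ra fa va with frame-holds 1≤d 1≤base fa h
      ...   | h₁ with set-outcome {e = mem (mem (lit 0) ⊕ (lit M ⊕ reg d))} {t = 20} h₁ (room le)
                        (trans (cong₂ (λ b x → τ (b + (M + x))) (holds-base h₁) (trans (reg-value h₁ d) va))
                          (holds-table h₁ (eval a ρ))) (m≤m+n 16 4)
      ...   | outcome rc fc vc = outcome (run-seq ra rc) (frame-trans ≤-refl fa fc) vc
      code-correct (cond a b c) {p} {ρ} {d} 1≤d bel le {σ} h en with code-correct a 1≤d bel (roomˡ le) h en
      ... | outcome {τ} ra fa va with frame-holds 1≤d 1≤base fa h | frame-env bel fa en
      ...   | h₁ | en₁ = finish (eval a ρ) (trans (reg-value h₁ d) va)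
        where
        le′ : d + (size b + size c) ≤ M
        le′ = ≤-trans (+-monoʳ-≤ d (≤-trans (m≤n+m _ (size a)) (n≤1+n _))) le
        finish : ∀ x → ⟦ reg d ⟧ τ ≡ x → Outcome (code (cond a b c) p d) d σ (time X (cond a b c)) (choose x (eval b ρ) (eval c ρ))
        finish zero eq with code-correct c 1≤d bel (≤-trans (+-monoʳ-≤ d (m≤n+m _ (size b))) le′) h₁ en₁
        ... | outcome rc fc vc = outcome (run-seq ra (run-weaken (+-mono-≤ (m≤m+n 6 4) (m≤n+m (time X c) (time X b))) (run-if-false eq rc)))
          (frame-trans ≤-refl fa fc) vc
        finish (suc x) eq with code-correct b 1≤d bel (≤-trans (+-monoʳ-≤ d (m≤m+n _ (size c))) le′) h₁ en₁
        ... | outcome rb fb vb = outcome (run-seq ra (run-weaken (+-mono-≤ (m≤m+n 6 4) (m≤m+n (time X b) (time X c)))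
            (run-if-true (λ z → 1+n≢0 (trans (≡-sym eq) z)) rb))) (frame-trans ≤-refl fa fb) vb
      code-correct (bind a b) {d = d} 1≤d bel le h en with code-correct a 1≤d bel (roomˡ le) h en
      ... | outcome ra fa va with frame-holds 1≤d 1≤base fa h
      ...   | h₁ with code-correct b (s≤s z≤n) (below-cons ≤-refl (below-suc bel)) (roomʳ le) h₁ (env-cons va (frame-env bel fa en))
      ...     | outcome rb fb vb with frame-holds (s≤s z≤n) 1≤base fb h₁
      ...       | h₂ with set-outcome {e = reg (suc d)} {t = 20} h₂ (room le)
                            (trans (reg-value h₂ (suc d)) vb) (m≤m+n 10 10)
      ...         | outcome rc fc vc = outcome (run-seq ra (run-seq rb rc)) (frame-trans ≤-refl (frame-trans ≤-refl fa (frame-weaken (n≤1+n d) fb)) fc) vc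
      code-correct (rec a b) {d = d} 1≤d bel le h en
        with code-correct a 1≤d bel (roomˡ (≤-trans (+-monoʳ-≤ d (n≤1+n _)) le)) h en
      ... | outcome ra fa va with frame-holds 1≤d 1≤base fa h
      ...   | h₁ with set-outcome {d = suc d} {e = lit 0} {t = 20} h₁
                        (≤-trans (s≤s (s≤s (m≤m+n d (size a + size b))))
                          (≤-trans (≤-reflexive (≡-sym (trans (+-suc d _) (cong suc (+-suc d _))))) le)) refl (m≤m+n 6 14)
      ...     | outcome rz fz vz with frame-holds (s≤s z≤n) 1≤base fz h₁
      ...       | h₂ with loop-correct b 1≤d bel
                            (≤-trans (s≤s (s≤s (+-monoʳ-≤ d (m≤n+m (size b) (size a)))))
                              (≤-trans (≤-reflexive (≡-sym (trans (+-suc d _) (cong suc (+-suc d _))))) le))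
                            X 0 refl h₂ (frame-env (below-suc bel) fz (frame-env bel fa en)) vz (trans (frame-reg fz ≤-refl) va)
      ...         | outcome rl fl vl = outcome (run-seq ra (run-seq rz rl)) (frame-trans ≤-refl (frame-trans ≤-refl fa (frame-weaken (n≤1+n d) fz)) fl) vl

      loop-correct b {p} {ρ} {d} {z} 1≤d bel le zero x {σ} eq h en vx vy =
        outcome (run-weaken (m≤m+n 12 8) (run-while-false guard-zero)) (frame λ _ _ → refl)
          (trans vy (cong (λ x → primrec x z (λ x y → eval b (x ∷ y ∷ ρ))) x≡X))
        where
        x≡X : x ≡ X
        x≡X = trans (≡-sym (+-identityʳ x)) eq
        guard-zero : ⟦ reg 0 ⊖ reg (suc d) ⟧ σ ≡ 0
        guard-zero = trans (cong₂ _∸_ (trans (reg-value h 0) (holds-bound h))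
          (trans (reg-value h (suc d)) (trans vx x≡X))) (n∸n≡0 X)
      loop-correct b {p} {ρ} {d} {z} 1≤d bel le (suc r) x {σ} eq h en vx vy
        with code-correct b (s≤s z≤n) (below-cons ≤-refl (below-cons (n≤1+n _) (below-suc (below-suc bel)))) le h
               (env-cons vx (env-cons vy en))
      ... | outcome {final} rb fb vb with frame-holds (s≤s z≤n) 1≤base fb h
      ...   | h₁ = finish
        where
        σ₁ τ₁ τ₂ : Memory
        σ₁ = final
        τ₁ = σ₁ [ σ₁ 0 + d ↦ ⟦ reg (suc (suc d)) ⟧ σ₁ ]
        τ₂ = τ₁ [ τ₁ 0 + suc d ↦ ⟦ reg (suc d) ⊕ lit 1 ⟧ τ₁ ]
        sd<M : suc d < M
        sd<M = ≤-trans (m≤m+n (suc (suc d)) (size b)) le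
        f₁ : Frame d σ₁ τ₁
        f₁ = set-frame _ h₁ ≤-refl (≤-trans (n≤1+n _) sd<M)
        h₂ = frame-holds 1≤d 1≤base f₁ h₁
        f₂ : Frame d τ₁ τ₂
        f₂ = set-frame _ h₂ (n≤1+n d) sd<M
        counter₁ : τ₁ (base + suc d) ≡ x
        counter₁ = trans (set-other _ h₁ (λ p → 1+n≢n (≡-sym p))) (trans (frame-reg fb ≤-refl) vx)
        counter₂ : τ₂ (base + suc d) ≡ suc x
        counter₂ = trans (set-value _ h₂)
          (trans (cong (_+ 1) (trans (reg-value h₂ (suc d)) counter₁)) (+-comm x 1))
        acc₂ : τ₂ (base + d) ≡ primrec (suc x) z (λ x y → eval b (x ∷ y ∷ ρ))
        acc₂ = trans (set-other _ h₂ 1+n≢n) (trans (set-value _ h₁)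
          (trans (reg-value h₁ (suc (suc d))) vb))
        f : Frame d σ τ₂
        f = frame-trans ≤-refl (frame-trans ≤-refl (frame-weaken (≤-trans (n≤1+n d) (n≤1+n _)) fb) f₁) f₂
        guard : ⟦ reg 0 ⊖ reg (suc d) ⟧ σ ≢ 0
        guard p = m>n⇒m∸n≢0 {X} {x} (≤-trans (s≤s (m≤m+n x r)) (≤-reflexive (trans (≡-sym (+-suc x r)) eq)))
          (trans (≡-sym (cong₂ _∸_ (trans (reg-value h 0) (holds-bound h)) (trans (reg-value h (suc d)) vx))) p)
        finish : _
        finish with loop-correct b {z = z} 1≤d bel le r (suc x) (trans (≡-sym (+-suc x r)) eq) (frame-holds 1≤d 1≤base f h)
                      (frame-env bel f en) counter₂ acc₂
        ... | outcome rl fl vl = outcome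
          (run-weaken (bound (time X b) (r * (time X b + 60)))
            (run-while-true guard (run-seq rb (run-seq {s = 20} {t = 20} (_ , m≤m+n 10 10 , assign⇓) (_ , m≤m+n 12 8 , assign⇓))) rl))
          (frame-trans ≤-refl f fl) vl
          where
          bound : ∀ m y → suc (11 + (m + 40) + (y + 20)) ≤ m + 60 + y + 20
          bound m y = ≤-trans (m≤m+n _ 8) (≤-reflexive (solve 2
            (λ m y → κ 12 :+ (m :+ κ 40) :+ (y :+ κ 20) :+ κ 8 := m :+ κ 60 :+ y :+ κ 20) refl m y))

-- Bounds and truth values

module _ (M : ℕ) (X : ℕ) where
  open Compiler M

  private
    unit : ℕ → ℕ
    unit D = 60 * suc X ^ D

    60≤unit : ∀ D → 60 ≤ unit D
    60≤unit D = ≤-trans (≤-reflexive (≡-sym (*-identityʳ 60))) (*-monoʳ-≤ 60 (m^n>0 (suc X) D))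

    two-parts : ∀ {a b s t u r} → r ≤ u → a ≤ s * u → b ≤ t * u → a + (b + r) ≤ suc (s + t) * u
    two-parts {a} {b} {s} {t} {u} {r} r≤ a≤ b≤ = ≤-trans (+-mono-≤ a≤ (+-mono-≤ b≤ r≤))
      (≤-reflexive (solve 3 (λ s t u → s :* u :+ (t :* u :+ u) := (κ 1 :+ (s :+ t)) :* u) refl s t u))

    one-part : ∀ {a s u r} → r ≤ u → a ≤ s * u → a + r ≤ suc s * u
    one-part {a} {s} {u} r≤ a≤ = ≤-trans (+-mono-≤ a≤ r≤) (≤-reflexive (+-comm (s * u) u))

    loop-part : ∀ {b s u} → 60 ≤ u → b ≤ s * u → 20 + (X * (b + 60) + 20) ≤ suc s * (suc X * u)
    loop-part {b} {s} {u} 60≤ b≤ = ≤-trans (+-mono-≤ {20} {20} ≤-refl (+-monoˡ-≤ 20 (*-monoʳ-≤ X (+-mono-≤ b≤ 60≤))))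
      (≤-trans (≤-reflexive (solve 3 (λ x s u → κ 20 :+ (x :* (s :* u :+ u) :+ κ 20) := κ 40 :+ x :* (s :* u :+ u)) refl X s u))
      (≤-trans (+-monoˡ-≤ _ (≤-trans (≤-trans (m≤m+n 40 20) 60≤) (m≤n+m u (s * u))))
      (≤-reflexive (solve 3 (λ x s u → (s :* u :+ u) :+ x :* (s :* u :+ u) := (κ 1 :+ s) :* ((κ 1 :+ x) :* u)) refl X s u))))

    slack : ∀ {r D} → r ≤ 60 → r ≤ unit D
    slack {D = D} r≤ = ≤-trans r≤ (60≤unit D)

  -- Every loop has the same length, so each nesting level costs a factor `suc X`. The 60 in `unit`
  -- absorbs the overhead of one round, and also the fixed costs of every construct.
  time-bound : ∀ {v} (e : Tm v) D → depth e ≤ D → time X e ≤ size e * unit D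
  time-bound (var i) D le = one-part {0} {0} {unit D} (slack {D = D} (m≤m+n 20 40)) z≤n
  time-bound (con x) D le = one-part {0} {0} {unit D} (slack {D = D} (m≤m+n 20 40)) z≤n
  time-bound (a ⊞ b) D le = two-parts {s = size a} {u = unit D} (slack {D = D} (m≤m+n 20 40))
    (time-bound a D (m⊔n≤o⇒m≤o (depth a) (depth b) le)) (time-bound b D (m⊔n≤o⇒n≤o (depth a) (depth b) le))
  time-bound (a ⊟ b) D le = two-parts {s = size a} {u = unit D} (slack {D = D} (m≤m+n 20 40))
    (time-bound a D (m⊔n≤o⇒m≤o (depth a) (depth b) le)) (time-bound b D (m⊔n≤o⇒n≤o (depth a) (depth b) le))
  time-bound (inp a) D le = one-part {s = size a} {unit D} (slack {D = D} (m≤m+n 40 20)) (time-bound a D le)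
  time-bound (tab a) D le = one-part {s = size a} {unit D} (slack {D = D} (m≤m+n 20 40)) (time-bound a D le)
  time-bound (cond a b c) D le = ≤-trans (≤-reflexive (cong (time X a +_) (+-comm 10 (time X b + time X c))))
    (two-parts {s = size a} {u = unit D} (slack {D = D} (m≤m+n 10 50)) (time-bound a D (m⊔n≤o⇒m≤o (depth a) _ le))
      (≤-trans (+-mono-≤ (time-bound b D (m⊔n≤o⇒m≤o (depth b) (depth c) (m⊔n≤o⇒n≤o (depth a) _ le)))
                         (time-bound c D (m⊔n≤o⇒n≤o (depth b) (depth c) (m⊔n≤o⇒n≤o (depth a) _ le))))
        (≤-reflexive (≡-sym (*-distribʳ-+ (unit D) (size b) (size c))))))
  time-bound (bind a b) D le = two-parts {s = size a} {u = unit D} (slack {D = D} (m≤m+n 20 40))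
    (time-bound a D (m⊔n≤o⇒m≤o (depth a) (depth b) le)) (time-bound b D (m⊔n≤o⇒n≤o (depth a) (depth b) le))
  time-bound (rec a b) zero le = contradiction (m⊔n≤o⇒n≤o (depth a) (suc (depth b)) le) λ ()
  time-bound (rec a b) (suc D) le = ≤-trans (+-mono-≤ (time-bound a (suc D) (m⊔n≤o⇒m≤o (depth a) _ le))
      (≤-trans (loop-part {s = size b} {unit D} (60≤unit D) (time-bound b D (≤-pred (m⊔n≤o⇒n≤o (depth a) _ le))))
        (≤-reflexive (cong (suc (size b) *_) unit-suc))))
    (≤-trans (≤-reflexive (≡-sym (*-distribʳ-+ (unit (suc D)) (size a) (suc (size b)))))
      (*-monoˡ-≤ (unit (suc D)) (≤-trans (≤-reflexive (+-suc (size a) (size b))) (n≤1+n _))))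
    where
    unit-suc : suc X * unit D ≡ unit (suc D)
    unit-suc = trans (≡-sym (*-assoc (suc X) 60 (suc X ^ D))) (trans (cong (_* suc X ^ D) (*-comm (suc X) 60)) (*-assoc 60 (suc X) (suc X ^ D)))

infix 3 _⊨_

_⊨_ : ℕ → Set → Set
x ⊨ P = (x ≢ 0 → P) × (P → x ≢ 0)

⊨-map : ∀ {x P Q} → (P → Q) → (Q → P) → x ⊨ P → x ⊨ Q
⊨-map f g (a , b) = (λ nz → f (a nz)) , (λ q → b (g q))

⊨-nonzero : ∀ x → x ⊨ x ≢ 0
⊨-nonzero x = (λ p → p) , (λ p → p)

⊨-zero : ∀ x → 1 ∸ x ⊨ x ≡ 0
⊨-zero zero = (λ _ → refl) , λ _ ()
⊨-zero (suc x) = (λ p → contradiction (0∸n≡0 x) p) , λ ()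

⊨-< : ∀ a b → b ∸ a ⊨ a < b
⊨-< a b = (λ p → ≰⇒> λ q → p (m≤n⇒m∸n≡0 q)) , m>n⇒m∸n≢0

⊨-≡ : ∀ a b → 1 ∸ ((a ∸ b) + (b ∸ a)) ⊨ a ≡ b
⊨-≡ a b = ⊨-map
  (λ p → ≤-antisym (m∸n≡0⇒m≤n (m+n≡0⇒m≡0 (a ∸ b) p)) (m∸n≡0⇒m≤n (m+n≡0⇒n≡0 (a ∸ b) p)))
  (λ { refl → cong₂ _+_ (n∸n≡0 a) (n∸n≡0 a) }) (⊨-zero _)

⊨-and : ∀ {x y P Q} → x ⊨ P → y ⊨ Q → choose x y 0 ⊨ (P × Q)
⊨-and {zero}  (a , b) _ = (λ p → contradiction refl p) , λ (p , _) → b p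
⊨-and {suc x} (a , b) (c , d) = (λ nz → a (λ ()) , c nz) , λ (_ , q) → d q

⊨-or : ∀ {x y P Q} → x ⊨ P → y ⊨ Q → choose x 1 y ⊨ (P ⊎ Q)
⊨-or {zero}  (a , b) (c , d) = (λ nz → inj₂ (c nz)) , λ { (inj₁ p) _ → b p refl ; (inj₂ q) → d q }
⊨-or {suc x} (a , b) _ = (λ _ → inj₁ (a λ ())) , λ _ ()

⊨-imp : ∀ {x y} {P Q : Set} → x ⊨ P → (P → y ⊨ Q) → choose x y 1 ⊨ (P → Q)
⊨-imp {zero}  (a , b) _ = (λ _ p → contradiction refl (b p)) , λ _ ()
⊨-imp {suc x} (a , b) f = (λ nz p → proj₁ (f p) nz) , λ pq → proj₂ (f (a λ ())) (pq (a λ ()))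

⊨-case : ∀ {x y z} {P Q R : Set} → x ⊨ P → y ⊨ Q → z ⊨ R → choose x y z ⊨ ((P → Q) × (¬ P → R))
⊨-case {zero}  (a , b) _ (e , f) =
  (λ nz → (λ p → contradiction refl (b p)) , λ _ → e nz) , λ (_ , g) → f (g λ p → b p refl)
⊨-case {suc x} (a , b) (c , d) _ =
  (λ nz → (λ _ → c nz) , λ ¬p → contradiction (a λ ()) ¬p) , λ (g , _) → d (g (a λ ()))

⊨-all : ∀ X {f : ℕ → ℕ → ℕ} {P : ℕ → Set} → (∀ x y → x < X → f x y ⊨ P x) →
  primrec X 1 (λ x y → choose y (f x y) 0) ⊨ (∀ x → x < X → P x)
⊨-all zero h = (λ _ _ ()) , λ _ ()
⊨-all (suc X) {f} {P} h with primrec X 1 (λ x y → choose y (f x y) 0) | ⊨-all X {f} {P} (λ x y lt → h x y (m≤n⇒m≤1+n lt))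
... | zero | a , b = (λ p → contradiction refl p) , λ g → b λ x lt → g x (m≤n⇒m≤1+n lt)
... | suc y | a , b = (λ nz → λ x lt → [ (λ lt′ → a (λ ()) x lt′) , (λ { refl → proj₁ (h X (suc y) ≤-refl) nz }) ]′ (m≤n⇒m<n∨m≡n (≤-pred lt))) ,
  λ g → proj₂ (h X (suc y) ≤-refl) (g X ≤-refl)

⊨-any : ∀ X {f : ℕ → ℕ → ℕ} {P : ℕ → Set} → (∀ x y → x < X → f x y ⊨ P x) →
  primrec X 0 (λ x y → choose y 1 (f x y)) ⊨ (∃[ x ] x < X × P x)
⊨-any zero h = (λ p → contradiction refl p) , λ ()
⊨-any (suc X) {f} {P} h with primrec X 0 (λ x y → choose y 1 (f x y)) | ⊨-any X {f} {P} (λ x y lt → h x y (m≤n⇒m≤1+n lt))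
... | zero | a , b = (λ nz → X , ≤-refl , proj₁ (h X 0 ≤-refl) nz) , λ (x , lt , p) →
  [ (λ lt′ → contradiction refl (b (x , lt′ , p))) , (λ { refl → proj₂ (h X 0 ≤-refl) p }) ]′ (m≤n⇒m<n∨m≡n (≤-pred lt))
... | suc y | a , b = (λ _ → let (x , lt , p) = a (λ ()) in x , m≤n⇒m≤1+n lt , p) , λ _ ()

primrec-cong : ∀ X {z} {s s′ : ℕ → ℕ → ℕ} → (∀ x y → x < X → s x y ≡ s′ x y) → primrec X z s ≡ primrec X z s′
primrec-cong zero h = refl
primrec-cong (suc X) {z} {s} {s′} h = trans (h X _ ≤-refl)
  (cong (s′ X) (primrec-cong X λ x y lt → h x y (m≤n⇒m≤1+n lt)))

choose-nonzero : ∀ {c x y} → c ≢ 0 → choose c x y ≡ x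
choose-nonzero {zero} p = contradiction refl p
choose-nonzero {suc c} p = refl

choose-zero : ∀ {c x y} → c ≡ 0 → choose c x y ≡ y
choose-zero refl = refl

-- Loops always run for X rounds. Testing `a ∸ x` makes all rounds from `a` on idle, so that the
-- loop iterates `s` exactly `a` times, provided that `a` fits below X.
primrec-stop : ∀ X a {z} (s : ℕ → ℕ) (g : ℕ → ℕ) → a ≤ X → g 0 ≡ z → (∀ x → x < a → s (g x) ≡ g (suc x)) →
  primrec X z (λ x y → choose (a ∸ x) (s y) y) ≡ g a
primrec-stop X a {z} s g a≤X g0 step = trans (cong (λ X → primrec X z body) (≡-sym (m+[n∸m]≡n a≤X))) (after (X ∸ a))
  where
  body : ℕ → ℕ → ℕ
  body x y = choose (a ∸ x) (s y) y
  before : ∀ x → x ≤ a → primrec x z body ≡ g x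
  before zero le = ≡-sym g0
  before (suc x) le = trans (choose-nonzero (m>n⇒m∸n≢0 le)) (trans (cong s (before x (<⇒≤ le))) (step x le))
  after : ∀ r → primrec (a + r) z body ≡ g a
  after zero = trans (cong (λ x → primrec x z body) (+-identityʳ a)) (before a ≤-refl)
  after (suc r) = trans (cong (λ x → primrec x z body) (+-suc a r))
    (trans (choose-zero (m≤n⇒m∸n≡0 (m≤m+n a r))) (after r))

primrec-mul : ∀ X a b → a ≤ X → primrec X 0 (λ x y → choose (a ∸ x) (y + b) y) ≡ a * b
primrec-mul X a b a≤X = primrec-stop X a (_+ b) (_* b) a≤X refl λ x _ → +-comm (x * b) b

module _ (n : ℕ) where
  -- Division by trial: the accumulator follows the counter as long as the multiple of `suc n` does
  -- not exceed `t`, and stays at the last success.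
  primrec-div : ∀ X t → t / suc n ≤ X →
    primrec X 0 (λ x y → choose (suc t ∸ suc x * suc n) (suc x) y) ≡ t / suc n
  primrec-div X t le = trans (cong (λ X → primrec X 0 body) (≡-sym (m+[n∸m]≡n le))) (after (X ∸ t / suc n))
    where
    b = t / suc n
    body : ℕ → ℕ → ℕ
    body x y = choose (suc t ∸ suc x * suc n) (suc x) y
    before : ∀ x → x ≤ b → primrec x 0 body ≡ x
    before zero le = refl
    before (suc x) le = choose-nonzero (m>n⇒m∸n≢0 (s≤s (≤-trans (*-monoˡ-≤ (suc n) le) (m/n*n≤m t (suc n)))))
    after : ∀ r → primrec (b + r) 0 body ≡ b
    after zero = trans (cong (λ x → primrec x 0 body) (+-identityʳ b)) (before b ≤-refl)
    after (suc r) = trans (cong (λ x → primrec x 0 body) (+-suc b r))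
      (trans (choose-zero (m≤n⇒m∸n≡0 (≤-trans (past t) (*-monoˡ-≤ (suc n) (s≤s (m≤m+n b r)))))) (after r))
      where
      past : ∀ t → suc t ≤ suc (t / suc n) * suc n
      past t = ≤-trans (≤-reflexive (cong suc (m≡m%n+[m/n]*n t (suc n)))) (+-monoˡ-≤ _ (m%n<n t (suc n)))

  drop : ℕ → ℕ → ℕ
  drop zero    t = t
  drop (suc i) t = drop i t / suc n

  digit : ℕ → ℕ → ℕ
  digit i t = drop i t % suc n

  drop-≤ : ∀ i t → drop i t ≤ t
  drop-≤ zero t = ≤-refl
  drop-≤ (suc i) t = ≤-trans (m/n≤m (drop i t) (suc n)) (drop-≤ i t)

  digit-≤ : ∀ i t → digit i t ≤ n
  digit-≤ i t = ≤-pred (m%n<n (drop i t) (suc n))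

  drop-suc : ∀ i t → drop (suc i) t ≡ drop i (t / suc n)
  drop-suc zero t = refl
  drop-suc (suc i) t = cong (_/ suc n) (drop-suc i t)

  from-digits : ∀ m (δ : ℕ → ℕ) → (∀ i → i < m → δ i ≤ n) →
    ∃[ t ] t < suc n ^ m × (∀ i → i < m → digit i t ≡ δ i)
  from-digits zero δ h = 0 , s≤s z≤n , λ _ ()
  from-digits (suc m) δ h with from-digits m (λ i → δ (suc i)) (λ i lt → h (suc i) (s≤s lt))
  ... | t , t< , eq = δ 0 + t * suc n , bound , digits
    where
    bound : δ 0 + t * suc n < suc n ^ suc m
    bound = ≤-trans (+-monoˡ-≤ (t * suc n) (s≤s (h 0 (s≤s z≤n))))
      (≤-trans (*-monoˡ-≤ (suc n) t<) (≤-reflexive (*-comm (suc n ^ m) (suc n))))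
    quotient : (δ 0 + t * suc n) / suc n ≡ t
    quotient = trans (+-distrib-/ (δ 0) (t * suc n) (subst (_< suc n) (≡-sym rem) (s≤s (h 0 (s≤s z≤n)))))
      (cong₂ _+_ (m<n⇒m/n≡0 (s≤s (h 0 (s≤s z≤n)))) (m*n/n≡m t (suc n)))
      where
      rem : δ 0 % suc n + (t * suc n) % suc n ≡ δ 0
      rem = trans (cong₂ _+_ (m<n⇒m%n≡m (s≤s (h 0 (s≤s z≤n)))) (m*n%n≡0 t (suc n))) (+-identityʳ _)
    digits : ∀ i → i < suc m → digit i (δ 0 + t * suc n) ≡ δ i
    digits zero _ = trans ([m+kn]%n≡m%n (δ 0) t (suc n)) (m<n⇒m%n≡m (s≤s (h 0 (s≤s z≤n))))
    digits (suc i) (s≤s lt) = trans (cong (_% suc n) (trans (drop-suc i (δ 0 + t * suc n)) (cong (drop i) quotient))) (eq i lt)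

-- The consistency test

mulV : ∀ {v} → Fin v → Fin v → Tm v
mulV i j = rec (con 0) (cond (var (suc (suc i)) ⊟ var 0F) (var 1F ⊞ var (suc (suc j))) (var 1F))

divV : ∀ {v} → Fin v → Fin v → Tm v
divV i j = rec (con 0) (bind (var 0F ⊞ con 1) (bind (mulV 0F (suc (suc (suc j))))
  (cond (con 1 ⊞ var (suc (suc (suc (suc i)))) ⊟ var 0F) (var 1F) (var 3F))))

dropV : ∀ {v} → Fin v → Fin v → Fin v → Tm v
dropV b i t = rec (var t) (cond (var (suc (suc i)) ⊟ var 0F) (divV 1F (suc (suc b))) (var 1F))

digitV : ∀ {v} → Fin v → Fin v → Fin v → Tm v
digitV b i t = bind (dropV b i t) (bind (divV 0F (suc b)) (bind (mulV 0F (suc (suc b))) (var 2F ⊟ var 0F)))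

allBelow anyBelow : ∀ {v} → Tm (suc (suc v)) → Tm (suc (suc v)) → Tm v
allBelow b φ = rec (con 1) (cond (var 1F) (cond (b ⊟ var 0F) φ (con 1)) (con 0))
anyBelow b φ = rec (con 0) (cond (var 1F) (con 1) (cond (b ⊟ var 0F) φ (con 0)))

infixr 5 _and_
_and_ : ∀ {v} → Tm v → Tm v → Tm v
a and b = cond a b (con 0)

_≡ᵗ_ : ∀ {v} → Tm v → Tm v → Tm v
a ≡ᵗ b = con 1 ⊟ ((a ⊟ b) ⊞ (b ⊟ a))

isZero : ∀ {v} → Tm v → Tm v
isZero a = con 1 ⊟ a

module Terms (k q : ℕ) where

  indexV : ∀ {v} → Fin v → Fin v → Tm v
  indexV c j = bind (con q) (mulV 0F (suc c)) ⊞ var j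

  slotV : ∀ {v} → Fin v → Fin v → Fin v → Fin v → Tm v
  slotV b c j t = bind (indexV c j) (digitV (suc b) 0F (suc t))

  -- On entry the variables are the base `n + 1`, the state and `n`. Every quantifier pushes two
  -- variables, its counter and the accumulator of its loop.
  validT : Tm 3
  validT =
    allBelow (con k) (allBelow (con q) (bind (slotV 4F 2F 0F 5F)
      (cond (var 7F ⊟ var 0F)
        (inp (mulV 7F 7F ⊞ bind (con k) (mulV 1F 0F) ⊞ var 3F) and
          allBelow (con q) (bind (slotV 7F 5F 0F 8F)
            (cond (var (suc 9F) ⊟ var 0F) (isZero (inp (mulV 3F (suc 9F) ⊞ var 0F))) (con 1))))
        (con 1))))

  moveT : Tm 3
  moveT =
    allBelow (var 4F) (anyBelow (con k) (allBelow (con q) (rec (con 0) (cond (var 1F) (con 1)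
      (isZero (tab (var 0F)) and
        allBelow (con (k * q)) (cond (var 0F ≡ᵗ indexV 6F 4F)
          (digitV (suc 9F) 0F 2F ≡ᵗ var 8F)
          (digitV (suc 9F) 0F 2F ≡ᵗ digitV (suc 9F) 0F (suc (suc 9F)))))))))

  okT : Tm 2
  okT = cond (tab (var 0F)) (con 1) (bind (var 1F ⊞ con 1) (validT and moveT))

  aliveT : Tm 1
  aliveT = rec (con 0) (cond (var 1F) (con 1) (isZero (tab (var 0F))))

  -- `mulV` counts up to its first factor, which must not exceed the number of rounds. Hence `n + 1`
  -- comes first; the growing power exceeds that number.
  powerT : Tm 1
  powerT = bind (var 0F ⊞ con 1) (rec (con 1) (cond (con (k * q) ⊟ var 0F) (mulV 2F 1F) (var 1F)))

  index : ℕ → ℕ → ℕ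
  index c j = q * c + j

  -- The vertex in slot j of colour c, or n if this slot of the state t is empty.
  slot : ℕ → ℕ → ℕ → ℕ → ℕ
  slot n c j t = digit n (index c j) t

  index-bound : ∀ {c j} → c < k → j < q → index c j < k * q
  index-bound {c} {j} c< j< = ≤-trans (≤-trans (≤-reflexive (≡-sym (+-suc (q * c) j))) (+-monoʳ-≤ (q * c) j<))
    (≤-trans (≤-reflexive (trans (+-comm (q * c) q) (≡-sym (*-suc q c)))) (≤-trans (*-monoʳ-≤ q c<) (≤-reflexive (*-comm q k))))

  module Specification (n X : ℕ) (I T : ℕ → ℕ) where
    open Semantics X I T

    mul-spec : ∀ {v} (i j : Fin v) {ρ} → lookᵛ ρ i ≤ X → eval (mulV i j) ρ ≡ lookᵛ ρ i * lookᵛ ρ j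
    mul-spec i j {ρ} = primrec-mul X (lookᵛ ρ i) (lookᵛ ρ j)

    div-spec : ∀ {v} (i j : Fin v) {ρ} → lookᵛ ρ j ≡ suc n → lookᵛ ρ i ≤ X → eval (divV i j) ρ ≡ lookᵛ ρ i / suc n
    div-spec i j {ρ} eq le = trans (primrec-cong X λ x y lt →
        trans (cong (λ p → choose (suc (lookᵛ ρ i) ∸ p) (x + 1) y)
          (trans (primrec-mul X (x + 1) (lookᵛ ρ j) (≤-trans (≤-reflexive (+-comm x 1)) lt)) (cong₂ _*_ (+-comm x 1) eq)))
        (cong (λ s → choose (suc (lookᵛ ρ i) ∸ suc x * suc n) s y) (+-comm x 1)))
      (primrec-div n X (lookᵛ ρ i) (≤-trans (m/n≤m (lookᵛ ρ i) (suc n)) le))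

    drop-spec : ∀ {v} (b i t : Fin v) {ρ} → lookᵛ ρ b ≡ suc n → lookᵛ ρ i ≤ X → lookᵛ ρ t ≤ X →
      eval (dropV b i t) ρ ≡ drop n (lookᵛ ρ i) (lookᵛ ρ t)
    drop-spec b i t {ρ} eq i≤ t≤ =
      primrec-stop X (lookᵛ ρ i) (λ y → eval (divV 0F 1F) (y ∷ lookᵛ ρ b ∷ [])) (λ x → drop n x (lookᵛ ρ t)) i≤ refl
        λ x _ → div-spec 0F 1F {drop n x (lookᵛ ρ t) ∷ lookᵛ ρ b ∷ []} eq (≤-trans (drop-≤ n x (lookᵛ ρ t)) t≤)

    digit-spec : ∀ {v} (b i t : Fin v) {ρ} → lookᵛ ρ b ≡ suc n → lookᵛ ρ i ≤ X → lookᵛ ρ t ≤ X →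
      eval (digitV b i t) ρ ≡ digit n (lookᵛ ρ i) (lookᵛ ρ t)
    digit-spec b i t {ρ} eq i≤ t≤ rewrite drop-spec b i t {ρ} eq i≤ t≤ = begin
        u ∸ eval (mulV 0F 2F) (eval (divV 0F 1F) (u ∷ lookᵛ ρ b ∷ []) ∷ u ∷ lookᵛ ρ b ∷ [])
          ≡⟨ cong (λ d → u ∸ eval (mulV 0F 2F) (d ∷ u ∷ lookᵛ ρ b ∷ [])) (div-spec 0F 1F {u ∷ lookᵛ ρ b ∷ []} eq u≤) ⟩
        u ∸ eval (mulV 0F 2F) (u / suc n ∷ u ∷ lookᵛ ρ b ∷ [])
          ≡⟨ cong (u ∸_) (mul-spec 0F 2F {u / suc n ∷ u ∷ lookᵛ ρ b ∷ []} (≤-trans (m/n≤m u (suc n)) u≤)) ⟩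
        u ∸ u / suc n * lookᵛ ρ b
          ≡⟨ cong (λ b → u ∸ u / suc n * b) eq ⟩
        u ∸ u / suc n * suc n
          ≡⟨ ≡-sym (m%n≡m∸m/n*n u (suc n)) ⟩
        u % suc n ∎
      where
      open ≡-Reasoning
      u = drop n (lookᵛ ρ i) (lookᵛ ρ t)
      u≤ : u ≤ X
      u≤ = ≤-trans (drop-≤ n (lookᵛ ρ i) (lookᵛ ρ t)) t≤

    record Evals {v} (e : Tm v) (ρ : Vec ℕ v) (x : ℕ) : Set where
      constructor evals
      field value : eval e ρ ≡ x

    open Evals

    mul-evals : ∀ {v} {i j : Fin v} {ρ} → lookᵛ ρ i ≤ X → Evals (mulV i j) ρ (lookᵛ ρ i * lookᵛ ρ j)
    mul-evals {i = i} {j} {ρ} le = evals (mul-spec i j {ρ} le)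

    digit-evals : ∀ {v} {b i t : Fin v} {ρ} → lookᵛ ρ b ≡ suc n → lookᵛ ρ i ≤ X → lookᵛ ρ t ≤ X →
      Evals (digitV b i t) ρ (digit n (lookᵛ ρ i) (lookᵛ ρ t))
    digit-evals {b = b} {i} {t} {ρ} eq i≤ t≤ = evals (digit-spec b i t {ρ} eq i≤ t≤)

    sum-evals : ∀ {v x y} {a b : Tm v} {ρ} → Evals a ρ x → Evals b ρ y → Evals (a ⊞ b) ρ (x + y)
    sum-evals (evals p) (evals q) = evals (cong₂ _+_ p q)

    inp-evals : ∀ {v x} {a : Tm v} {ρ} → Evals a ρ x → Evals (inp a) ρ (I x)
    inp-evals (evals p) = evals (cong I p)

    tab-evals : ∀ {v x} {a : Tm v} {ρ} → Evals a ρ x → Evals (tab a) ρ (T x)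
    tab-evals (evals p) = evals (cong T p)

    var-evals : ∀ {v} {i : Fin v} {ρ} → Evals (var i) ρ (lookᵛ ρ i)
    var-evals = evals refl

    bind-evals : ∀ {v x y} {a : Tm v} {b ρ} → Evals a ρ x → Evals b (x ∷ ρ) y → Evals (bind a b) ρ y
    bind-evals (evals refl) (evals q) = evals q

    record Sat {v} (φ : Tm v) (ρ : Vec ℕ v) (P : Set) : Set where
      constructor sat
      field truth : eval φ ρ ⊨ P

    open Sat

    sat-below : ∀ {v x y c} {ρ : Vec ℕ v} (b : Tm (suc (suc v))) → eval b (x ∷ y ∷ ρ) ≡ c → Sat (b ⊟ var 0F) (x ∷ y ∷ ρ) (x < c)
    sat-below {x = x} b refl = sat (⊨-< x _)

    sat-imp : ∀ {v} {ρ : Vec ℕ v} {a φ P Q} → Sat a ρ P → (P → Sat φ ρ Q) → Sat (cond a φ (con 1)) ρ (P → Q)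
    sat-imp (sat p) f = sat (⊨-imp p λ x → truth (f x))

    sat-and : ∀ {v} {ρ : Vec ℕ v} {a b P Q} → Sat a ρ P → Sat b ρ Q → Sat (a and b) ρ (P × Q)
    sat-and (sat p) (sat q) = sat (⊨-and p q)

    sat-guard : ∀ {v} {ρ : Vec ℕ v} {a b} {P Q : Set} → Sat a ρ P → (P → Sat b ρ Q) → Sat (a and b) ρ (P × Q)
    sat-guard {ρ = ρ} {a} {b} (sat p) f = sat (guarded (eval a ρ) p)
      where
      guarded : ∀ x → x ⊨ _ → choose x (eval b ρ) 0 ⊨ _
      guarded zero (_ , g) = (λ nz → contradiction refl nz) , λ (p , _) → g p
      guarded (suc x) (f′ , _) = (λ nz → f′ (λ ()) , proj₁ (truth (f (f′ λ ()))) nz) , λ (p , q) → proj₂ (truth (f p)) q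

    sat-case : ∀ {v} {ρ : Vec ℕ v} {a b c P Q R} → Sat a ρ P → Sat b ρ Q → Sat c ρ R →
      Sat (cond a b c) ρ ((P → Q) × (¬ P → R))
    sat-case (sat p) (sat q) (sat r) = sat (⊨-case p q r)

    sat-zero : ∀ {v x} {ρ : Vec ℕ v} {a} → Evals a ρ x → Sat (isZero a) ρ (x ≡ 0)
    sat-zero (evals refl) = sat (⊨-zero _)

    sat-nonzero : ∀ {v x} {ρ : Vec ℕ v} {a} → Evals a ρ x → Sat a ρ (x ≢ 0)
    sat-nonzero (evals refl) = sat (⊨-nonzero _)

    sat-≡ : ∀ {v x y} {ρ : Vec ℕ v} {a b} → Evals a ρ x → Evals b ρ y → Sat (a ≡ᵗ b) ρ (x ≡ y)
    sat-≡ (evals refl) (evals refl) = sat (⊨-≡ _ _)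

    sat-bind : ∀ {v x} {ρ : Vec ℕ v} {a φ P} → Evals a ρ x → Sat φ (x ∷ ρ) P → Sat (bind a φ) ρ P
    sat-bind (evals refl) (sat p) = sat p

    sat-any : ∀ {v} {ρ : Vec ℕ v} {φ} {P : ℕ → Set} → (∀ x y → x < X → Sat φ (x ∷ y ∷ ρ) (P x)) →
      Sat (rec (con 0) (cond (var 1F) (con 1) φ)) ρ (∃[ x ] x < X × P x)
    sat-any {ρ = ρ} {φ} h = sat (⊨-any X {λ x y → eval φ (x ∷ y ∷ ρ)} λ x y lt → truth (h x y lt))

    sat-allBelow : ∀ {v c} {ρ : Vec ℕ v} {b φ} {P : ℕ → Set} → c ≤ X →
      (∀ x y → eval b (x ∷ y ∷ ρ) ≡ c) → (∀ x y → x < c → Sat φ (x ∷ y ∷ ρ) (P x)) →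
      Sat (allBelow b φ) ρ (∀ x → x < c → P x)
    sat-allBelow {ρ = ρ} {b} {φ} c≤X eq h = sat (⊨-map
      (λ g x lt → g x (≤-trans lt c≤X) lt) (λ g x _ lt → g x lt)
      (⊨-all X {λ x y → choose (eval b (x ∷ y ∷ ρ) ∸ x) (eval φ (x ∷ y ∷ ρ)) 1}
        λ x y _ → truth (sat-imp (sat-below b (eq x y)) (h x y))))

    sat-anyBelow : ∀ {v c} {ρ : Vec ℕ v} {b φ} {P : ℕ → Set} → c ≤ X →
      (∀ x y → eval b (x ∷ y ∷ ρ) ≡ c) → (∀ x y → x < c → Sat φ (x ∷ y ∷ ρ) (P x)) →
      Sat (anyBelow b φ) ρ (∃[ x ] x < c × P x)
    sat-anyBelow {ρ = ρ} {b} {φ} c≤X eq h = sat (⊨-map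
      (λ (x , _ , lt , p) → x , lt , p) (λ (x , lt , p) → x , ≤-trans lt c≤X , lt , p)
      (truth (sat-any λ x y _ → sat-guard (sat-below b (eq x y)) (h x y))))

    Valid : ℕ → Set
    Valid t = ∀ c → c < k → ∀ j → j < q → slot n c j t < n →
      I (n * n + slot n c j t * k + c) ≢ 0 ×
      (∀ j′ → j′ < q → slot n c j′ t < n → I (slot n c j t * n + slot n c j′ t) ≡ 0)

    -- One colour has to serve for all slots: which slot may be sacrificed depends on the colour and
    -- on the partial colouring to be preserved, and the latter is not known here.
    Move : ℕ → Set
    Move t = ∀ v → v < n → ∃[ c ] c < k × (∀ j → j < q → ∃[ t′ ] t′ < X × T t′ ≡ 0 ×
      (∀ i → i < k * q → (i ≡ index c j → digit n i t′ ≡ v) × (i ≢ index c j → digit n i t′ ≡ digit n i t)))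

    module _ (k≤X : k ≤ X) (q≤X : q ≤ X) (m≤X : k * q ≤ X) (n≤X : n ≤ X) where

      index-evals : ∀ {v} {c j : Fin v} {ρ} → Evals (indexV c j) ρ (index (lookᵛ ρ c) (lookᵛ ρ j))
      index-evals {c = c} {j} {ρ} = evals (cong (_+ lookᵛ ρ j) (primrec-mul X q (lookᵛ ρ c) q≤X))

      slot-evals : ∀ {v} {b c j t : Fin v} {ρ} → lookᵛ ρ b ≡ suc n → lookᵛ ρ c < k → lookᵛ ρ j < q → lookᵛ ρ t ≤ X →
        Evals (slotV b c j t) ρ (slot n (lookᵛ ρ c) (lookᵛ ρ j) (lookᵛ ρ t))
      slot-evals eq c< j< t≤ = bind-evals index-evals
        (digit-evals eq (≤-trans (<⇒≤ (index-bound c< j<)) m≤X) t≤)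

      valid-spec : ∀ {b t} → b ≡ suc n → t ≤ X → Sat validT (b ∷ t ∷ n ∷ []) (Valid t)
      valid-spec {b} {t} eq t≤ =
        sat-allBelow k≤X (λ _ _ → refl) λ c _ c< →
        sat-allBelow q≤X (λ _ _ → refl) λ j _ j< →
        sat-bind (slot-evals eq c< j< t≤) (sat-imp (sat (⊨-< _ n)) λ d< →
        sat-and (sat-nonzero (inp-evals (sum-evals (sum-evals (mul-evals n≤X) (bind-evals (evals refl) (mul-evals (≤-trans (<⇒≤ d<) n≤X)))) var-evals)))
        (sat-allBelow q≤X (λ _ _ → refl) λ j′ _ j′< →
        sat-bind (slot-evals eq c< j′< t≤) (sat-imp (sat (⊨-< _ n)) λ d′< →
        sat-zero (inp-evals (sum-evals (mul-evals (≤-trans (<⇒≤ d<) n≤X)) var-evals)))))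

      move-spec : ∀ {b t} → b ≡ suc n → t ≤ X → Sat moveT (b ∷ t ∷ n ∷ []) (Move t)
      move-spec {b} {t} eq t≤ =
        sat-allBelow n≤X (λ _ _ → refl) λ v _ v< →
        sat-anyBelow k≤X (λ _ _ → refl) λ c _ c< →
        sat-allBelow q≤X (λ _ _ → refl) λ j _ j< →
        sat-any λ t′ _ t′< →
        sat-and (sat-zero (tab-evals var-evals))
        (sat-allBelow m≤X (λ _ _ → refl) λ i _ i< →
        sat-case (sat-≡ var-evals index-evals)
          (sat-≡ (digit-evals eq (≤-trans (<⇒≤ i<) m≤X) (<⇒≤ t′<)) var-evals)
          (sat-≡ (digit-evals eq (≤-trans (<⇒≤ i<) m≤X) (<⇒≤ t′<))
                 (digit-evals eq (≤-trans (<⇒≤ i<) m≤X) t≤)))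

      ok-spec : ∀ {t} → t ≤ X → eval okT (t ∷ n ∷ []) ⊨ (T t ≢ 0 ⊎ (Valid t × Move t))
      ok-spec {t} t≤ = ⊨-or (⊨-nonzero (T t)) (truth {φ = bind (var 1F ⊞ con 1) (validT and moveT)} {t ∷ n ∷ []} (sat-bind {x = suc n} (evals (+-comm n 1))
        (sat-and (valid-spec refl t≤) (move-spec refl t≤))))

    alive-spec : eval aliveT (n ∷ []) ⊨ (∃[ t ] t < X × T t ≡ 0)
    alive-spec = truth {φ = aliveT} {n ∷ []} (sat-any λ t _ _ → sat-zero (tab-evals var-evals))

    power-spec : k * q ≤ X → suc n ≤ X → eval powerT (n ∷ []) ≡ suc n ^ (k * q)
    power-spec m≤X b≤X = primrec-stop X (k * q) (λ y → eval (mulV 0F 1F) (n + 1 ∷ y ∷ [])) (suc n ^_) m≤X refl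
      λ x _ → trans (mul-spec 0F 1F {n + 1 ∷ suc n ^ x ∷ []} (≤-trans (≤-reflexive (+-comm n 1)) b≤X)) (cong (_* suc n ^ x) (+-comm n 1))

-- The algorithm

zeros : ℕ → (ℕ → ℕ) → ℕ
zeros zero    T = 0
zeros (suc x) T with T x ≟ 0
... | yes _ = suc (zeros x T)
... | no  _ = zeros x T

zeros-≤ : ∀ x T → zeros x T ≤ x
zeros-≤ zero T = z≤n
zeros-≤ (suc x) T with T x ≟ 0
... | yes _ = s≤s (zeros-≤ x T)
... | no  _ = m≤n⇒m≤1+n (zeros-≤ x T)

zeros-cong : ∀ x {T T′} → (∀ t → t < x → T t ≡ T′ t) → zeros x T ≡ zeros x T′
zeros-cong zero h = refl
zeros-cong (suc x) {T} {T′} h with T x ≟ 0 | T′ x ≟ 0 | zeros-cong x {T} {T′} (λ t lt → h t (m≤n⇒m≤1+n lt))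
... | yes _ | yes _ | eq = cong suc eq
... | no  _ | no  _ | eq = eq
... | yes p | no ¬p | _  = contradiction (trans (≡-sym (h x ≤-refl)) p) ¬p
... | no ¬p | yes p | _  = contradiction (trans (h x ≤-refl) p) ¬p

zeros-kill : ∀ x {T t} → t < x → T t ≡ 0 → zeros x (T [ t ↦ 1 ]) < zeros x T
zeros-kill (suc x) {T} {t} t<x eq with m≤n⇒m<n∨m≡n (≤-pred t<x)
... | inj₁ lt with (T [ t ↦ 1 ]) x ≟ 0 | T x ≟ 0 | zeros-kill x {T} lt eq
...   | yes _ | yes _ | ih = s≤s ih
...   | no  _ | no  _ | ih = ih
...   | no  _ | yes _ | ih = m≤n⇒m≤1+n ih
...   | yes p | no ¬p | _  = contradiction (trans (≡-sym (update-other T 1 (<⇒≢ lt))) p) ¬p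
zeros-kill (suc x) {T} {t} t<x eq | inj₂ refl with (T [ t ↦ 1 ]) t ≟ 0 | T t ≟ 0
... | yes p | _     = contradiction (trans (≡-sym p) (update-same T t 1)) λ ()
... | no  _ | no ¬p = contradiction eq ¬p
... | no  _ | yes _ = s≤s (≤-reflexive (zeros-cong t λ u lt → update-other T {a = t} 1 λ { refl → <-irrefl refl lt }))

module Algorithm (k q : ℕ) where
  open Terms k q

  -- Registers 0, 1 and 2 hold the number of rounds, `n` and the state under inspection; compiled
  -- terms work from register 3 on.
  M : ℕ
  M = 3 + (size okT + (size powerT + size aliveT))

  open Compiler M public

  slots : ℕ
  slots = k * q

  -- Added to `n` it exceeds `k`, `q`, `k * q` and `n`, which is all that the loops computing the
  -- power require.
  padding : ℕ
  padding = suc (slots + (k + q))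

  -- Cells 1 and n + 2 belong to the diagonal of the adjacency matrix and hold 0, so they can be used before the size of
  -- the input is known.  If n ≤ 1, the input ends before cell k + 2 anyway.
  counter : Expr
  counter = mem (lit 0) ⊕ lit 2

  measure : Program
  measure = if (mem (lit 0) ⊖ lit 1)
    (mem[ counter ]≔ mem (lit 0) ⨾
     while (mem counter)
       (mem[ lit 1 ]≔ mem (lit 1) ⊕ (mem (lit 0) ⊕ lit k) ⨾
        mem[ counter ]≔ mem counter ⊖ lit 1))
    (mem[ lit 1 ]≔ lit (suc k))

  -- With s in cell 1 the registers start at s + 1. The order matters: `n` is copied from cell 0
  -- before the base replaces it, and s is read for the last time before cell 1 gets back the
  -- diagonal entry 0 of the input.
  allocate : Program
  allocate =
    mem[ mem (lit 1) ⊕ lit 2 ]≔ mem (lit 0) ⨾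
    mem[ mem (lit 1) ⊕ lit 1 ]≔ mem (lit 0) ⊕ lit padding ⨾
    mem[ lit 0 ]≔ mem (lit 1) ⊕ lit 1 ⨾
    mem[ lit 1 ]≔ lit 0

  -- The power is computed with a small number of rounds; adding it to register 0 makes all later
  -- loops long enough to run through every state.
  enlarge : Program
  enlarge = code powerT (1 ∷ []) 3 ⨾ setReg 0 (reg 3 ⊕ reg 0)

  -- The scan returns to state 0 because states accepted earlier may have relied on a move to the
  -- deleted one.
  kill : Program
  kill = mem[ mem (lit 0) ⊕ (lit M ⊕ reg 2) ]≔ lit 1 ⨾ setReg 2 (lit 0)

  step : Program
  step = code okT (2 ∷ 1 ∷ []) 3 ⨾ if (reg 3) (setReg 2 (reg 2 ⊕ lit 1)) kill

  prune-table : Program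
  prune-table = setReg 2 (lit 0) ⨾ while (reg 0 ⊖ reg 2) step

  answer : Program
  answer = code aliveT (1 ∷ []) 3 ⨾ mem[ lit 0 ]≔ lit 1 ⊖ (lit 1 ⊖ reg 3)

  algorithm : Program
  algorithm = measure ⨾ allocate ⨾ enlarge ⨾ prune-table ⨾ answer

  3≤M : 3 ≤ M
  3≤M = m≤m+n 3 _

  module Loop (n base X : ℕ) (I : ℕ → ℕ) (1≤base : 1 ≤ base) (I-outside : ∀ a → base ≤ suc a → I a ≡ 0)
              (k≤X : k ≤ X) (q≤X : q ≤ X) (m≤X : slots ≤ X) (n≤X : n ≤ X) where
    open Correctness base X I I-outside public
    open Holds public

    OK : (ℕ → ℕ) → ℕ → Set
    OK T t = T t ≢ 0 ⊎ (Specification.Valid n X I T t × Specification.Move n X I T t)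

    store-holds : ∀ {T σ} t → Holds T σ → Holds (T [ t ↦ 1 ]) (σ [ σ 0 + (M + t) ↦ 1 ])
    store-holds {T} {σ} t h = record
      { holds-base  = trans (other λ p → <-irrefl (≡-sym p) (≤-trans 1≤base (m≤m+n base (M + t)))) (holds-base h)
      ; holds-bound = trans (other λ p → <-irrefl (≡-sym (+-cancelˡ-≡ base _ _ p)) (≤-trans (≤-trans (s≤s z≤n) 3≤M) (m≤m+n M t))) (holds-bound h)
      ; holds-input = λ a lt → trans (other λ p → <-irrefl (≡-sym p) (≤-trans lt (m≤m+n base (M + t)))) (holds-input h a lt)
      ; holds-table = table
      }
      where
      other : ∀ {a} → base + (M + t) ≢ a → (σ [ σ 0 + (M + t) ↦ 1 ]) a ≡ σ a
      other p = update-other σ 1 λ e → p (trans (cong (_+ (M + t)) (≡-sym (holds-base h))) e)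
      table : ∀ j → (σ [ σ 0 + (M + t) ↦ 1 ]) (base + (M + j)) ≡ (T [ t ↦ 1 ]) j
      table j with t ≟ j
      ... | yes refl = trans (trans (cong (λ b → (σ [ σ 0 + (M + t) ↦ 1 ]) (b + (M + t))) (≡-sym (holds-base h)))
        (update-same σ (σ 0 + (M + t)) 1)) (≡-sym (update-same T t 1))
      ... | no t≢j = trans (trans (other λ p → t≢j (+-cancelˡ-≡ M _ _ (+-cancelˡ-≡ base _ _ p))) (holds-table h j))
        (≡-sym (update-other T 1 t≢j))

    store-reg : ∀ {T σ} t {i} → Holds T σ → i < M → (σ [ σ 0 + (M + t) ↦ 1 ]) (base + i) ≡ σ (base + i)
    store-reg {T} {σ} t {i} h i<M = update-other σ 1 λ p → <-irrefl
      (≡-sym (+-cancelˡ-≡ base _ _ (trans (cong (_+ (M + t)) (≡-sym (holds-base h))) p))) (≤-trans i<M (m≤m+n M t))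

    -- Restarting after every deletion makes all states below t acceptable for the current table.
    record Progress (J : (ℕ → ℕ) → Set) (T : ℕ → ℕ) (t : ℕ) (σ : Memory) : Set where
      field
        holds     : Holds T σ
        order     : σ (base + 1) ≡ n
        position  : σ (base + 2) ≡ t
        t≤X       : t ≤ X
        invariant : J T
        checked   : ∀ u → u < t → OK T u

    module _ (J : (ℕ → ℕ) → Set) (J-kill : ∀ T t → t < X → J T → ¬ OK T t → J (T [ t ↦ 1 ])) where

      open Progress

      -- Lexicographic: a deletion lowers the number of remaining states by one, which pays for
      -- restarting the scan, and an acceptance shortens the rest of the scan.
      potential : (ℕ → ℕ) → ℕ → ℕ
      potential T t = zeros X T * suc X + (X ∸ t)

      Stepped : (ℕ → ℕ) → ℕ → Memory → Set
      Stepped T t σ = ∃[ τ ] ∃[ T′ ] ∃[ t′ ] Run step σ (time X okT + 40) τ × Progress J T′ t′ τ × potential T′ t′ < potential T t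

      round : ℕ
      round = time X okT + 60

      after-check : ∀ {T t σ} → Progress J T t σ → t < X →
        (o : Outcome {T} 1≤base (code okT (2 ∷ 1 ∷ []) 3) 3 σ (time X okT) (Semantics.eval X I T okT (t ∷ n ∷ []))) →
        Stepped T t σ
      after-check {T} {t} {σ} pr t<X o = decide _ refl
        where
        open Outcome o renaming (final to σ₁)
        spec = Specification.ok-spec n X I T k≤X q≤X m≤X n≤X {t} (<⇒≤ t<X)
        h₁ = frame-holds (s≤s z≤n) 1≤base framed (holds pr)
        order₁ : σ₁ (base + 1) ≡ n
        order₁ = trans (frame-reg framed (s≤s (s≤s z≤n))) (order pr)
        position₁ : σ₁ (base + 2) ≡ t
        position₁ = trans (frame-reg framed ≤-refl) (position pr)
        decide : ∀ x → Semantics.eval X I T okT (t ∷ n ∷ []) ≡ x →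
          Stepped T t σ
        decide (suc x) eq = _ , T , suc t ,
          run-seq run (run-weaken (m≤m+n 18 22) (run-if-true (λ z → 1+n≢0 (trans (≡-sym eq) (trans (≡-sym value) (trans (≡-sym (reg-value h₁ 3)) z))))
            (_ , ≤-refl , assign⇓))) ,
          record
            { holds = set-holds
            ; order = trans (set-other {T} 1≤base _ h₁ λ ()) order₁
            ; position = trans (set-value {T} 1≤base _ h₁) (trans (cong (_+ 1) (trans (reg-value h₁ 2) position₁)) (+-comm t 1))
            ; t≤X = t<X
            ; invariant = invariant pr
            ; checked = λ u lt → [ checked pr u , (λ { refl → proj₁ spec λ z → 1+n≢0 (trans (≡-sym eq) z) }) ]′ (m≤n⇒m<n∨m≡n (≤-pred lt))
            } ,
          +-monoʳ-< (zeros X T * suc X) (∸-monoʳ-< {X} ≤-refl t<X)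
          where
          set-holds : Holds T (σ₁ [ σ₁ 0 + 2 ↦ ⟦ reg 2 ⊕ lit 1 ⟧ σ₁ ])
          set-holds = frame-holds {2} (s≤s z≤n) 1≤base (set-frame {T} 1≤base _ h₁ ≤-refl 3≤M) h₁
        decide zero eq = _ , T [ t ↦ 1 ] , 0 ,
          run-seq run (run-weaken (m≤m+n 24 16) (run-if-false (trans (reg-value h₁ 3) (trans value eq))
            (run-seq (_ , ≤-refl , assign⇓) (_ , ≤-refl , assign⇓)))) ,
          record
            { holds = frame-holds {2} (s≤s z≤n) 1≤base (set-frame {T [ t ↦ 1 ]} 1≤base _ h₂ ≤-refl 3≤M) h₂
            ; order = trans (set-other {T [ t ↦ 1 ]} 1≤base _ h₂ λ ()) (trans (reg₂ (≤-trans (n≤1+n 2) 3≤M)) order₁)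
            ; position = set-value {T [ t ↦ 1 ]} 1≤base _ h₂
            ; t≤X = z≤n
            ; invariant = J-kill T t t<X (invariant pr) bad
            ; checked = λ _ ()
            } ,
          decrease
          where
          bad : ¬ OK T t
          bad ok = proj₂ spec ok eq
          Tt≡0 : T t ≡ 0
          Tt≡0 with T t ≟ 0
          ... | yes p = p
          ... | no ¬p = contradiction (inj₁ ¬p) bad
          σ₂ : Memory
          σ₂ = σ₁ [ ⟦ mem (lit 0) ⊕ (lit M ⊕ reg 2) ⟧ σ₁ ↦ 1 ]
          address : ⟦ mem (lit 0) ⊕ (lit M ⊕ reg 2) ⟧ σ₁ ≡ σ₁ 0 + (M + t)
          address = cong (λ x → σ₁ 0 + (M + x)) (trans (reg-value h₁ 2) position₁)
          h₂ : Holds (T [ t ↦ 1 ]) σ₂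
          h₂ = subst (λ a → Holds (T [ t ↦ 1 ]) (σ₁ [ a ↦ 1 ])) (≡-sym address) (store-holds t h₁)
          reg₂ : ∀ {i} → i < M → σ₂ (base + i) ≡ σ₁ (base + i)
          reg₂ {i} i<M = trans (cong (λ a → (σ₁ [ a ↦ 1 ]) (base + i)) address) (store-reg t h₁ i<M)
          decrease : potential (T [ t ↦ 1 ]) 0 < potential T t
          decrease = ≤-trans (≤-reflexive (trans (≡-sym (+-suc (zeros X (T [ t ↦ 1 ]) * suc X) X)) (+-comm _ (suc X))))
            (≤-trans (*-monoˡ-≤ (suc X) (zeros-kill X t<X Tt≡0)) (m≤m+n _ (X ∸ t)))

      loop : ∀ fuel {T t σ} → potential T t ≤ fuel → Progress J T t σ →
        ∃[ τ ] ∃[ T′ ] Run (while (reg 0 ⊖ reg 2) step) σ (fuel * round + 20) τ × Progress J T′ X τ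
      loop fuel {T} {t} {σ} le pr with m≤n⇒m<n∨m≡n (t≤X pr)
      ... | inj₂ refl = σ , T , run-weaken (≤-trans (m≤m+n 12 8) (m≤n+m 20 (fuel * round))) (run-while-false guard) , pr
        where
        guard : ⟦ reg 0 ⊖ reg 2 ⟧ σ ≡ 0
        guard = trans (cong₂ _∸_ (trans (reg-value (holds pr) 0) (holds-bound (holds pr)))
          (trans (reg-value (holds pr) 2) (position pr))) (n∸n≡0 X)
      loop zero {T} {t} le pr | inj₁ t<X =
        contradiction (≤-trans (m<n⇒0<n∸m t<X) (≤-trans (m≤n+m _ (zeros X T * suc X)) le)) λ ()
      loop (suc fuel) {T} {t} {σ} le pr | inj₁ t<X = go (after-check pr t<X check)
        where
        check = code-correct 1≤base okT {2 ∷ 1 ∷ []} {t ∷ n ∷ []} {3} (s≤s z≤n)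
          (below-cons ≤-refl (below-cons (s≤s (s≤s z≤n)) (below λ ())))
          (+-monoʳ-≤ 3 (m≤m+n (size okT) _)) (holds pr)
          (env-cons (position pr) (env-cons (order pr) (env λ ())))
        guard : ⟦ reg 0 ⊖ reg 2 ⟧ σ ≢ 0
        guard z = m>n⇒m∸n≢0 t<X (trans (≡-sym (cong₂ _∸_ (trans (reg-value (holds pr) 0) (holds-bound (holds pr)))
          (trans (reg-value (holds pr) 2) (position pr)))) z)
        go : Stepped T t σ →
          ∃[ τ ] ∃[ T′ ] Run (while (reg 0 ⊖ reg 2) step) σ (suc fuel * round + 20) τ × Progress J T′ X τ
        go (τ , T′ , t′ , r , pr′ , lt) with loop fuel (≤-pred (≤-trans lt le)) pr′
        ... | υ , T″ , r′ , pr″ = υ , T″ , run-weaken (bound (time X okT) (fuel * round)) (run-while-true guard r r′) , pr″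
          where
          bound : ∀ m y → suc (11 + (m + 40) + (y + 20)) ≤ m + 60 + y + 20
          bound m y = ≤-trans (m≤m+n _ 8) (≤-reflexive (solve 2
            (λ m y → κ 12 :+ (m :+ κ 40) :+ (y :+ κ 20) :+ κ 8 := m :+ κ 60 :+ y :+ κ 20) refl m y))

  run-assign : ∀ {a e σ x y t} → ⟦ a ⟧ σ ≡ x → ⟦ e ⟧ σ ≡ y → suc (cost a + cost e) ≤ t →
    Run (mem[ a ]≔ e) σ t (σ [ x ↦ y ])
  run-assign refl refl le = _ , le , assign⇓

  record Measured (n : ℕ) (σ₀ σ : Memory) : Set where
    field
      order      : σ 0 ≡ n
      positive   : 1 ≤ σ 1
      enough     : n * n + n * k ≤ σ 1
      unaffected : ∀ a → 2 ≤ a → σ a ≡ σ₀ a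

  module _ {n : ℕ} {σ₀ : Memory} (σ₀0 : σ₀ 0 ≡ n) (σ₀1 : σ₀ 1 ≡ 0) (σ₀c : 2 ≤ n → σ₀ (n + 2) ≡ 0) where

    countdown : 2 ≤ n → ∀ r x {σ} → σ 0 ≡ n → σ 1 ≡ x → σ (n + 2) ≡ r →
      (∀ a → 2 ≤ a → a ≢ n + 2 → σ a ≡ σ₀ a) →
      ∃[ τ ] Run (while (mem counter)
         (mem[ lit 1 ]≔ mem (lit 1) ⊕ (mem (lit 0) ⊕ lit k) ⨾ mem[ counter ]≔ mem counter ⊖ lit 1)) σ (r * 40 + 10) τ ×
        τ 0 ≡ n × τ 1 ≡ x + r * (n + k) × (∀ a → 2 ≤ a → τ a ≡ σ₀ a)
    countdown 2≤n zero x {σ} e0 e1 ec eo = σ ,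
      run-weaken (m≤m+n 6 4) (run-while-false (trans (cong (λ m → σ (m + 2)) e0) ec)) ,
      e0 , trans e1 (≡-sym (+-identityʳ x)) , all
      where
      all : ∀ a → 2 ≤ a → σ a ≡ σ₀ a
      all a 2≤a with a ≟ n + 2
      ... | yes refl = trans ec (≡-sym (σ₀c 2≤n))
      ... | no  p    = eo a 2≤a p
    countdown 2≤n (suc r) x {σ} e0 e1 ec eo =
      finish (countdown 2≤n r (x + (n + k)) {σ₂}
        (trans (update-other σ₁ {n + 2} r (0≢ n)) e0)
        (trans (update-other σ₁ {n + 2} r (1≢ n)) refl)
        (update-same σ₁ (n + 2) r)
        (λ a 2≤a p → trans (update-other σ₁ r (λ q → p (≡-sym q))) (trans (update-other σ {1} (x + (n + k)) λ { refl → <-irrefl refl 2≤a }) (eo a 2≤a p))))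
      where
      0≢ : ∀ n → n + 2 ≢ 0
      0≢ zero ()
      0≢ (suc n) ()
      1≢ : ∀ n → n + 2 ≢ 1
      1≢ zero ()
      1≢ (suc n) p = 0≢ n (suc-injective p)
      σ₁ σ₂ : Memory
      σ₁ = σ [ 1 ↦ x + (n + k) ]
      σ₂ = σ₁ [ n + 2 ↦ r ]
      r₁ : Run (mem[ lit 1 ]≔ mem (lit 1) ⊕ (mem (lit 0) ⊕ lit k)) σ 10 σ₁
      r₁ = run-assign refl (cong₂ (λ a b → a + (b + k)) e1 e0) (m≤m+n 9 1)
      counter₁ : ⟦ counter ⟧ σ₁ ≡ n + 2
      counter₁ = cong (_+ 2) e0
      r₂ : Run (mem[ counter ]≔ mem counter ⊖ lit 1) σ₁ 20 σ₂
      r₂ = run-assign counter₁ (cong (_∸ 1) (trans (cong σ₁ counter₁) (trans (update-other σ {1} (x + (n + k)) (λ p → 1≢ n (≡-sym p))) ec))) (m≤m+n 12 8)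
      finish : (∃[ τ ] Run _ σ₂ (r * 40 + 10) τ × τ 0 ≡ n × τ 1 ≡ x + (n + k) + r * (n + k) × (∀ a → 2 ≤ a → τ a ≡ σ₀ a)) → _
      finish (τ , run , τ0 , τ1 , τo) = τ ,
        run-weaken (≤-trans (m≤m+n _ 4) (≤-reflexive (bound (r * 40))))
          (run-while-true (λ z → 1+n≢0 (trans (≡-sym ec) (trans (cong (λ m → σ (m + 2)) (≡-sym e0)) z))) (run-seq r₁ r₂) run) ,
        τ0 , trans τ1 (+-assoc x (n + k) _) , τo
        where
        bound : ∀ y → suc (5 + (10 + 20) + (y + 10)) + 4 ≡ 40 + y + 10
        bound y = solve 1 (λ y → κ 1 :+ (κ 35 :+ (y :+ κ 10)) :+ κ 4 := κ 40 :+ y :+ κ 10) refl y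

    measure-correct : ∃[ τ ] Run measure σ₀ (n * 40 + 40) τ × Measured n σ₀ τ
    measure-correct with 2 ≤? n
    ... | no ¬2≤n = _ ,
      run-weaken (≤-trans (m≤m+n 9 31) (m≤n+m 40 (n * 40)))
        (run-if-false (trans (cong (_∸ 1) σ₀0) (m≤n⇒m∸n≡0 n≤1)) (run-assign {t = 4} refl refl (m≤m+n 3 1))) ,
      record
        { order = σ₀0
        ; positive = s≤s z≤n
        ; enough = ≤-trans (+-mono-≤ (*-mono-≤ n≤1 n≤1) (*-monoˡ-≤ k n≤1)) (≤-reflexive (cong suc (+-identityʳ k)))
        ; unaffected = λ a 2≤a → update-other σ₀ {1} (suc k) λ { refl → <-irrefl refl 2≤a }
        }
      where
      n≤1 : n ≤ 1
      n≤1 = ≤-pred (≰⇒> ¬2≤n)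
    ... | yes 2≤n = finish (countdown 2≤n n 0 {σ₁} (trans (update-other σ₀ n (≢+2 0 (s≤s z≤n))) σ₀0)
        (trans (update-other σ₀ n (≢+2 1 (s≤s (s≤s z≤n)))) σ₀1) (update-same σ₀ (n + 2) n)
        (λ a _ p → update-other σ₀ n λ q → p (≡-sym q)))
      where
      ≢+2 : ∀ a → a < 2 → n + 2 ≢ a
      ≢+2 a lt refl = <-irrefl refl (≤-trans lt (m≤n+m 2 n))
      σ₁ : Memory
      σ₁ = σ₀ [ n + 2 ↦ n ]
      finish : (∃[ τ ] Run _ σ₁ (n * 40 + 10) τ × τ 0 ≡ n × τ 1 ≡ 0 + n * (n + k) × (∀ a → 2 ≤ a → τ a ≡ σ₀ a)) → _
      finish (τ , run , τ0 , τ1 , τo) = τ ,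
        run-weaken (≤-trans (≤-reflexive (solve 1 (λ y → κ 5 :+ (κ 10 :+ (y :+ κ 10)) := y :+ κ 25) refl (n * 40))) (+-monoʳ-≤ (n * 40) (m≤m+n 25 15)))
          (run-if-true (λ z → m>n⇒m∸n≢0 2≤n (trans (cong (_∸ 1) (≡-sym σ₀0)) z))
            (run-seq (run-assign {t = 10} (cong (_+ 2) σ₀0) σ₀0 (m≤m+n 7 3)) run)) ,
        record
          { order = τ0
          ; positive = ≤-trans (*-mono-≤ {1} {n} (≤-trans (n≤1+n 1) 2≤n) (≤-trans (≤-trans (n≤1+n 1) 2≤n) (m≤m+n n k))) (≤-reflexive (≡-sym τ1))
          ; enough = ≤-reflexive (trans (≡-sym (*-distribˡ-+ n n k)) (≡-sym τ1))
          ; unaffected = τo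
          }
        where open +-*-Solver using (solve; _:=_; _:+_) renaming (con to κ)

-- A complete run of the program

module Execution (k q : ℕ) {n : ℕ} {σ₀ : Memory} (σ₀0 : σ₀ 0 ≡ n) (σ₀1 : σ₀ 1 ≡ 0) (σ₀c : 2 ≤ n → σ₀ (n + 2) ≡ 0)
                 (σ₀-end : ∀ a → 1 + (n * n + n * k) ≤ a → σ₀ a ≡ 0) where
  open Terms k q
  open Algorithm k q

  I : ℕ → ℕ
  I a = σ₀ (suc a)

  -- `X₁` is the number of rounds before `enlarge`, `X` afterwards. Numbers from the power up to X
  -- are harmless: only the lowest `slots` digits are read, so they are further codes of the same
  -- states.
  X₁ X : ℕ
  X₁ = n + padding
  X = suc n ^ slots + X₁

  executionTime : ℕ
  executionTime = (n * 40 + 40) + ((10 + (10 + (10 + 10))) + ((time X₁ powerT + 20) +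
    ((10 + ((X * suc X + X) * (time X okT + 60) + 20)) + (time X aliveT + 20))))

  private
    k≤P : k ≤ padding
    k≤P = ≤-trans (≤-trans (m≤m+n k q) (m≤n+m (k + q) slots)) (n≤1+n _)
    q≤P : q ≤ padding
    q≤P = ≤-trans (≤-trans (m≤n+m q k) (m≤n+m (k + q) slots)) (n≤1+n _)
    m≤P : slots ≤ padding
    m≤P = ≤-trans (m≤m+n slots (k + q)) (n≤1+n _)
    P≤X₁ : padding ≤ X₁
    P≤X₁ = m≤n+m padding n
    X₁≤X : X₁ ≤ X
    X₁≤X = m≤n+m X₁ (suc n ^ slots)
    P≤X : padding ≤ X
    P≤X = ≤-trans P≤X₁ X₁≤X
    n<X₁ : suc n ≤ X₁
    n<X₁ = ≤-trans (≤-reflexive (+-comm 1 n)) (+-monoʳ-≤ n (s≤s z≤n))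

  power≤X : suc n ^ slots ≤ X
  power≤X = m≤m+n _ X₁

  module _ (s : ℕ) (positive : 1 ≤ s) (enough : n * n + n * k ≤ s) where

    outside : ∀ a → suc s ≤ suc a → I a ≡ 0
    outside a le = σ₀-end (suc a) (≤-trans (s≤s enough) le)

    open Loop n (suc s) X I (s≤s z≤n) outside (≤-trans k≤P P≤X) (≤-trans q≤P P≤X) (≤-trans m≤P P≤X) (≤-trans (<⇒≤ n<X₁) X₁≤X) public

    -- The compiler is used for two numbers of rounds; this instance serves the computation of the
    -- power.
    module Small = Correctness (suc s) X₁ I outside

    allocate-correct : ∀ {σ} → σ 0 ≡ n → σ 1 ≡ s → (∀ a → 2 ≤ a → σ a ≡ σ₀ a) →
      ∃[ τ ] Run allocate σ (10 + (10 + (10 + 10))) τ × Small.Holds (λ _ → 0) τ × τ (suc s + 1) ≡ n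
    allocate-correct {σ} σ0 σ1 rest = μ₄ ,
      run-seq (run-assign {t = 10} (trans (cong (_+ 2) σ1) (+-comm s 2)) σ0 (m≤m+n 7 3))
        (run-seq (run-assign {t = 10} (trans (cong (_+ 1) σ1) (+-comm s 1)) (cong (_+ padding) σ0) (m≤m+n 9 1))
          (run-seq (run-assign {t = 10} refl (trans (cong (_+ 1) (trans (update-other μ₁ X₁ (λ p → 1≢s p)) σ1)) (+-comm s 1)) (m≤m+n 6 4))
            (run-assign {t = 10} refl refl (m≤m+n 3 7)))) ,
      record
        { holds-base = refl
        ; holds-bound = trans (cong μ₄ (+-identityʳ (suc s))) first
        ; holds-input = inputs
        ; holds-table = λ j → trans (cong μ₄ (shift j)) (trans (beyond (Mpred + j)) (σ₀-end _ (s≤s (≤-trans enough (≤-trans (m≤m+n s _) (≤-trans (n≤1+n _) (n≤1+n _)))))))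
        } ,
      trans (cong (λ a → μ₄ (suc a)) (+-comm s 1)) second
      where
      μ₁ μ₂ μ₃ μ₄ : Memory
      μ₁ = σ [ suc (suc s) ↦ n ]
      μ₂ = μ₁ [ suc s ↦ X₁ ]
      μ₃ = μ₂ [ 0 ↦ suc s ]
      μ₄ = μ₃ [ 1 ↦ 0 ]
      1≢s : suc s ≢ 1
      1≢s p = <-irrefl (≡-sym (suc-injective p)) positive
      first : μ₄ (suc s) ≡ X₁
      first = trans (update-other μ₃ 0 (λ p → 1≢s (≡-sym p))) (update-same μ₁ (suc s) X₁)
      second : μ₄ (suc (suc s)) ≡ n
      second = trans (update-other μ₁ {suc s} X₁ (λ p → 1+n≢n (≡-sym p))) (update-same σ (suc (suc s)) n)
      Mpred : ℕ
      Mpred = suc (size okT + (size powerT + size aliveT))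
      shift : ∀ j → suc s + (M + j) ≡ suc (suc (suc s)) + (Mpred + j)
      shift j = cong suc (trans (+-suc s _) (cong suc (+-suc s _)))
      beyond : ∀ j → μ₄ (suc (suc (suc s)) + j) ≡ σ₀ (suc (suc (suc s)) + j)
      beyond j = trans (update-other μ₁ {suc s} X₁ λ p → <-irrefl (suc-injective p) (s≤s (≤-trans (m≤m+n s j) (n≤1+n _))))
        (trans (update-other σ {suc (suc s)} n λ p → <-irrefl (suc-injective (suc-injective p)) (s≤s (m≤m+n s j)))
          (rest _ (s≤s (s≤s z≤n))))
      inputs : ∀ a → suc a < suc s → μ₄ (suc a) ≡ I a
      inputs zero _ = ≡-sym σ₀1
      inputs (suc a) lt = trans (update-other μ₁ {suc s} X₁ λ p → <-irrefl (≡-sym p) lt)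
        (trans (update-other σ {suc (suc s)} n λ p → <-irrefl (≡-sym p) (m≤n⇒m≤1+n lt)) (rest _ (s≤s (s≤s z≤n))))

    enlarge-correct : ∀ {σ} → Small.Holds (λ _ → 0) σ → σ (suc s + 1) ≡ n →
      ∃[ τ ] Run enlarge σ (time X₁ powerT + 20) τ × Holds (λ _ → 0) τ × τ (suc s + 1) ≡ n
    enlarge-correct {σ} h order = finish (Small.code-correct (s≤s z≤n) powerT {1 ∷ []} {n ∷ []} {3} (s≤s z≤n)
        (Small.below-cons (s≤s (s≤s z≤n)) (Small.below λ ()))
        (+-monoʳ-≤ 3 (≤-trans (m≤m+n (size powerT) (size aliveT)) (m≤n+m _ (size okT)))) h
        (Small.env-cons order (Small.env λ ())))
      where
      finish : Small.Outcome (s≤s z≤n) (code powerT (1 ∷ []) 3) 3 σ (time X₁ powerT) _ →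
        ∃[ τ ] Run enlarge σ (time X₁ powerT + 20) τ × Holds (λ _ → 0) τ × τ (suc s + 1) ≡ n
      finish (Small.outcome {σ₁} run framed value) = σ₂ ,
        run-seq run (run-assign {t = 20} target newX (m≤m+n 16 4)) ,
        record
          { holds-base = trans (other {0} λ ()) (Small.Holds.holds-base h₁)
          ; holds-bound = trans (cong σ₂ (+-identityʳ (suc s))) (update-same σ₁ (suc s) X)
          ; holds-input = λ a lt → trans (other λ p → <-irrefl (≡-sym p) lt) (Small.Holds.holds-input h₁ a lt)
          ; holds-table = λ j → trans (other λ p → m≢1+m+n (suc s) (trans p (+-suc (suc s) _))) (Small.Holds.holds-table h₁ j)
          } ,
        trans (other λ p → m≢1+m+n (suc s) (trans p (trans (+-comm (suc s) 1) (cong suc (≡-sym (+-identityʳ (suc s)))))))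
          (trans (Small.frame-reg framed (s≤s (s≤s z≤n))) order)
        where
        h₁ = Small.frame-holds {3} (s≤s z≤n) (s≤s z≤n) framed h
        σ₂ : Memory
        σ₂ = σ₁ [ suc s ↦ X ]
        other : ∀ {a} → suc s ≢ a → σ₂ a ≡ σ₁ a
        other p = update-other σ₁ X p
        target : ⟦ mem (lit 0) ⊕ lit 0 ⟧ σ₁ ≡ suc s
        target = trans (+-identityʳ _) (Small.Holds.holds-base h₁)
        newX : ⟦ reg 3 ⊕ reg 0 ⟧ σ₁ ≡ X
        newX = cong₂ _+_
          (trans (Small.reg-value h₁ 3) (trans value
            (Specification.power-spec n X₁ I (λ _ → 0) (≤-trans m≤P P≤X₁) n<X₁)))
          (trans (Small.reg-value h₁ 0) (Small.Holds.holds-bound h₁))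

    module _ (J : (ℕ → ℕ) → Set) (J-kill : ∀ T t → t < X → J T → ¬ OK T t → J (T [ t ↦ 1 ])) (J-start : J (λ _ → 0)) where

      alive? : (ℕ → ℕ) → ℕ
      alive? T = Semantics.eval X I T aliveT (n ∷ [])

      prune-correct : ∀ {σ} → Holds (λ _ → 0) σ → σ (suc s + 1) ≡ n →
        ∃[ τ ] ∃[ T ] Run prune-table σ (10 + ((X * suc X + X) * (time X okT + 60) + 20)) τ × Progress J T X τ
      prune-correct {σ} h order = finish (loop J J-kill (X * suc X + X)
          (+-monoˡ-≤ X (*-monoˡ-≤ (suc X) (zeros-≤ X (λ _ → 0)))) start)
        where
        start : Progress J (λ _ → 0) 0 (σ [ σ 0 + 2 ↦ 0 ])
        start = record
          { holds = frame-holds {2} (s≤s z≤n) (s≤s z≤n) (set-frame {λ _ → 0} (s≤s z≤n) 0 h ≤-refl 3≤M) h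
          ; order = trans (set-other {λ _ → 0} (s≤s z≤n) 0 h λ ()) order
          ; position = set-value {λ _ → 0} (s≤s z≤n) 0 h
          ; t≤X = z≤n
          ; invariant = J-start
          ; checked = λ _ ()
          }
        finish : _ → _
        finish (τ , T , run , pr) = τ , T , run-seq (run-assign {t = 10} refl refl (m≤m+n 6 4)) run , pr

      answer-correct : ∀ {T σ} → Progress J T X σ →
        ∃[ τ ] Run answer σ (time X aliveT + 20) τ × τ 0 ≡ 1 ∸ (1 ∸ alive? T)
      answer-correct {T} {σ} pr = finish (code-correct (s≤s z≤n) aliveT {1 ∷ []} {n ∷ []} {3} (s≤s z≤n)
          (below-cons (s≤s (s≤s z≤n)) (below λ ()))
          (+-monoʳ-≤ 3 (≤-trans (m≤n+m (size aliveT) (size powerT)) (m≤n+m _ (size okT)))) (Progress.holds pr)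
          (env-cons (Progress.order pr) (env λ ())))
        where
        finish : Outcome (s≤s z≤n) (code aliveT (1 ∷ []) 3) 3 σ (time X aliveT) (alive? T) →
          ∃[ τ ] Run answer σ (time X aliveT + 20) τ × τ 0 ≡ 1 ∸ (1 ∸ alive? T)
        finish (outcome {σ₁} run framed value) = _ , run-seq run (run-assign {t = 20} refl refl (m≤m+n 11 9)) ,
          cong (λ x → 1 ∸ (1 ∸ x)) (trans (reg-value (frame-holds {3} (s≤s z≤n) (s≤s z≤n) framed (Progress.holds pr)) 3) value)

      progress-kept : ∀ {T σ} → Progress J T X σ → J T
      progress-kept = Progress.invariant

      progress-accepted : ∀ {T σ} → Progress J T X σ → ∀ t → t < X → OK T t
      progress-accepted = Progress.checked

  Accepted : (ℕ → ℕ) → ℕ → Set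
  Accepted T t = T t ≢ 0 ⊎ (Specification.Valid n X I T t × Specification.Move n X I T t)

  record Result (J : (ℕ → ℕ) → Set) : Set where
    field
      {memory} : Memory
      table    : ℕ → ℕ
      run      : Run algorithm σ₀ executionTime memory
      kept     : J table
      accepted : ∀ t → t < X → Accepted table t
      output   : memory 0 ≡ 1 ∸ (1 ∸ Semantics.eval X I table aliveT (n ∷ []))

  algorithm-correct : (J : (ℕ → ℕ) → Set) →
    (∀ T t → t < X → J T →
      ¬ Accepted T t → J (T [ t ↦ 1 ])) →
    J (λ _ → 0) → Result J
  algorithm-correct J J-kill J-start = with-measured (measure-correct σ₀0 σ₀1 σ₀c)
    where
    with-measured : (∃[ τ ] Run measure σ₀ (n * 40 + 40) τ × Measured n σ₀ τ) → Result J
    with-measured (σ₁ , run₁ , ms) = with-allocated (allocate-correct (σ₁ 1) positive enough (Measured.order ms) refl (Measured.unaffected ms))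
      where
      positive = Measured.positive ms
      enough = Measured.enough ms
      with-allocated : _ → Result J
      with-allocated (σ₂ , run₂ , h₂ , o₂) = with-enlarged (enlarge-correct (σ₁ 1) positive enough h₂ o₂)
        where
        with-enlarged : _ → Result J
        with-enlarged (σ₃ , run₃ , h₃ , o₃) = with-pruned (prune-correct (σ₁ 1) positive enough J J-kill J-start h₃ o₃)
          where
          with-pruned : _ → Result J
          with-pruned (σ₄ , T , run₄ , pr) = with-answered (answer-correct (σ₁ 1) positive enough J J-kill J-start pr)
            where
            with-answered : _ → Result J
            with-answered (σ₅ , run₅ , out) = record
              { table = T
              ; run = run-seq run₁ (run-seq run₂ (run-seq run₃ (run-seq run₄ run₅)))
              ; kept = progress-kept (σ₁ 1) positive enough J J-kill J-start pr
              ; accepted = progress-accepted (σ₁ 1) positive enough J J-kill J-start pr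
              ; output = out
              }

-- Surviving states and colourings

load-++ˡ : ∀ xs ys {a} → a < length xs → load (xs ++ ys) a ≡ load xs a
load-++ˡ (x ∷ xs) ys {zero}  _ = refl
load-++ˡ (x ∷ xs) ys {suc a} (s≤s lt) = load-++ˡ xs ys lt

load-++ʳ : ∀ xs ys a → load (xs ++ ys) (length xs + a) ≡ load ys a
load-++ʳ [] ys a = refl
load-++ʳ (x ∷ xs) ys a = load-++ʳ xs ys a

load-end : ∀ xs {a} → length xs ≤ a → load xs a ≡ 0
load-end [] _ = refl
load-end (x ∷ xs) (s≤s le) = load-end xs le

load-tabulate : ∀ {n} (f : Fin n → ℕ) i → load (tabulate f) (toℕ i) ≡ f i
load-tabulate f zero = refl
load-tabulate f (suc i) = load-tabulate (λ i → f (suc i)) i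

rows : ∀ {n w} → (Fin n → Fin w → ℕ) → List ℕ
rows g = concat (tabulate λ u → tabulate (g u))

length-rows : ∀ {n w} (g : Fin n → Fin w → ℕ) → length (rows g) ≡ n * w
length-rows {zero} g = refl
length-rows {suc n} {w} g = trans (length-++ (tabulate (g zero)))
  (cong₂ _+_ (length-tabulate (g zero)) (length-rows (λ u → g (suc u))))

load-rows : ∀ {n w} (g : Fin n → Fin w → ℕ) u v → load (rows g) (toℕ u * w + toℕ v) ≡ g u v
load-rows {suc n} {w} g zero v = trans
  (load-++ˡ (tabulate (g zero)) _ (subst (toℕ v <_) (≡-sym (length-tabulate (g zero))) (toℕ<n v))) (load-tabulate (g zero) v)
load-rows {suc n} {w} g (suc u) v = trans
  (cong (load (rows g)) (trans (+-assoc w (toℕ u * w) (toℕ v)) (cong (_+ (toℕ u * w + toℕ v)) (≡-sym (length-tabulate (g zero))))))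
  (trans (load-++ʳ (tabulate (g zero)) _ (toℕ u * w + toℕ v)) (load-rows (λ u → g (suc u)) u v))

fresh : ∀ {q} (js : List (Fin q)) → length js < q → ∃[ j ] j ∉ˡ js
fresh {q} js lt with any? (λ j → ¬? (memberˡ? _≟ᶠ_ j js))
... | yes p = p
... | no ¬p = contradiction (pigeonhole lt λ j → Any.index (member j)) λ (i , j , i<j , eq) → <-irrefl
  (cong toℕ (trans (lookup-index (member i)) (trans (cong (lookup js) eq) (≡-sym (lookup-index (member j)))))) i<j
  where
  member : ∀ j → j ∈ˡ js
  member j = decidable-stable (memberˡ? _≟ᶠ_ j js) λ ¬m → ¬p (j , ¬m)

bit-zero : ∀ {b} → bit b ≡ 0 → b ≡ false
bit-zero {false} _ = refl

bit-nonzero : ∀ {b} → bit b ≢ 0 → b ≡ true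
bit-nonzero {true} _ = refl
bit-nonzero {false} p = contradiction refl p

module Instance {k n : ℕ} (q : ℕ) (G : Graph (Fin n)) (L : Fin n → Subset k) where

  private
    adjBit : Fin n → Fin n → ℕ
    adjBit u v = bit (adj G u v)
    listBit : Fin n → Fin k → ℕ
    listBit v c = bit (lookᵛ (L v) c)
    adjacency lists : List ℕ
    adjacency = rows adjBit
    lists = rows listBit

  cell : ℕ → ℕ
  cell = load (adjacency ++ lists)

  adj-cell : ∀ u v → cell (toℕ u * n + toℕ v) ≡ bit (adj G u v)
  adj-cell u v = trans (load-++ˡ adjacency lists (subst (toℕ u * n + toℕ v <_) (≡-sym (length-rows adjBit)) bound)) (load-rows adjBit u v)
    where
    bound : toℕ u * n + toℕ v < n * n
    bound = ≤-trans (≤-trans (≤-reflexive (≡-sym (+-suc (toℕ u * n) (toℕ v)))) (+-monoʳ-≤ (toℕ u * n) (toℕ<n v)))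
      (≤-trans (≤-reflexive (+-comm (toℕ u * n) n)) (*-monoˡ-≤ n (toℕ<n u)))

  list-cell : ∀ v c → cell (n * n + toℕ v * k + toℕ c) ≡ bit (lookᵛ (L v) c)
  list-cell v c = trans (cong cell (trans (+-assoc (n * n) _ _) (cong (_+ (toℕ v * k + toℕ c)) (≡-sym (length-rows adjBit)))))
    (trans (load-++ʳ adjacency lists (toℕ v * k + toℕ c)) (load-rows listBit v c))

  cell-end : ∀ a → n * n + n * k ≤ a → cell a ≡ 0
  cell-end a le = load-end (adjacency ++ lists) (subst (_≤ a)
    (≡-sym (trans (length-++ adjacency) (cong₂ _+_ (length-rows adjBit) (length-rows listBit)))) le)

  first-cell : cell 0 ≡ 0
  first-cell = corner refl
    where
    corner : ∀ {m} → n ≡ m → cell 0 ≡ 0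
    corner {zero} eq = cell-end 0 (≤-reflexive (cong (λ m → m * m + m * k) eq))
    corner {suc m} eq = trans (cong (λ i → cell (i * n + i)) (≡-sym z)) (trans (adj-cell u u) (cong bit (irrefl G u)))
      where
      lt : 0 < n
      lt = subst (0 <_) (≡-sym eq) (s≤s z≤n)
      u : Fin n
      u = fromℕ< lt
      z : toℕ u ≡ 0
      z = toℕ-fromℕ< lt

  second-cell : 2 ≤ n → input G L (n + 2) ≡ 0
  second-cell lt = trans (cong (input G L) (+-suc n 1)) (trans (cong cell (trans (cong (_+ 1) (≡-sym (+-identityʳ n))) (cong (λ i → i * n + i) (≡-sym o))))
    (trans (adj-cell u u) (cong bit (irrefl G u))))
    where
    u : Fin n
    u = fromℕ< lt
    o : toℕ u ≡ 1
    o = toℕ-fromℕ< lt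

  input-end : ∀ a → 1 + (n * n + n * k) ≤ a → input G L a ≡ 0
  input-end (suc a) (s≤s le) = cell-end a le

  open Execution k q {n} {input G L} refl first-cell second-cell input-end public

  open Terms k q using (index; slot; index-bound; aliveT)

  Valid : ℕ → Set
  Valid = Terms.Specification.Valid k q n X I (λ _ → 0)

  Move : (ℕ → ℕ) → ℕ → Set
  Move T = Terms.Specification.Move k q n X I T

  index-injective : ∀ {c c′ : Fin k} {j j′ : Fin q} → index (toℕ c) (toℕ j) ≡ index (toℕ c′) (toℕ j′) → c ≡ c′ × j ≡ j′
  index-injective {c} {c′} {j} {j′} eq = combine-injective c j c′ j′
    (toℕ-injective (trans (toℕ-combine c j) (trans eq (≡-sym (toℕ-combine c′ j′)))))

  Acceptable : (ℕ → ℕ) → Set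
  Acceptable T = ∀ t → t < X → T t ≢ 0 ⊎ (Valid t × Move T t)

  module States {T : ℕ → ℕ} (acceptable : Acceptable T) where

    Contains : ℕ → Entry n k → Set
    Contains t (v , c) = ∃[ j ] slot n (toℕ c) (toℕ {q} j) t ≡ toℕ v

    contains? : ∀ t e → Dec (Contains t e)
    contains? t (v , c) = any? λ j → slot n (toℕ c) (toℕ j) t ≟ toℕ v

    Live : List (Entry n k) → Set
    Live π = ∃[ t ] t < X × T t ≡ 0 × All (Contains t) π

    good : ∀ {t} → t < X → T t ≡ 0 → Valid t × Move T t
    good {t} lt eq with acceptable t lt
    ... | inj₁ p = contradiction eq p
    ... | inj₂ p = p

    positions : ∀ {t} c {π} → All (Contains t) π → List (Fin q)
    positions c [] = []
    positions c {(v , c′) ∷ π} ((j , _) ∷ W) with c′ ≟ᶠ c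
    ... | yes _ = j ∷ positions c W
    ... | no  _ = positions c W

    positions-length : ∀ {t} c {π} (W : All (Contains t) π) → length (positions c W) ≡ tally c π
    positions-length c [] = refl
    positions-length c {(v , c′) ∷ π} (_ ∷ W) with c′ ≟ᶠ c
    ... | yes _ = cong suc (positions-length c W)
    ... | no  _ = positions-length c W

    moved : ∀ {t t′} (c : Fin k) (j : Fin q) →
      (∀ i → i < k * q → i ≢ index (toℕ c) (toℕ j) → digit n i t′ ≡ digit n i t) →
      ∀ {π} (W : All (Contains t) π) → j ∉ˡ positions c W → All (Contains t′) π
    moved c j same [] _ = []
    moved c j same {(v , c′) ∷ π} ((j′ , eq) ∷ W) fresh with c′ ≟ᶠ c
    ... | yes refl = (j′ , trans (same _ (index-bound (toℕ<n c) (toℕ<n j′)) λ p →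
        fresh (here (≡-sym (proj₂ (index-injective {c} {c} {j′} {j} p))))) eq) ∷ moved c j same W λ j∈ → fresh (there j∈)
    ... | no c′≢c = (j′ , trans (same _ (index-bound (toℕ<n c′) (toℕ<n j′)) λ p →
        c′≢c (proj₁ (index-injective {c′} {c} {j′} {j} p))) eq) ∷ moved c j same W fresh

    -- The state itself may be full. As `π` has fewer than q entries of the colour, some slot of
    -- that colour witnesses none of them and can be overwritten.
    extend : ∀ {π} → Live π → (∀ c → tally c π < q) → ∀ v → ∃[ c ] Live ((v , c) ∷ π)
    extend {π} (t , t< , alive , W) room v with proj₂ (good t< alive) (toℕ v) (toℕ<n v)
    ... | c , c<k , moves with fresh (positions (fromℕ< c<k) W) (subst (_< q) (≡-sym (positions-length (fromℕ< c<k) W)) (room (fromℕ< c<k)))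
    ...   | j , j∉ with moves (toℕ j) (toℕ<n j)
    ...     | t′ , t′< , alive′ , change = fromℕ< c<k , t′ , t′< , alive′ ,
      (j , proj₁ (change′ _ (index-bound (toℕ<n (fromℕ< c<k)) (toℕ<n j))) refl) ∷
      moved (fromℕ< c<k) j (λ i i< → proj₂ (change′ i i<)) W j∉
      where
      change′ : ∀ i → i < k * q → (i ≡ index (toℕ (fromℕ< c<k)) (toℕ j) → digit n i t′ ≡ toℕ v) ×
        (i ≢ index (toℕ (fromℕ< c<k)) (toℕ j) → digit n i t′ ≡ digit n i t)
      change′ = subst (λ c → ∀ i → i < k * q → (i ≡ index c (toℕ j) → digit n i t′ ≡ toℕ v) ×
        (i ≢ index c (toℕ j) → digit n i t′ ≡ digit n i t)) (≡-sym (toℕ-fromℕ< c<k)) change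

    family : Family q G L
    family = record
      { Live   = Live
      ; live?  = λ π → anyUpTo? (λ t → (T t ≟ 0) ×-dec All.all? (contains? t) π) X
      ; sub    = λ ρ⊆π (t , t< , alive , W) → t , t< , alive , All.tabulate λ e∈ → All.lookup W (ρ⊆π e∈)
      ; extend = extend
      ; proper = proper
      ; listed = listed
      }
      where
      proper : ∀ {π u v c} → Live π → (u , c) ∈ˡ π → (v , c) ∈ˡ π → adj G u v ≡ false
      proper {u = u} {v} {c} (t , t< , alive , W) u∈ v∈ with All.lookup W u∈ | All.lookup W v∈
      ... | j , p | j′ , p′ = bit-zero (trans (≡-sym (adj-cell u v))
        (trans (cong₂ (λ x y → cell (x * n + y)) (≡-sym p) (≡-sym p′))
          (proj₂ (proj₁ (good t< alive) (toℕ c) (toℕ<n c) (toℕ j) (toℕ<n j) (subst (_< n) (≡-sym p) (toℕ<n u)))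
            (toℕ j′) (toℕ<n j′) (subst (_< n) (≡-sym p′) (toℕ<n v)))))
      listed : ∀ {π v c} → Live π → (v , c) ∈ˡ π → c ∈ L v
      listed {v = v} {c} (t , t< , alive , W) v∈ with All.lookup W v∈
      ... | j , p = lookup⇒[]= c (L v) (bit-nonzero λ z →
        proj₁ (proj₁ (good t< alive) (toℕ c) (toℕ<n c) (toℕ j) (toℕ<n j) (subst (_< n) (≡-sym p) (toℕ<n v)))
          (trans (cong (λ x → cell (n * n + x * k + toℕ c)) p) (trans (list-cell v c) z)))

  module _ (colouring : ListColourable G L) where
    private
      f : Fin n → Fin k
      f = proj₁ colouring

    Consistent : ℕ → Set
    Consistent t = ∀ c j → c < k → j < q → slot n c j t < n → ∃[ v ] slot n c j t ≡ toℕ v × c ≡ toℕ (f v)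

    consistent-valid : ∀ {t} → Consistent t → Valid t
    consistent-valid {t} consistent c c< j j< d< with consistent c j c< j< d<
    ... | v , p , refl = (λ z → contradiction (trans (≡-sym listed) (trans (cong (λ x → cell (n * n + x * k + toℕ (f v))) (≡-sym p)) z)) λ ()) , nonadjacent
      where
      listed : cell (n * n + toℕ v * k + toℕ (f v)) ≡ 1
      listed = trans (list-cell v (f v)) (cong bit ([]=⇒lookup (proj₁ (proj₂ colouring) v)))
      nonadjacent : ∀ j′ → j′ < q → slot n c j′ t < n → cell (slot n c j t * n + slot n c j′ t) ≡ 0
      nonadjacent j′ j′< d′< with consistent c j′ c< j′< d′<
      ... | v′ , p′ , eq = trans (cong₂ (λ x y → cell (x * n + y)) p p′) (trans (adj-cell v v′) (cong bit not-adjacent))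
        where
        not-adjacent : adj G v v′ ≡ false
        not-adjacent with true⊎false (adj G v v′)
        ... | inj₁ a = contradiction (toℕ-injective eq) (proj₂ (proj₂ colouring) v v′ a)
        ... | inj₂ a = a

    -- Each vertex moves with its own colour under `f`. Overwriting any slot of that colour gives a
    -- state that again agrees with `f` and is therefore undeleted.
    consistent-move : ∀ {T t} → (∀ u → u < X → Consistent u → T u ≡ 0) → Consistent t → Move T t
    consistent-move {T} {t} sound consistent x x< = toℕ (f v) , toℕ<n (f v) , λ j j< → target j j<
      where
      v : Fin n
      v = fromℕ< x<
      target : ∀ j → j < q → ∃[ t′ ] t′ < X × T t′ ≡ 0 ×
        (∀ i → i < k * q → (i ≡ index (toℕ (f v)) j → digit n i t′ ≡ x) × (i ≢ index (toℕ (f v)) j → digit n i t′ ≡ digit n i t))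
      target j j< = finish (from-digits n (k * q) δ λ i _ → δ≤n i)
        where
        δ : ℕ → ℕ
        δ i with i ≟ index (toℕ (f v)) j
        ... | yes _ = x
        ... | no  _ = digit n i t
        δ≤n : ∀ i → δ i ≤ n
        δ≤n i with i ≟ index (toℕ (f v)) j
        ... | yes _ = <⇒≤ x<
        ... | no  _ = digit-≤ n i t
        δ-new : ∀ i → i ≡ index (toℕ (f v)) j → δ i ≡ x
        δ-new i eq with i ≟ index (toℕ (f v)) j
        ... | yes _ = refl
        ... | no ¬p = contradiction eq ¬p
        δ-old : ∀ i → i ≢ index (toℕ (f v)) j → δ i ≡ digit n i t
        δ-old i neq with i ≟ index (toℕ (f v)) j
        ... | yes p = contradiction p neq
        ... | no  _ = refl
        finish : (∃[ t′ ] t′ < suc n ^ (k * q) × (∀ i → i < k * q → digit n i t′ ≡ δ i)) → _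
        finish (t′ , t′< , eq) = t′ , ≤-trans t′< power≤X , sound t′ (≤-trans t′< power≤X) consistent′ ,
          λ i i< → (λ p → trans (eq i i<) (δ-new i p)) , λ p → trans (eq i i<) (δ-old i p)
          where
          consistent′ : Consistent t′
          consistent′ c j′ c< j′< d< with index c j′ ≟ index (toℕ (f v)) j
          ... | no  p = subst (λ d → d < n → ∃[ w ] d ≡ toℕ w × c ≡ toℕ (f w))
            (≡-sym (trans (eq _ (index-bound c< j′<)) (δ-old _ p))) (consistent c j′ c< j′<) d<
          ... | yes p = v , trans (eq _ (index-bound c< j′<)) (trans (δ-new _ p) (≡-sym (toℕ-fromℕ< x<))) , same-colour
            where
            same-colour : c ≡ toℕ (f v)
            same-colour = trans (≡-sym (toℕ-fromℕ< c<)) (cong toℕ (proj₁ (index-injective {fromℕ< c<} {f v} {fromℕ< j′<} {fromℕ< j<}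
              (trans (cong₂ index (toℕ-fromℕ< c<) (toℕ-fromℕ< j′<)) (trans p (cong (index (toℕ (f v))) (≡-sym (toℕ-fromℕ< j<))))))))

    empty-state : ∃[ t ] t < X × Consistent t
    empty-state with from-digits n (k * q) (λ _ → n) (λ _ _ → ≤-refl)
    ... | t , t< , eq = t , ≤-trans t< power≤X , λ c j c< j< d< → contradiction (≤-trans d< (≤-reflexive (≡-sym (eq _ (index-bound c< j<))))) (<-irrefl refl)

  -- The loop invariant. It ranges over all colourings, so the run can be analysed before it is
  -- known whether one exists.
  Sound : (ℕ → ℕ) → Set
  Sound T = ∀ (colouring : ListColourable G L) t → t < X → Consistent colouring t → T t ≡ 0

  sound-kill : ∀ T t → t < X → Sound T → ¬ (T t ≢ 0 ⊎ (Valid t × Move T t)) → Sound (T [ t ↦ 1 ])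
  sound-kill T t t< sound bad colouring u u< consistent with t ≟ u
  ... | no  p    = trans (update-other T 1 p) (sound colouring u u< consistent)
  ... | yes refl = contradiction (inj₂ (consistent-valid colouring consistent , consistent-move colouring (sound colouring) consistent)) bad

  module Decision (c₀ : Fin k) (free : Free (bull ∷ chair ∷ []) G) (k*16+5≤q : k * 16 + 5 ≤ q)
                  (result : Result Sound) where
    open Result result

    verdict : ℕ
    verdict = Semantics.eval X cell table aliveT (n ∷ [])

    alive-spec : verdict ⊨ (∃[ t ] t < X × table t ≡ 0)
    alive-spec = Terms.Specification.alive-spec k q n X cell table

    answer : ∀ x → verdict ≡ x → ∃[ b ] Reflects (ListColourable G L) b × memory 0 ≡ bit b
    answer zero eq = false , ofⁿ not-colourable , trans output (cong (λ x → 1 ∸ (1 ∸ x)) eq)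
      where
      not-colourable : ¬ ListColourable G L
      not-colourable colouring with empty-state colouring
      ... | t , t< , consistent = proj₂ alive-spec (t , t< , kept colouring t t< consistent) eq
    answer (suc x) eq = true , ofʸ colourable , trans output (trans (cong (λ x → 1 ∸ (1 ∸ x)) eq) (cong (1 ∸_) (0∸n≡0 x)))
      where
      colourable : ListColourable G L
      colourable with proj₁ alive-spec (λ z → 1+n≢0 (trans (≡-sym eq) z))
      ... | t , t< , alive = Consistency.colourable G free L (States.family accepted) c₀ k*16+5≤q (t , t< , alive , [])

    decision : ∃[ t ] DecidesListColouring (Algorithm.algorithm k q) G L t × t ≤ executionTime
    decision = proj₁ run , (memory , proj₂ (proj₂ run) , answer verdict refl) , proj₁ (proj₂ run)

  decides : Fin k → Free (bull ∷ chair ∷ []) G → k * 16 + 5 ≤ q →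
    ∃[ t ] DecidesListColouring (Algorithm.algorithm k q) G L t × t ≤ executionTime
  decides c₀ free k*16+5≤q = Decision.decision c₀ free k*16+5≤q
    (algorithm-correct Sound sound-kill (λ _ _ _ _ → refl))

-- The running time

record Multiple (v x a : ℕ) : Set where
  constructor multiple
  field bounded : x ≤ a * v

open Multiple

merge : ∀ {v x y a b} → Multiple v x a → Multiple v y b → Multiple v (x + y) (a + b)
merge {v} {a = a} {b} (multiple p) (multiple q) = multiple (≤-trans (+-mono-≤ p q) (≤-reflexive (≡-sym (*-distribʳ-+ v a b))))

constant : ∀ {v} a → 1 ≤ v → Multiple v a a
constant a 1≤v = multiple (≤-trans (≤-reflexive (≡-sym (*-identityʳ a))) (*-monoʳ-≤ a 1≤v))

-- The exponents 2, 8 and 1 are the loop depths of `powerT`, `okT` and `aliveT`. The potential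
-- allows at most `X * W + X`, hence at most W^2, inspections of a state, each costing of order W^8;
-- this dominates everything else.
total-bound : ∀ {n W₁ X W p o a} s₁ s₂ s₃ → n < W → W₁ ≤ W → X < W →
  p ≤ s₁ * (60 * W₁ ^ 2) → o ≤ s₂ * (60 * W ^ 8) → a ≤ s₃ * (60 * W ^ 1) →
  Multiple (W ^ 10)
    ((n * 40 + 40) + (40 + ((p + 20) + ((10 + ((X * W + X) * (o + 60) + 20)) + (a + 20)))))
    (40 + (40 + ((s₁ * 60 + 20) + ((10 + ((s₂ * 60 + 60) + 20)) + (s₃ * 60 + 20)))))
total-bound {n} {W₁} {X} {W} {p} {o} {a} s₁ s₂ s₃ n<W W₁≤W X<W p≤ o≤ a≤ =
  merge first (merge (constant 40 1≤V) (merge (merge power (constant 20 1≤V))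
    (merge (merge (constant 10 1≤V) (merge main (constant 20 1≤V))) (merge final (constant 20 1≤V)))))
  where
  V : ℕ
  V = W ^ 10
  W≢0 : NonZero W
  W≢0 = >-nonZero (≤-trans (s≤s z≤n) X<W)
  1≤V : 1 ≤ V
  1≤V = m^n>0 W {{W≢0}} 10
  power≤V : ∀ {i} → i ≤ 10 → W ^ i ≤ V
  power≤V le = ^-monoʳ-≤ W {{W≢0}} le
  first : Multiple V (n * 40 + 40) 40
  first = multiple (≤-trans (≤-reflexive (trans (+-comm (n * 40) 40) (*-comm (suc n) 40)))
    (*-monoʳ-≤ 40 (≤-trans n<W (≤-trans (≤-reflexive (≡-sym (*-identityʳ W))) (power≤V {1} (s≤s z≤n))))))
  scaled : ∀ s {x} → x ≤ V → s * (60 * x) ≤ s * 60 * V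
  scaled s x≤ = ≤-trans (*-monoʳ-≤ s (*-monoʳ-≤ 60 x≤)) (≤-reflexive (≡-sym (*-assoc s 60 V)))
  power : Multiple V p (s₁ * 60)
  power = multiple (≤-trans p≤ (scaled s₁ (≤-trans (^-monoˡ-≤ 2 W₁≤W) (power≤V {2} (s≤s (s≤s z≤n))))))
  final : Multiple V a (s₃ * 60)
  final = multiple (≤-trans a≤ (scaled s₃ (power≤V {1} (s≤s z≤n))))
  main : Multiple V ((X * W + X) * (o + 60)) (s₂ * 60 + 60)
  main = multiple (≤-trans (*-mono-≤ rounds (bounded (merge {W ^ 8} {a = s₂ * 60} (multiple check) (constant 60 (m^n>0 W {{W≢0}} 8)))))
    (≤-reflexive (trans (≡-sym (*-assoc (W * W) c (W ^ 8))) (trans (cong (_* W ^ 8) (*-comm (W * W) c))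
      (trans (*-assoc c (W * W) (W ^ 8)) (cong (c *_) (*-assoc W W (W ^ 8))))))))
    where
    rounds : X * W + X ≤ W * W
    rounds = ≤-trans (+-monoʳ-≤ (X * W) (<⇒≤ X<W)) (≤-trans (≤-reflexive (+-comm (X * W) W)) (*-monoˡ-≤ W X<W))
    check : o ≤ s₂ * 60 * W ^ 8
    check = ≤-trans o≤ (≤-reflexive (≡-sym (*-assoc s₂ 60 (W ^ 8))))
    c = s₂ * 60 + 60

n≤2^n : ∀ n → suc n ≤ 2 ^ n
n≤2^n zero = s≤s z≤n
n≤2^n (suc n) = ≤-trans (+-mono-≤ (m^n>0 2 n) (n≤2^n n)) (≤-reflexive (cong (2 ^ n +_) (≡-sym (+-identityʳ (2 ^ n)))))

-- All seven summands are at most n ^ (2 * k * q), and 7 ≤ n ^ 3.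
bound-power : ∀ {k q n} → 1 ≤ k → 1 ≤ q → 2 ≤ n →
  suc (suc n ^ (k * q) + (n + suc (k * q + (k + q)))) ≤ n ^ (3 + 2 * (k * q))
bound-power {k} {q} {n} 1≤k 1≤q 2≤n = ≤-trans seven (≤-trans (*-monoˡ-≤ P 7≤n³) (≤-reflexive (≡-sym (^-distribˡ-+-* n 3 (2 * m)))))
  where
  m P : ℕ
  m = k * q
  P = n ^ (2 * m)
  1≤m : 1 ≤ m
  1≤m = *-mono-≤ 1≤k 1≤q
  m<P : suc m ≤ P
  m<P = ≤-trans (n≤2^n m) (≤-trans (^-monoˡ-≤ m 2≤n) (^-monoʳ-≤ n {{nz}} (m≤m+n m (m + 0))))
    where nz = >-nonZero (≤-trans (s≤s z≤n) 2≤n)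
  sucn≤n² : suc n ≤ n ^ 2
  sucn≤n² = ≤-trans (+-mono-≤ {1} {n} (≤-trans (n≤1+n 1) 2≤n) ≤-refl)
    (≤-trans (≤-reflexive (cong (n +_) (≡-sym (+-identityʳ n)))) (≤-trans (*-monoˡ-≤ n 2≤n) (≤-reflexive (cong (n *_) (≡-sym (*-identityʳ n))))))
  power≤P : suc n ^ m ≤ P
  power≤P = ≤-trans (^-monoˡ-≤ m sucn≤n²) (≤-reflexive (^-*-assoc n 2 m))
  n≤P : n ≤ P
  n≤P = ≤-trans (≤-reflexive (≡-sym (*-identityʳ n))) (^-monoʳ-≤ n {{>-nonZero (≤-trans (s≤s z≤n) 2≤n)}} {1} (≤-trans 1≤m (m≤m+n m (m + 0))))
  1≤P : 1 ≤ P
  1≤P = ≤-trans (s≤s z≤n) m<P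
  m≤P : m ≤ P
  m≤P = ≤-trans (n≤1+n m) m<P
  k≤P : k ≤ P
  k≤P = ≤-trans (≤-trans (≤-reflexive (≡-sym (*-identityʳ k))) (*-monoʳ-≤ k 1≤q)) m≤P
  q≤P : q ≤ P
  q≤P = ≤-trans (≤-trans (≤-reflexive (≡-sym (*-identityˡ q))) (*-monoˡ-≤ q 1≤k)) m≤P
  7≤n³ : 7 ≤ n ^ 3
  7≤n³ = ≤-trans (n≤1+n 7) (^-monoˡ-≤ 3 2≤n)
  seven : 1 + (suc n ^ m + (n + (1 + (m + (k + q))))) ≤ 7 * P
  seven = ≤-trans (+-mono-≤ 1≤P (+-mono-≤ power≤P (+-mono-≤ n≤P (+-mono-≤ 1≤P (+-mono-≤ m≤P (+-mono-≤ k≤P q≤P))))))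
    (≤-reflexive (solve 1 (λ x → x :+ (x :+ (x :+ (x :+ (x :+ (x :+ x))))) := κ 7 :* x) refl P))

-- The left side is 320 k^2 + 100 k + 46, at most 466 k^2 for k ≥ 1. Here 16 comes from the constant
-- factor, 10 from `total-bound` and the inner factor from `bound-power`.
exponent-bound : ∀ k → 1 ≤ k → 16 + (3 + 2 * (k * (k * 16 + 5))) * 10 ≤ 470 * k ^ 2
exponent-bound (suc j) _ = ≤-trans (m≤m+n _ (200 * j + 4 + 150 * (j * j))) (≤-reflexive (solve 1 (λ j →
  κ 16 :+ (κ 3 :+ κ 2 :* ((κ 1 :+ j) :* ((κ 1 :+ j) :* κ 16 :+ κ 5))) :* κ 10 :+ (κ 200 :* j :+ κ 4 :+ κ 150 :* (j :* j))
    := κ 470 :* ((κ 1 :+ j) :* ((κ 1 :+ j) :* κ 1))) refl j))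

module _ (k : ℕ) (1≤k : 1 ≤ k) {n : ℕ} (G : Graph (Fin n)) (L : Fin n → Subset k) (2≤n : 2 ≤ n) where
  private
    q : ℕ
    q = k * 16 + 5

  open Terms k q
  open Algorithm k q using (M; time)
  open Instance q G L using (X; X₁; executionTime)

  private
    coefficient : ℕ
    coefficient = 40 + (40 + ((size powerT * 60 + 20) + ((10 + ((size okT * 60 + 60) + 20)) + (size aliveT * 60 + 20))))

    polynomial : ∀ C W → C ≤ 2 ^ 16 → W ≤ n ^ (3 + 2 * (k * q)) → C * W ^ 10 ≤ n ^ (470 * k ^ 2)
    polynomial C W C≤ W≤ = ≤-trans (*-mono-≤ {C} {2 ^ 16} {W ^ 10} C≤ (^-monoˡ-≤ 10 W≤))
      (≤-trans (*-mono-≤ (^-monoˡ-≤ 16 2≤n) (≤-reflexive (^-*-assoc n (3 + 2 * (k * q)) 10)))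
      (≤-trans (≤-reflexive (≡-sym (^-distribˡ-+-* n 16 ((3 + 2 * (k * q)) * 10))))
        (^-monoʳ-≤ n {{>-nonZero (≤-trans (s≤s z≤n) 2≤n)}} (exponent-bound k 1≤k))))

  execution-bound : executionTime ≤ n ^ (470 * k ^ 2)
  execution-bound = ≤-trans (bounded within)
    -- A constant has size 1 whatever its value, so the coefficient does not depend on `k` and is
    -- compared with 2^16 by evaluation.
    (polynomial coefficient (suc X) (≤ᵇ⇒≤ coefficient (2 ^ 16) tt) (bound-power 1≤k 1≤q 2≤n))
    where
    1≤q : 1 ≤ q
    1≤q = ≤-trans (s≤s z≤n) (m≤n+m 5 (k * 16))
    X₁≤X : X₁ ≤ X
    X₁≤X = m≤n+m X₁ (suc n ^ (k * q))
    n<W : n < suc X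
    n<W = s≤s (≤-trans (m≤m+n n _) X₁≤X)
    within : Multiple (suc X ^ 10) executionTime coefficient
    within = total-bound {n} {suc X₁} {X} {suc X} {time X₁ powerT} {time X okT} {time X aliveT}
      (size powerT) (size okT) (size aliveT) n<W (s≤s X₁≤X) ≤-refl
      (time-bound M X₁ powerT 2 ≤-refl) (time-bound M X okT 8 ≤-refl) (time-bound M X aliveT 1 ≤-refl)

-- One constant serves all `k`, while the program may depend on `k`. The time bound is stated from n
-- = 2 on because powers of 0 and 1 cannot absorb constant factors; smaller graphs are decided by
-- the same program.
corollary1p3 : ∃[ c ] ∀ (k : ℕ) → 3 ≤ k →
    ∃[ p ] ∀ (n : ℕ) (G : Graph (Fin n)) (L : Fin n → Subset k) →
    Free (bull ∷ chair ∷ []) G →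
    ∃[ t ] DecidesListColouring p G L t × (2 ≤ n → t ≤ n ^ (c * k ^ 2))
corollary1p3 = 470 , λ k 3≤k → Algorithm.algorithm k (k * 16 + 5) , λ n G L free → conclude k 3≤k G L
    (Instance.decides (k * 16 + 5) G L (fromℕ< 3≤k) free ≤-refl)
  where
  conclude : ∀ k → 3 ≤ k → ∀ {n} (G : Graph (Fin n)) (L : Fin n → Subset k) →
    (∃[ t ] DecidesListColouring (Algorithm.algorithm k (k * 16 + 5)) G L t × t ≤ Instance.executionTime (k * 16 + 5) G L) →
    ∃[ t ] DecidesListColouring (Algorithm.algorithm k (k * 16 + 5)) G L t × (2 ≤ n → t ≤ n ^ (470 * k ^ 2))
  conclude k 3≤k G L (t , decides , t≤) = t , decides , λ 2≤n →
    ≤-trans t≤ (execution-bound k (≤-trans (s≤s z≤n) 3≤k) G L 2≤n)
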